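{- For $k^2<\delta n$, any $\delta$-error randomized parity decision tree deciding the $k$-Hamming weight predicate $H^n_k$ on $\mathbb{F}_2^n$ has size $\exp\Omega(k\log(k/\delta))$; that is, $\log \mathrm{PS}_\delta(H^n_k)=\Omega(k\log(k/\delta))$.
   Context: $H^n_k\colon\mathbb{F}_2^n\to\{0,1\}$ equals $1$ iff its input has Hamming weight exactly $k$. A (deterministic) parity decision tree is a binary tree whose internal nodes are labeled by vectors $y\in\mathbb{F}_2^n$ and whose leaves are labeled by output bits; on input $x$ one walks from the root, at a node labeled $y$ going to the left child if $\langle x,y\rangle=0$ (inner product over $\mathbb{F}_2$) and to the right child otherwise, and outputs the label of the leaf reached. Its size is its total number of nodes. A $\delta$-error randomized parity decision tree for a predicate $P$ is a probability distribution over deterministic parity decision trees such that for every input $x$ the sampled tree outputs $P(x)$ with probability at least $1-\delta$; its size is the maximum size of a tree in the support. $\mathrm{PS}_\delta(P)$ is the minimum size of a $\delta$-error randomized parity decision tree computing $P$. Logarithms are base 2.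
   Formalization: The error is restricted to 0 < δ ≤ 1/3, since for δ = 1/2 mixing the two constant trees gives size 1 and the claim fails; k ≥ 1 is assumed so that log(k/δ) is defined; δ and the probabilities of the trees are rational. -}

module Defs where

open import Data.Bool using (Bool; true; false; _∧_; _xor_; if_then_else_; not)
open import Data.Nat using (ℕ; zero; suc; _+_; _⊔_; _≡ᵇ_)
open import Data.Vec using (Vec; []; _∷_; zipWith; foldr)
open import Data.List using (List; []; _∷_)
open import Data.Product using (_×_; _,_)
open import Data.Integer using (+_)
open import Data.Rational using (ℚ; 0ℚ; 1ℚ; _/_) renaming (_+_ to _+ℚ_; _*_ to _*ℚ_; _-_ to _-ℚ_; _≤_ to _≤ℚ_; _<_ to _<ℚ_)
open import Relation.Binary.PropositionalEquality using (_≡_)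
open import Data.Unit using (⊤)

F2^ : ℕ → Set
F2^ n = Vec Bool n

⟨_,_⟩ : ∀ {n} → F2^ n → F2^ n → Bool
⟨ x , y ⟩ = foldr _ _xor_ false (zipWith _∧_ x y)

weight : ∀ {n} → F2^ n → ℕ
weight []          = 0
weight (true ∷ x)  = suc (weight x)
weight (false ∷ x) = weight x

H : (n k : ℕ) → F2^ n → Bool
H n k x = weight x ≡ᵇ k

data PDT (n : ℕ) : Set where
  leaf : Bool → PDT n
  node : F2^ n → PDT n → PDT n → PDT n

eval : ∀ {n} → PDT n → F2^ n → Bool
eval (leaf b)     x = b
eval (node y l r) x = if ⟨ x , y ⟩ then eval r x else eval l x

size : ∀ {n} → PDT n → ℕ
size (leaf _)     = 1
size (node _ l r) = suc (size l + size r)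

toℚ : ℕ → ℚ
toℚ n = + n / 1

_^ℚ_ : ℚ → ℕ → ℚ
q ^ℚ zero  = 1ℚ
q ^ℚ suc k = q *ℚ (q ^ℚ k)

-- A randomized parity decision tree: a finitely supported probability
-- distribution over deterministic trees, given as a list of
-- (probability, tree) pairs.  All listed probabilities are required to be
-- strictly positive, so the list is exactly the support.
RPDT : ℕ → Set
RPDT n = List (ℚ × PDT n)

totalWeight : ∀ {n} → RPDT n → ℚ
totalWeight []            = 0ℚ
totalWeight ((p , _) ∷ R) = p +ℚ totalWeight R

AllPositive : ∀ {n} → RPDT n → Set
AllPositive []            = ⊤
AllPositive ((p , _) ∷ R) = (0ℚ <ℚ p) × AllPositive R

IsDistribution : ∀ {n} → RPDT n → Set
IsDistribution R = AllPositive R × (totalWeight R ≡ 1ℚ)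

probCorrect : ∀ {n} → (F2^ n → Bool) → RPDT n → F2^ n → ℚ
probCorrect P []            x = 0ℚ
probCorrect P ((p , t) ∷ R) x =
  (if not (eval t x xor P x) then p else 0ℚ) +ℚ probCorrect P R x

IsRandPDT : ∀ {n} → (F2^ n → Bool) → ℚ → RPDT n → Set
IsRandPDT {n} P δ R = IsDistribution R × ((x : F2^ n) → (1ℚ -ℚ δ) ≤ℚ probCorrect P R x)

rsize : ∀ {n} → RPDT n → ℕ
rsize []            = 0
rsize ((_ , t) ∷ R) = size t ⊔ rsize R

{-# OPTIONS --safe #-}
-- A leaf of a parity decision tree is an affine subspace; the number of k-tuples of coordinates
-- whose indicator sum lies in it is the number N k of k-step walks between two points of a Cayley
-- graph on F₂^r with n generators.  If N (k + 2) / n² and n² N (k - 2) are both O(δ) times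
-- N k, then N k / n^k is at most about (δ / k)^(k/16):
--   * By the interchange min (ab, cd)² ≤ (ad)(cb), the positions at times t and t - 2 of a random
--     k-walk have nearly disjoint laws.  Hence a (k + 2)-walk that backtracks one edge at time i
--     reveals i: the signs "on time" / "two steps behind" change there.  A queueing argument
--     tolerates a constant fraction of wrong signs, so such walks are distinct for different i,
--     which gains a factor k.
--   * A step v → w is small when v carries more than an h/n fraction of the walks to w.  Each w has
--     fewer than n/h small in-steps, so the walks weighted by h^(number of small steps) total at
--     most (2n)^k; if N k is not tiny then a typical walk has few small steps, and backtracking
--     a step that is small in neither direction costs only a factor h².
-- Summing over the accepting leaves (corruption), a mixture of few leaves that accepts most k-tuples
-- accepts too many (k ± 2)-tuples; k² < δ n keeps collisions among coordinates negligible.  Errors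
-- δ that are not small are handled by fixing most of the k ones and running the trees p times.
module Submission where

open import Defs
open import Data.Bool using (Bool; true; false; not; _xor_; _∧_; if_then_else_)
open import Data.Bool.Properties using (T-≡)
open import Data.Fin using (Fin; zero; suc; _↑ˡ_)
open import Data.Integer as ℤ using (+_; -[1+_])
import Data.Integer.Properties as ℤ
open import Data.List using (List; []; _∷_; _++_; map; length; allFin)
open import Data.List.Properties using (length-tabulate; map-tabulate)
open import Data.Nat renaming (_/_ to _div_)
import Data.Nat.Coprimality as Coprimality
open import Data.Nat.DivMod using (m/n*n≤m; m≡m%n+[m/n]*n; m%n<n)
open import Data.Nat.Properties
open import Data.Nat.Tactic.RingSolver using (solve-∀)
open import Data.Product using (Σ; _×_; _,_; ∃; proj₁; proj₂)
open import Data.Rational as ℚ using (ℚ; mkℚ; 0ℚ; 1ℚ; _/_; ↥_; ↧ₙ_; *≤*) renaming (_+_ to _+ℚ_; _*_ to _*ℚ_; _-_ to _-ℚ_; _≤_ to _≤ℚ_; _<_ to _<ℚ_)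
import Data.Rational.Properties as ℚ
open import Data.Rational.Solver using (module +-*-Solver)
import Data.Rational.Unnormalised as ℚᵘ
import Data.Rational.Unnormalised.Properties as ℚᵘ
open import Data.Vec using (Vec; []; _∷_; zipWith; replicate; lookup; _[_]%=_) renaming (_++_ to _⧺_)
open import Function using (_∘_; flip; id; Equivalence)
open import Relation.Binary.PropositionalEquality
open import Relation.Nullary using (Dec; yes; no; does; contradiction)
open import Relation.Nullary.Decidable using (¬?; from-yes; from-no)

-- Log-convexity of N would rule out the critical leaves at once, but it fails: for walks from the
-- origin to a single point of weight k, N k = k! while N (k - 2) = 0. The two growth hypotheses can
-- therefore only force N k to be tiny, and `near-log-convexity` argues by contradiction from 8
-- (2n)^k ≤ N k h^(q + 1). The exponent k/16 comes from two choices. Up to q, about k/8, small steps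
-- per walk are affordable. Backtracking gains k and loses 16 h², while the hypothesis on k + 2
-- grants only a factor 1/E; so h may grow up to (k E)^(1/2) / 4. With E of order 1/δ this makes
-- h^(k/8) of order (k/δ)^(k/16), up to c^k. Backtracking adds two steps, hence k ± 2: tuples of
-- those lengths have weights that must be rejected, so on average over leaves the growth hypotheses
-- are just correctness of the trees. No estimate depends on the codimension of a leaf; only the
-- number of leaves matters. All estimates live in the naturals with denominators multiplied out.
-- The conclusion k^k ≤ S^m δ^k is k log (k/δ) ≤ m log S.

∑ : {A : Set} → List A → (A → ℕ) → ℕ
∑ []       f = 0
∑ (x ∷ xs) f = f x + ∑ xs f

module _ {A : Set} where

  ∑-cong : ∀ xs {f g : A → ℕ} → (∀ x → f x ≡ g x) → ∑ xs f ≡ ∑ xs g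
  ∑-cong []       e = refl
  ∑-cong (x ∷ xs) e = cong₂ _+_ (e x) (∑-cong xs e)

  ∑-mono : ∀ xs {f g : A → ℕ} → (∀ x → f x ≤ g x) → ∑ xs f ≤ ∑ xs g
  ∑-mono []       e = z≤n
  ∑-mono (x ∷ xs) e = +-mono-≤ (e x) (∑-mono xs e)

  ∑-+ : ∀ xs (f g : A → ℕ) → ∑ xs (λ x → f x + g x) ≡ ∑ xs f + ∑ xs g
  ∑-+ []       f g = refl
  ∑-+ (x ∷ xs) f g rewrite ∑-+ xs f g = lemma (f x) (g x) (∑ xs f) (∑ xs g)
    where
    lemma : ∀ a b c d → a + b + (c + d) ≡ a + c + (b + d)
    lemma = solve-∀

  ∑-*ˡ : ∀ xs c (f : A → ℕ) → ∑ xs (λ x → c * f x) ≡ c * ∑ xs f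
  ∑-*ˡ []       c f = sym (*-zeroʳ c)
  ∑-*ˡ (x ∷ xs) c f rewrite ∑-*ˡ xs c f = sym (*-distribˡ-+ c (f x) (∑ xs f))

  ∑-*ʳ : ∀ xs c (f : A → ℕ) → ∑ xs (λ x → f x * c) ≡ ∑ xs f * c
  ∑-*ʳ xs c f = trans (∑-cong xs λ x → *-comm (f x) c) (trans (∑-*ˡ xs c f) (*-comm c (∑ xs f)))

  ∑-const : ∀ (xs : List A) c → ∑ xs (λ _ → c) ≡ length xs * c
  ∑-const []       c = refl
  ∑-const (x ∷ xs) c = cong (_+_ c) (∑-const xs c)

  ∑-zero : ∀ (xs : List A) → ∑ xs (λ _ → 0) ≡ 0
  ∑-zero xs = trans (∑-const xs 0) (*-zeroʳ (length xs))

  ∑-++ : ∀ xs ys (f : A → ℕ) → ∑ (xs ++ ys) f ≡ ∑ xs f + ∑ ys f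
  ∑-++ []       ys f = refl
  ∑-++ (x ∷ xs) ys f = trans (cong (_+_ (f x)) (∑-++ xs ys f)) (sym (+-assoc (f x) (∑ xs f) (∑ ys f)))

∑-map : ∀ {A B : Set} (g : A → B) xs (f : B → ℕ) → ∑ (map g xs) f ≡ ∑ xs (f ∘ g)
∑-map g []       f = refl
∑-map g (x ∷ xs) f = cong (_+_ (f (g x))) (∑-map g xs f)

∑-swap : ∀ {A B : Set} xs ys (f : A → B → ℕ) →
         ∑ xs (λ x → ∑ ys (f x)) ≡ ∑ ys (λ y → ∑ xs (λ x → f x y))
∑-swap []       ys f = sym (∑-zero ys)
∑-swap (x ∷ xs) ys f rewrite ∑-swap xs ys f = sym (∑-+ ys (f x) (λ y → ∑ xs (λ x′ → f x′ y)))

-- antidiagonal f t s = f t (s - 1) + f (t + 1) (s - 2) + … + f (t + s - 1) 0.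
antidiagonal : (ℕ → ℕ → ℕ) → ℕ → ℕ → ℕ
antidiagonal f t zero    = 0
antidiagonal f t (suc s) = f t s + antidiagonal f (suc t) s

antidiagonal-+ : ∀ f g t s →
  antidiagonal (λ a b → f a b + g a b) t s ≡ antidiagonal f t s + antidiagonal g t s
antidiagonal-+ f g t zero    = refl
antidiagonal-+ f g t (suc s) rewrite antidiagonal-+ f g (suc t) s =
  lemma (f t s) (g t s) (antidiagonal f (suc t) s) (antidiagonal g (suc t) s)
  where
  lemma : ∀ a b c d → a + b + (c + d) ≡ a + c + (b + d)
  lemma = solve-∀

antidiagonal-* : ∀ c f t s → antidiagonal (λ a b → c * f a b) t s ≡ c * antidiagonal f t s
antidiagonal-* c f t zero    = sym (*-zeroʳ c)
antidiagonal-* c f t (suc s) rewrite antidiagonal-* c f (suc t) s =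
  sym (*-distribˡ-+ c (f t s) (antidiagonal f (suc t) s))

antidiagonal-mono : ∀ k {f g} t s → t + s ≡ k → (∀ a b → suc (a + b) ≡ k → f a b ≤ g a b) →
                    antidiagonal f t s ≤ antidiagonal g t s
antidiagonal-mono k t zero    e le = z≤n
antidiagonal-mono k t (suc s) e le =
  +-mono-≤ (le t s (trans (sym (+-suc t s)) e)) (antidiagonal-mono k (suc t) s (trans (sym (+-suc t s)) e) le)

antidiagonal-const : ∀ c t s → antidiagonal (λ _ _ → c) t s ≡ s * c
antidiagonal-const c t zero    = refl
antidiagonal-const c t (suc s) = cong (_+_ c) (antidiagonal-const c (suc t) s)

antidiagonal-suc : ∀ f t s → antidiagonal f (suc t) s ≡ antidiagonal (f ∘ suc) t s
antidiagonal-suc f t zero    = refl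
antidiagonal-suc f t (suc s) = cong (_+_ (f (suc t) s)) (antidiagonal-suc f (suc t) s)

antidiagonal-snoc : ∀ f t s →
  antidiagonal f t (suc s) ≡ antidiagonal (λ a b → f a (suc b)) t s + f (t + s) 0
antidiagonal-snoc f t zero    rewrite +-identityʳ t = +-identityʳ (f t 0)
antidiagonal-snoc f t (suc s) rewrite antidiagonal-snoc f (suc t) s | +-suc t s =
  sym (+-assoc (f t (suc s)) _ _)

antidiagonal-flip : ∀ f s → antidiagonal f 0 s ≡ antidiagonal (flip f) 0 s
antidiagonal-flip f zero    = refl
antidiagonal-flip f (suc s) = begin
  f 0 s + antidiagonal f 1 s                 ≡⟨ cong (_+_ (f 0 s)) (antidiagonal-suc f 0 s) ⟩
  f 0 s + antidiagonal (f ∘ suc) 0 s         ≡⟨ cong (_+_ (f 0 s)) (antidiagonal-flip (f ∘ suc) s) ⟩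
  f 0 s + antidiagonal (flip (f ∘ suc)) 0 s  ≡⟨ +-comm (f 0 s) _ ⟩
  antidiagonal (flip (f ∘ suc)) 0 s + f 0 s  ≡⟨ antidiagonal-snoc (flip f) 0 s ⟨
  antidiagonal (flip f) 0 (suc s)            ∎
  where open ≡-Reasoning

-- Indicators and elementary inequalities

𝟙 : {P : Set} → Dec P → ℕ
𝟙 (yes _) = 1
𝟙 (no  _) = 0

𝟙≤1 : ∀ {P : Set} (p : Dec P) → 𝟙 p ≤ 1
𝟙≤1 (yes _) = ≤-refl
𝟙≤1 (no  _) = z≤n

𝟙*≤ : ∀ {P : Set} (p : Dec P) {a b} → (P → a ≤ b) → 𝟙 p * a ≤ b
𝟙*≤ (yes p) {a} a≤b = ≤-trans (≤-reflexive (*-identityˡ a)) (a≤b p)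
𝟙*≤ (no _)  _   = z≤n

-- Markov's inequality: every counted entry carries more than an h/n share of the total.
heavy-count : ∀ {A : Set} (xs : List A) n h (f : A → ℕ) →
              h * ∑ xs (λ x → 𝟙 (h * ∑ xs f <? n * f x)) ≤ n
heavy-count xs n h f with ∑ xs f in eq
-- A vanishing total cannot be cancelled; but a counted entry is positive, so nothing is counted.
... | zero = ≤-trans (≤-reflexive (trans (cong (h *_) none) (*-zeroʳ h))) z≤n
  where
  positive : ∀ y → h * 0 < n * y → 1 ≤ y
  positive zero    lt = contradiction (subst (h * 0 <_) (*-zeroʳ n) lt) n≮0
  positive (suc y) lt = s≤s z≤n
  none : ∑ xs (λ x → 𝟙 (h * 0 <? n * f x)) ≡ 0
  none = n≤0⇒n≡0 (≤-trans
    (∑-mono xs λ x → ≤-trans (≤-reflexive (sym (*-identityʳ _))) (𝟙*≤ (h * 0 <? n * f x) (positive (f x))))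
    (≤-reflexive eq))
... | S@(suc _) = *-cancelʳ-≤ _ _ S (begin
  h * ∑ xs (λ x → 𝟙 (h * S <? n * f x)) * S    ≡⟨ lemma h _ S ⟩
  ∑ xs (λ x → 𝟙 (h * S <? n * f x)) * (h * S)  ≡⟨ ∑-*ʳ xs (h * S) _ ⟨
  ∑ xs (λ x → 𝟙 (h * S <? n * f x) * (h * S))  ≤⟨ ∑-mono xs (λ x → 𝟙*≤ (h * S <? n * f x) <⇒≤) ⟩
  ∑ xs (λ x → n * f x)                          ≡⟨ ∑-*ˡ xs n f ⟩
  n * ∑ xs f                                    ≡⟨ cong (n *_) eq ⟩
  n * S                                         ∎)
  where
  open ≤-Reasoning
  lemma : ∀ a b c → a * b * c ≡ b * (a * c)
  lemma = solve-∀

1+n≤h^n : ∀ h → 2 ≤ h → ∀ n → 1 + n ≤ h ^ n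
1+n≤h^n h 2≤h zero    = ≤-refl
1+n≤h^n h 2≤h (suc n) = begin
  1 + suc n        ≤⟨ m≤m+n (2 + n) n ⟩
  2 + n + n        ≡⟨ lemma n ⟩
  2 * (1 + n)      ≤⟨ *-mono-≤ 2≤h (1+n≤h^n h 2≤h n) ⟩
  h * h ^ n        ∎
  where
  open ≤-Reasoning
  lemma : ∀ n → 2 + n + n ≡ 2 * (1 + n)
  lemma = solve-∀

-- Turns a bound on an exponential moment of s into one on its mean: the excess of s over q is at
-- most h^(s - q - 1).
linear≤exponential : ∀ h → 2 ≤ h → ∀ q s → h ^ suc q * s ≤ h ^ suc q * q + h ^ s
linear≤exponential h 2≤h q s with s ≤? q
... | yes s≤q = ≤-trans (*-monoʳ-≤ (h ^ suc q) s≤q) (m≤m+n _ _)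
... | no  s≰q with m≤n⇒∃[o]m+o≡n (≰⇒> s≰q)
...   | o , refl = begin
  hq * (suc q + o)          ≡⟨ lemma hq q o ⟩
  hq * q + hq * (1 + o)      ≤⟨ +-monoʳ-≤ (hq * q) (*-monoʳ-≤ hq (1+n≤h^n h 2≤h o)) ⟩
  hq * q + hq * h ^ o        ≡⟨ cong (_+_ (hq * q)) (sym (^-distribˡ-+-* h (suc q) o)) ⟩
  hq * q + h ^ (suc q + o)  ∎
  where
  open ≤-Reasoning
  hq = h ^ suc q
  lemma : ∀ a b c → a * (suc b + c) ≡ a * b + a * (1 + c)
  lemma = solve-∀

^-distribʳ-* : ∀ p m n → (m * n) ^ p ≡ m ^ p * n ^ p
^-distribʳ-* zero    m n = refl
^-distribʳ-* (suc p) m n = trans (cong (m * n *_) (^-distribʳ-* p m n)) (lemma m n (m ^ p) (n ^ p))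
  where
  lemma : ∀ a b c d → a * b * (c * d) ≡ a * c * (b * d)
  lemma = solve-∀

^-swap : ∀ x m n → (x ^ m) ^ n ≡ (x ^ n) ^ m
^-swap x m n = trans (^-*-assoc x m n) (trans (cong (x ^_) (*-comm m n)) (sym (^-*-assoc x n m)))

edge-bound : ∀ n h a a′ a* b b′ b* →
  n * n * (a * b) ≤ 4 * (h * h) * (a* * b*)
    + n * n * (𝟙 (h * a′ <? n * a) * (a * b) + 𝟙 (h * b′ <? n * b) * (b * a)
               + 𝟙 (2 * a* <? a′) * (a * b) + 𝟙 (2 * b* <? b′) * (a * b))
edge-bound n h a a′ a* b b′ b* =
  go (h * a′ <? n * a) (h * b′ <? n * b) (2 * a* <? a′) (2 * b* <? b′)
  where
  open ≤-Reasoning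
  X = 4 * (h * h) * (a* * b*)
  lemma : ∀ h a b → h * (2 * a) * (h * (2 * b)) ≡ 4 * (h * h) * (a * b)
  lemma = solve-∀
  lemma′ : ∀ n a b → n * n * (a * b) ≡ n * a * (n * b)
  lemma′ = solve-∀
  up : ∀ {x y} → x ≤ y → n * n * x ≤ X + n * n * y
  up x≤y = m≤n⇒m≤o+n X (*-monoʳ-≤ (n * n) x≤y)
  go : (p : Dec (h * a′ < n * a)) (q : Dec (h * b′ < n * b)) (r : Dec (2 * a* < a′)) (s : Dec (2 * b* < b′)) →
       n * n * (a * b) ≤ X + n * n * (𝟙 p * (a * b) + 𝟙 q * (b * a) + 𝟙 r * (a * b) + 𝟙 s * (a * b))
  go (yes _) q r s = up (m≤n⇒m≤n+o (𝟙 s * (a * b)) (m≤n⇒m≤n+o (𝟙 r * (a * b)) (m≤n⇒m≤n+o (𝟙 q * (b * a)) (≤-reflexive (sym (*-identityˡ (a * b)))))))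
  go (no _) (yes _) r s = up (m≤n⇒m≤n+o (𝟙 s * (a * b)) (m≤n⇒m≤n+o (𝟙 r * (a * b)) (≤-reflexive (trans (*-comm a b) (sym (*-identityˡ (b * a)))))))
  go (no _) (no _) (yes _) s = up (m≤n⇒m≤n+o (𝟙 s * (a * b)) (≤-reflexive (sym (*-identityˡ (a * b)))))
  go (no _) (no _) (no _) (yes _) = up (≤-reflexive (sym (*-identityˡ (a * b))))
  go (no p) (no q) (no r) (no s) = ≤-trans (begin
    n * n * (a * b)            ≡⟨ lemma′ n a b ⟩
    n * a * (n * b)            ≤⟨ *-mono-≤ (≮⇒≥ p) (≮⇒≥ q) ⟩
    h * a′ * (h * b′)          ≤⟨ *-mono-≤ (*-monoʳ-≤ h (≮⇒≥ r)) (*-monoʳ-≤ h (≮⇒≥ s)) ⟩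
    h * (2 * a*) * (h * (2 * b*)) ≡⟨ lemma h a* b* ⟩
    X                          ∎) (m≤m+n X _)

-- Charges a vertex where clean walks are a minority to its unclean walks, which then make up at
-- least half.
minority : ∀ a b {c} → a + b ≡ c → 𝟙 (2 * a <? c) * c ≤ 2 * b
minority a b refl = 𝟙*≤ (2 * a <? a + b) λ lt → begin
  a + b        ≤⟨ +-monoˡ-≤ b (<⇒≤ (+-cancelˡ-< a a b (≤-trans (≤-reflexive (cong (λ x → suc (a + x)) (sym (+-identityʳ a)))) lt))) ⟩
  b + b        ≡⟨ cong (_+_ b) (sym (+-identityʳ b)) ⟩
  2 * b        ∎
  where open ≤-Reasoning

geometric≤sum : ∀ m x y → m * m ≤ x * y → m ≤ x + y
geometric≤sum m x y le with m ≤? x + y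
... | yes m≤ = m≤
... | no  m≰ = contradiction (begin-strict
  x * y              ≤⟨ *-mono-≤ (m≤m+n x y) (m≤n+m y x) ⟩
  (x + y) * (x + y)  <⟨ *-mono-< (≰⇒> m≰) (≰⇒> m≰) ⟩
  m * m              ≤⟨ le ⟩
  x * y              ∎) (<-irrefl refl)
  where open ≤-Reasoning

-- The geometric mean of a d and n⁴ c b is at most their sum. The weight n⁴ balances the two: summed
-- over vertices, a d gives N (k + 2) and c b gives N (k - 2), whose hypotheses differ by exactly
-- this factor.
⊓-interchange : ∀ n a b c d → n * n * ((a * b) ⊓ (c * d)) ≤ a * d + n * n * (n * n * (c * b))
⊓-interchange n a b c d = geometric≤sum _ (a * d) (n * n * (n * n * (c * b))) (begin
  n * n * m * (n * n * m)                  ≡⟨ lemma n m ⟩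
  n * n * (n * n) * (m * m)                ≤⟨ *-monoʳ-≤ (n * n * (n * n)) (*-mono-≤ (m⊓n≤m (a * b) (c * d)) (m⊓n≤n (a * b) (c * d))) ⟩
  n * n * (n * n) * (a * b * (c * d))      ≡⟨ lemma′ n a b c d ⟩
  a * d * (n * n * (n * n * (c * b)))      ∎)
  where
  open ≤-Reasoning
  m = (a * b) ⊓ (c * d)
  lemma : ∀ n m → n * n * m * (n * n * m) ≡ n * n * (n * n) * (m * m)
  lemma = solve-∀
  lemma′ : ∀ n a b c d → n * n * (n * n) * (a * b * (c * d)) ≡ a * d * (n * n * (n * n * (c * b)))
  lemma′ = solve-∀

-- Queues

⟦_⟧ : Bool → ℕ
⟦ true  ⟧ = 1
⟦ false ⟧ = 0

-- Noise counts twice, so that no stretch of a walk looks clean from both of its ends.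
enqueue : Bool → ℕ → ℕ
enqueue true  q = 2 + q
enqueue false q = pred q

empty nonEmpty : ℕ → ℕ
empty    zero    = 1
empty    (suc _) = 0
nonEmpty zero    = 0
nonEmpty (suc _) = 1

empty+nonEmpty : ∀ q → empty q + nonEmpty q ≡ 1
empty+nonEmpty zero    = refl
empty+nonEmpty (suc q) = refl

-- Queue length as a potential: noise pays for its two queued units and for the present moment being
-- unclean; at a quiet moment the unit that leaves pays.
enqueue-potential : ∀ b q → nonEmpty (enqueue b q) + enqueue b q ≤ q + 3 * ⟦ b ⟧
enqueue-potential true  q             = ≤-reflexive (+-comm 3 q)
enqueue-potential false zero          = z≤n
enqueue-potential false (suc zero)    = z≤n
enqueue-potential false (suc (suc q)) = m≤m+n (2 + q) 0

below : ℕ → ℕ → ℕ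
below zero    r       = 1
below (suc q) zero    = 0
below (suc q) (suc r) = below q r

below-suc : ∀ q r → below q r ≤ below q (suc r)
below-suc zero    r       = ≤-refl
below-suc (suc q) zero    = z≤n
below-suc (suc q) (suc r) = below-suc q r

below-pred : ∀ q r → below (2 + q) r ≤ below q (pred r)
below-pred q zero    = z≤n
below-pred q (suc r) = below-drop q r
  where
  below-drop : ∀ q r → below (suc q) r ≤ below q r
  below-drop q       zero    = z≤n
  below-drop zero    (suc r) = ≤-refl
  below-drop (suc q) (suc r) = below-drop q r

below≤1 : ∀ q r → below q r ≤ 1
below≤1 zero    r       = ≤-refl
below≤1 (suc q) zero    = z≤n
below≤1 (suc q) (suc r) = below≤1 q r

-- A walk splits at most once into two parts whose queues are both empty: `below` bounds the
-- number of such splits still to come.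
split-potential : ∀ b q r →
  empty q * empty (enqueue (not b) r) + below (enqueue b q) r ≤ below q (enqueue (not b) r)
split-potential true  zero    zero          = ≤-refl
split-potential true  zero    (suc zero)    = ≤-refl
split-potential true  zero    (suc (suc r)) = below≤1 0 r
split-potential true  (suc q) r             = below-pred (suc q) r
split-potential false zero    r             = ≤-refl
split-potential false (suc q) r             = below-suc q r

⟦<⟧*≤⊓ : ∀ {x y} (p : Dec (x < y)) → ⟦ does p ⟧ * x ≤ x ⊓ y
⟦<⟧*≤⊓ {x} (yes x<y) = ⊓-glb (≤-reflexive (*-identityˡ x)) (≤-trans (≤-reflexive (*-identityˡ x)) (<⇒≤ x<y))
⟦<⟧*≤⊓     (no _)    = z≤n

⟦≮⟧*≤⊓ : ∀ {x y} (p : Dec (x < y)) → ⟦ not (does p) ⟧ * y ≤ x ⊓ y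
⟦≮⟧*≤⊓         (yes _)   = z≤n
⟦≮⟧*≤⊓ {x} {y} (no x≮y) = ⊓-glb (≤-trans (≤-reflexive (*-identityˡ y)) (≮⇒≥ x≮y)) (≤-reflexive (*-identityˡ y))

⟦⟧≤1 : ∀ b → ⟦ b ⟧ ≤ 1
⟦⟧≤1 true  = ≤-refl
⟦⟧≤1 false = z≤n

-- Walks in a regular graph whose steps are involutions

module Graph (V C : Set) (vs : List V) (cs : List C) (n : ℕ) (length-cs : length cs ≡ n)
             (move : C → V → V) (move-invol : ∀ c v → move c (move c v) ≡ v)
             (∑-move : ∀ c f → ∑ vs (λ v → f (move c v)) ≡ ∑ vs f) where

  walk : (V → ℕ) → ℕ → V → ℕ
  walk u zero    v = u v
  walk u (suc t) v = ∑ cs λ c → walk u t (move c v)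

  infix 7 _·_
  _·_ : (V → ℕ) → (V → ℕ) → ℕ
  f · g = ∑ vs λ v → f v * g v

  ·-comm : ∀ f g → f · g ≡ g · f
  ·-comm f g = ∑-cong vs λ v → *-comm (f v) (g v)

  -- Each step is its own inverse and permutes the vertices, so directed edges may be listed by tail
  -- or by head.
  ∑∑-reverse : ∀ (f : V → V → ℕ) →
    ∑ vs (λ v → ∑ cs λ c → f v (move c v)) ≡ ∑ vs (λ v → ∑ cs λ c → f (move c v) v)
  ∑∑-reverse f = begin
    ∑ vs (λ v → ∑ cs λ c → f v (move c v))
      ≡⟨ ∑-swap vs cs _ ⟩
    ∑ cs (λ c → ∑ vs λ v → f v (move c v))
      ≡⟨ ∑-cong cs (λ c → sym (∑-move c _)) ⟩
    ∑ cs (λ c → ∑ vs λ v → f (move c v) (move c (move c v)))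
      ≡⟨ ∑-cong cs (λ c → ∑-cong vs λ v → cong (f (move c v)) (move-invol c v)) ⟩
    ∑ cs (λ c → ∑ vs λ v → f (move c v) v)
      ≡⟨ ∑-swap vs cs _ ⟨
    ∑ vs (λ v → ∑ cs λ c → f (move c v) v) ∎
    where open ≡-Reasoning

  adjoint : ∀ f g → (λ v → ∑ cs λ c → f (move c v)) · g ≡ f · (λ v → ∑ cs λ c → g (move c v))
  adjoint f g = begin
    ∑ vs (λ v → (∑ cs λ c → f (move c v)) * g v)   ≡⟨ ∑-cong vs (λ v → sym (∑-*ʳ cs (g v) _)) ⟩
    ∑ vs (λ v → ∑ cs λ c → f (move c v) * g v)     ≡⟨ ∑∑-reverse (λ v w → f v * g w) ⟨
    ∑ vs (λ v → ∑ cs λ c → f v * g (move c v))     ≡⟨ ∑-cong vs (λ v → ∑-*ˡ cs (f v) _) ⟩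
    f · (λ v → ∑ cs λ c → g (move c v))            ∎
    where open ≡-Reasoning

  -- Both sides count the walks of length t + s from u to w, on the left by their vertex at time t.
  walk-· : ∀ u w t s → walk u t · walk w s ≡ u · walk w (t + s)
  walk-· u w zero    s = refl
  walk-· u w (suc t) s = trans (adjoint (walk u t) (walk w s))
    (trans (walk-· u w t (suc s)) (cong (λ j → u · walk w j) (+-suc t s)))

  module Path (u : V → ℕ) (step : ℕ → V → V → ℕ → ℕ) where

    -- A sum over all t-walks from u to w of F applied to a state that starts at 0 and is updated by
    -- `step`. F acts as a continuation, so walks never have to be represented and linearity in F
    -- does all the work.
    path : ℕ → V → (ℕ → ℕ) → ℕ
    path zero    w F = u w * F 0
    path (suc t) w F = ∑ cs λ c → path t (move c w) (λ q → F (step t (move c w) w q))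

    path-cong : ∀ t w {F G} → (∀ q → F q ≡ G q) → path t w F ≡ path t w G
    path-cong zero    w e = cong (u w *_) (e 0)
    path-cong (suc t) w e = ∑-cong cs λ c → path-cong t (move c w) λ q → e _

    path-mono : ∀ t w {F G} → (∀ q → F q ≤ G q) → path t w F ≤ path t w G
    path-mono zero    w e = *-monoʳ-≤ (u w) (e 0)
    path-mono (suc t) w e = ∑-mono cs λ c → path-mono t (move c w) λ q → e _

    path-+ : ∀ t w F G → path t w (λ q → F q + G q) ≡ path t w F + path t w G
    path-+ zero    w F G = *-distribˡ-+ (u w) (F 0) (G 0)
    path-+ (suc t) w F G = trans (∑-cong cs λ c → path-+ t (move c w) _ _) (∑-+ cs _ _)

    path-* : ∀ t w a F → path t w (λ q → a * F q) ≡ a * path t w F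
    path-* zero    w a F = lemma (u w) a (F 0)
      where
      lemma : ∀ x y z → x * (y * z) ≡ y * (x * z)
      lemma = solve-∀
    path-* (suc t) w a F = trans (∑-cong cs λ c → path-* t (move c w) a _) (∑-*ˡ cs a _)

    path-1 : ∀ t w → path t w (λ _ → 1) ≡ walk u t w
    path-1 zero    w = *-identityʳ (u w)
    path-1 (suc t) w = ∑-cong cs λ c → path-1 t (move c w)

    path-const : ∀ t w a → path t w (λ _ → a) ≡ a * walk u t w
    path-const t w a = trans (path-cong t w λ _ → sym (*-identityʳ a))
      (trans (path-* t w a λ _ → 1) (cong (a *_) (path-1 t w)))

    path-∑ : ∀ {X : Set} t w (xs : List X) (F : X → ℕ → ℕ) →
             path t w (λ q → ∑ xs λ x → F x q) ≡ ∑ xs λ x → path t w (F x)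
    path-∑ t w []       F = path-const t w 0
    path-∑ t w (x ∷ xs) F = trans (path-+ t w (F x) _) (cong (_+_ (path t w (F x))) (path-∑ t w xs F))

  module Queue (u : V → ℕ) (noise : ℕ → V → Bool) where

    open Path u (λ t v w → enqueue (noise (suc t) w)) public

    clean unclean total : ℕ → V → ℕ
    clean   t w = path t w empty
    unclean t w = path t w nonEmpty
    total   t w = path t w id

    clean+unclean : ∀ t w → clean t w + unclean t w ≡ walk u t w
    clean+unclean t w = trans (sym (path-+ t w empty nonEmpty))
      (trans (path-cong t w empty+nonEmpty) (path-1 t w))

    -- The walks of length t + s from u to w that meet noise at time t.
    noiseMass : (V → ℕ) → ℕ → ℕ → ℕ
    noiseMass w t s = ∑ vs λ v → ⟦ noise t v ⟧ * (walk u t v * walk w s v)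

    unclean-step : ∀ t v → unclean (suc t) v + total (suc t) v
                   ≤ (∑ cs λ c → total t (move c v)) + 3 * (⟦ noise (suc t) v ⟧ * walk u (suc t) v)
    unclean-step t v = begin
      unclean (suc t) v + total (suc t) v
        ≡⟨ path-+ (suc t) v nonEmpty id ⟨
      path (suc t) v (λ q → nonEmpty q + q)
        ≤⟨ ∑-mono cs (λ c → path-mono t (move c v) (enqueue-potential b)) ⟩
      (∑ cs λ c → path t (move c v) (λ q → q + 3 * ⟦ b ⟧))
        ≡⟨ ∑-cong cs (λ c → trans (path-+ t (move c v) id _)
             (cong (_+_ (total t (move c v))) (path-const t (move c v) (3 * ⟦ b ⟧)))) ⟩
      (∑ cs λ c → total t (move c v) + 3 * ⟦ b ⟧ * walk u t (move c v))
        ≡⟨ ∑-+ cs _ _ ⟩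
      (∑ cs λ c → total t (move c v)) + (∑ cs λ c → 3 * ⟦ b ⟧ * walk u t (move c v))
        ≡⟨ cong (_+_ ((∑ cs λ c → total t (move c v)))) (trans (∑-*ˡ cs (3 * ⟦ b ⟧) _) (*-assoc 3 ⟦ b ⟧ _)) ⟩
      (∑ cs λ c → total t (move c v)) + 3 * (⟦ b ⟧ * walk u (suc t) v) ∎
      where
      open ≤-Reasoning
      b = noise (suc t) v

    unclean-mass-step : ∀ w t s → unclean (suc t) · walk w s + total (suc t) · walk w s
                        ≤ total t · walk w (suc s) + 3 * noiseMass w (suc t) s
    unclean-mass-step w t s = begin
      unclean (suc t) · walk w s + total (suc t) · walk w s
        ≡⟨ ∑-+ vs _ _ ⟨
      (∑ vs λ v → unclean (suc t) v * walk w s v + total (suc t) v * walk w s v)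
        ≡⟨ ∑-cong vs (λ v → sym (*-distribʳ-+ (walk w s v) (unclean (suc t) v) (total (suc t) v))) ⟩
      (∑ vs λ v → (unclean (suc t) v + total (suc t) v) * walk w s v)
        ≤⟨ ∑-mono vs (λ v → *-monoˡ-≤ (walk w s v) (unclean-step t v)) ⟩
      (∑ vs λ v → ((∑ cs λ c → total t (move c v)) + 3 * (⟦ noise (suc t) v ⟧ * walk u (suc t) v)) * walk w s v)
        ≡⟨ ∑-cong vs (λ v → lemma (∑ cs λ c → total t (move c v)) ⟦ noise (suc t) v ⟧ (walk u (suc t) v) (walk w s v)) ⟩
      (∑ vs λ v → (∑ cs λ c → total t (move c v)) * walk w s v + 3 * (⟦ noise (suc t) v ⟧ * (walk u (suc t) v * walk w s v)))
        ≡⟨ trans (∑-+ vs _ _) (cong₂ _+_ (adjoint (total t) (walk w s)) (∑-*ˡ vs 3 _)) ⟩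
      total t · walk w (suc s) + 3 * noiseMass w (suc t) s ∎
      where
      open ≤-Reasoning
      lemma : ∀ a b x y → (a + 3 * (b * x)) * y ≡ a * y + 3 * (b * (x * y))
      lemma = solve-∀

    -- The potential telescopes over time: the queue starts empty, its final length is dropped, and
    -- each noise accounts for at most three unclean moments.
    unclean-mass : ∀ w k → antidiagonal (λ t s → unclean (suc t) · walk w s) 0 k
                   ≤ 3 * antidiagonal (λ t s → noiseMass w (suc t) s) 0 k
    unclean-mass w k = ≤-trans (go 0 k) (≤-reflexive (cong (_+ 3 * antidiagonal (λ t s → noiseMass w (suc t) s) 0 k) empty-start))
      where
      open ≤-Reasoning
      empty-start : total 0 · walk w k ≡ 0
      empty-start = trans (∑-cong vs λ v → cong (_* walk w k v) (*-zeroʳ (u v))) (∑-zero vs)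
      go : ∀ t s → antidiagonal (λ t s → unclean (suc t) · walk w s) t s
           ≤ total t · walk w s + 3 * antidiagonal (λ t s → noiseMass w (suc t) s) t s
      go t zero    = z≤n
      go t (suc s) = begin
        unclean (suc t) · walk w s + antidiagonal (λ t s → unclean (suc t) · walk w s) (suc t) s
          ≤⟨ +-monoʳ-≤ (unclean (suc t) · walk w s) (go (suc t) s) ⟩
        unclean (suc t) · walk w s + (total (suc t) · walk w s + 3 * D)
          ≡⟨ +-assoc (unclean (suc t) · walk w s) _ _ ⟨
        unclean (suc t) · walk w s + total (suc t) · walk w s + 3 * D
          ≤⟨ +-monoˡ-≤ (3 * D) (unclean-mass-step w t s) ⟩
        total t · walk w (suc s) + 3 * noiseMass w (suc t) s + 3 * D
          ≡⟨ lemma (total t · walk w (suc s)) (noiseMass w (suc t) s) D ⟩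
        total t · walk w (suc s) + 3 * (noiseMass w (suc t) s + D) ∎
        where
        D = antidiagonal (λ t s → noiseMass w (suc t) s) (suc t) s
        lemma : ∀ a b c → a + 3 * b + 3 * c ≡ a + 3 * (b + c)
        lemma = solve-∀

  module SmallSteps (u : V → ℕ) (u≤1 : ∀ v → u v ≤ 1) (h : ℕ) (2≤h : 2 ≤ h) where

    small? : ∀ t v w → Dec (h * walk u (suc t) w < n * walk u t v)
    small? t v w = h * walk u (suc t) w <? n * walk u t v

    open Path u (λ t v w s → s + 𝟙 (small? t v w))

    -- Induction on the last step: its weight is at most 1 + h if it is small and 1 otherwise, and
    -- by `heavy-count` these weights sum to at most n + n over the steps into w.
    path-^ : ∀ t w → path t w (h ^_) ≤ (2 * n) ^ t
    path-^ zero    w = ≤-trans (≤-reflexive (*-identityʳ (u w))) (u≤1 w)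
    path-^ (suc t) w = begin
      (∑ cs λ c → path t (move c w) (λ s → h ^ (s + 𝟙 (small? t (move c w) w))))
        ≤⟨ ∑-mono cs (λ c → one c (𝟙 (small? t (move c w) w)) (𝟙≤1 (small? t (move c w) w))) ⟩
      (∑ cs λ c → (1 + h * 𝟙 (small? t (move c w) w)) * (2 * n) ^ t)
        ≡⟨ ∑-*ʳ cs ((2 * n) ^ t) _ ⟩
      (∑ cs λ c → 1 + h * 𝟙 (small? t (move c w) w)) * (2 * n) ^ t
        ≤⟨ *-monoˡ-≤ ((2 * n) ^ t) count ⟩
      2 * n * (2 * n) ^ t ∎
      where
      open ≤-Reasoning
      one : ∀ c x → x ≤ 1 → path t (move c w) (λ s → h ^ (s + x)) ≤ (1 + h * x) * (2 * n) ^ t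
      one c x x≤1 = begin
        path t (move c w) (λ s → h ^ (s + x))
          ≡⟨ path-cong t (move c w) (λ s → trans (^-distribˡ-+-* h s x) (*-comm (h ^ s) (h ^ x))) ⟩
        path t (move c w) (λ s → h ^ x * h ^ s)
          ≡⟨ path-* t (move c w) (h ^ x) (h ^_) ⟩
        h ^ x * path t (move c w) (h ^_)
          ≤⟨ *-mono-≤ (bernoulli x x≤1) (path-^ t (move c w)) ⟩
        (1 + h * x) * (2 * n) ^ t ∎
        where
        bernoulli : ∀ x → x ≤ 1 → h ^ x ≤ 1 + h * x
        bernoulli zero       _ = m≤m+n 1 _
        bernoulli (suc zero) _ = n≤1+n _
        bernoulli (suc (suc _)) (s≤s ())
      count : (∑ cs λ c → 1 + h * 𝟙 (small? t (move c w) w)) ≤ 2 * n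
      count = begin
        (∑ cs λ c → 1 + h * 𝟙 (small? t (move c w) w))
          ≡⟨ trans (∑-+ cs _ _) (cong₂ _+_ (trans (∑-const cs 1) (trans (*-identityʳ (length cs)) length-cs)) (∑-*ˡ cs h _)) ⟩
        n + h * (∑ cs λ c → 𝟙 (small? t (move c w) w))
          ≤⟨ +-monoʳ-≤ n (heavy-count cs n h (λ c → walk u t (move c w))) ⟩
        n + n
          ≡⟨ cong (_+_ n) (sym (+-identityʳ n)) ⟩
        2 * n ∎

    smallMass : (V → ℕ) → ℕ → ℕ → ℕ
    smallMass w t s = ∑ vs λ v → ∑ cs λ c →
      𝟙 (small? t (move c v) v) * (walk u t (move c v) * walk w s v)

    smallMass-step : ∀ w t s →
      smallMass w t s + (λ v → path t v id) · walk w (suc s) ≡ (λ v → path (suc t) v id) · walk w s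
    smallMass-step w t s = begin
      smallMass w t s + p · walk w (suc s)
        ≡⟨ cong (_+_ (smallMass w t s)) (sym (adjoint p (walk w s))) ⟩
      smallMass w t s + (λ v → ∑ cs λ c → p (move c v)) · walk w s
        ≡⟨ ∑-+ vs _ _ ⟨
      (∑ vs λ v → (∑ cs λ c → x c v * (walk u t (move c v) * walk w s v)) + (∑ cs λ c → p (move c v)) * walk w s v)
        ≡⟨ ∑-cong vs (λ v → pointwise v) ⟩
      (λ v → path (suc t) v id) · walk w s ∎
      where
      open ≡-Reasoning
      p = λ v → path t v id
      x = λ c v → 𝟙 (small? t (move c v) v)
      lemma : ∀ a b c d → a * (b * c) + d * c ≡ (d + a * b) * c
      lemma = solve-∀
      pointwise : ∀ v → (∑ cs λ c → x c v * (walk u t (move c v) * walk w s v)) + (∑ cs λ c → p (move c v)) * walk w s v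
                  ≡ path (suc t) v id * walk w s v
      pointwise v = begin
        (∑ cs λ c → x c v * (walk u t (move c v) * walk w s v)) + (∑ cs λ c → p (move c v)) * walk w s v
          ≡⟨ cong (_+_ ((∑ cs λ c → x c v * (walk u t (move c v) * walk w s v)))) (sym (∑-*ʳ cs (walk w s v) _)) ⟩
        (∑ cs λ c → x c v * (walk u t (move c v) * walk w s v)) + (∑ cs λ c → p (move c v) * walk w s v)
          ≡⟨ ∑-+ cs _ _ ⟨
        (∑ cs λ c → x c v * (walk u t (move c v) * walk w s v) + p (move c v) * walk w s v)
          ≡⟨ ∑-cong cs (λ c → lemma (x c v) (walk u t (move c v)) (walk w s v) (p (move c v))) ⟩
        (∑ cs λ c → (p (move c v) + x c v * walk u t (move c v)) * walk w s v)
          ≡⟨ ∑-cong cs (λ c → cong (_* walk w s v) (sym (trans (path-+ t (move c v) id _)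
               (cong (_+_ (p (move c v))) (path-const t (move c v) (x c v)))))) ⟩
        (∑ cs λ c → path t (move c v) (λ q → q + x c v) * walk w s v)
          ≡⟨ ∑-*ʳ cs (walk w s v) _ ⟩
        path (suc t) v id * walk w s v ∎

    -- Linearity of expectation: the walks whose step at a given time is small, added over all
    -- times, give the number of small steps summed over walks.
    smallMass-total : ∀ w k → antidiagonal (smallMass w) 0 k ≤ (λ v → path k v id) · w
    smallMass-total w k = m+n≤o⇒m≤o (antidiagonal (smallMass w) 0 k) (≤-reflexive (go 0 k))
      where
      open ≡-Reasoning
      go : ∀ t s → antidiagonal (smallMass w) t s + (λ v → path t v id) · walk w s
           ≡ (λ v → path (t + s) v id) · w
      go t zero    = cong (λ j → (λ v → path j v id) · w) (sym (+-identityʳ t))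
      go t (suc s) = begin
        smallMass w t s + A + (λ v → path t v id) · walk w (suc s)
          ≡⟨ lemma (smallMass w t s) A _ ⟩
        A + (smallMass w t s + (λ v → path t v id) · walk w (suc s))
          ≡⟨ cong (_+_ A) (smallMass-step w t s) ⟩
        A + (λ v → path (suc t) v id) · walk w s
          ≡⟨ go (suc t) s ⟩
        (λ v → path (suc t + s) v id) · w
          ≡⟨ cong (λ j → (λ v → path j v id) · w) (sym (+-suc t s)) ⟩
        (λ v → path (t + suc s) v id) · w ∎
        where
        A = antidiagonal (smallMass w) (suc t) s
        lemma : ∀ a b c → a + b + c ≡ b + (a + c)
        lemma = solve-∀

    -- The first q small steps of a walk cost q N; the excess is paid by the exponential moment
    -- `path-^`.
    smallMass-bound : ∀ w → ∑ vs w ≤ 1 → ∀ k q →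
      h ^ suc q * antidiagonal (smallMass w) 0 k ≤ h ^ suc q * (q * (walk u k · w)) + (2 * n) ^ k
    smallMass-bound w ∑w≤1 k q = begin
      hq * antidiagonal (smallMass w) 0 k
        ≤⟨ *-monoʳ-≤ hq (smallMass-total w k) ⟩
      hq * ((λ v → path k v id) · w)
        ≡⟨ ∑-*ˡ vs hq _ ⟨
      (∑ vs λ v → hq * (path k v id * w v))
        ≡⟨ ∑-cong vs (λ v → trans (sym (*-assoc hq (path k v id) (w v))) (cong (_* w v) (sym (path-* k v hq id)))) ⟩
      (∑ vs λ v → path k v (λ s → hq * s) * w v)
        ≤⟨ ∑-mono vs (λ v → *-monoˡ-≤ (w v) (path-mono k v (linear≤exponential h 2≤h q))) ⟩
      (∑ vs λ v → path k v (λ s → hq * q + h ^ s) * w v)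
        ≡⟨ ∑-cong vs (λ v → cong (_* w v) (trans (path-+ k v _ _) (cong (_+ path k v (h ^_)) (path-const k v (hq * q))))) ⟩
      (∑ vs λ v → (hq * q * walk u k v + path k v (h ^_)) * w v)
        ≤⟨ ∑-mono vs (λ v → *-monoˡ-≤ (w v) (+-monoʳ-≤ (hq * q * walk u k v) (path-^ k v))) ⟩
      (∑ vs λ v → (hq * q * walk u k v + (2 * n) ^ k) * w v)
        ≡⟨ ∑-cong vs (λ v → lemma hq q (walk u k v) ((2 * n) ^ k) (w v)) ⟩
      (∑ vs λ v → hq * q * (walk u k v * w v) + (2 * n) ^ k * w v)
        ≡⟨ trans (∑-+ vs _ _) (cong₂ _+_ (∑-*ˡ vs (hq * q) _) (∑-*ˡ vs ((2 * n) ^ k) w)) ⟩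
      hq * q * (walk u k · w) + (2 * n) ^ k * ∑ vs w
        ≤⟨ +-mono-≤ (≤-reflexive (*-assoc hq q _)) (≤-trans (*-monoʳ-≤ ((2 * n) ^ k) ∑w≤1) (≤-reflexive (*-identityʳ _))) ⟩
      hq * (q * (walk u k · w)) + (2 * n) ^ k ∎
      where
      open ≤-Reasoning
      hq = h ^ suc q
      lemma : ∀ a b c d e → (a * b * c + d) * e ≡ a * b * (c * e) + d * e
      lemma = solve-∀

  module Splits (u w : V → ℕ) (sign : ℕ → ℕ → V → Bool) (k : ℕ) where

    -- One sign is read from both ends: "behind" is noise for the part before a backtrack and the
    -- expected sign for the part after it. Hence every vertex is noise for exactly one of the two
    -- sides.
    noiseᵘ noiseʷ : ℕ → V → Bool
    noiseᵘ t v = sign t (2 + k ∸ t) v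
    noiseʷ s v = not (sign (2 + k ∸ s) s v)

    module Qᵘ = Queue u noiseᵘ
    module Qʷ = Queue w noiseʷ

    -- Walks of length t + 1 + s cut at the edge after time t; q is the forward queue of the first
    -- part and r the backward queue of the second, both up to and including the ends of that edge.
    joint : ℕ → ℕ → (ℕ → ℕ → ℕ) → ℕ
    joint t s F = ∑ vs λ v → ∑ cs λ c → Qᵘ.path t v (λ q → Qʷ.path s (move c v) (F q))

    -- The same walks seen from one vertex y next to the cut, before y has entered either queue.
    -- This is the common form of the cuts before and after y.
    around : ℕ → ℕ → (V → ℕ → ℕ → ℕ) → ℕ
    around t s F = ∑ vs λ y → ∑ cs λ c →
      Qᵘ.path t (move c y) (λ q → ∑ cs λ c′ → Qʷ.path s (move c′ y) (F y q))

    joint-before : ∀ t s F → joint t (suc s) F ≡ around t s (λ y q r → F q (enqueue (noiseʷ (suc s) y) r))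
    joint-before t s F = ∑∑-reverse λ v y →
      Qᵘ.path t v (λ q → ∑ cs λ c′ → Qʷ.path s (move c′ y) (λ r → F q (enqueue (noiseʷ (suc s) y) r)))

    joint-after : ∀ t s F → joint (suc t) s F ≡ around t s (λ y q r → F (enqueue (noiseᵘ (suc t) y) q) r)
    joint-after t s F = ∑-cong vs λ y → trans (∑-swap cs cs _)
      (∑-cong cs λ c → sym (Qᵘ.path-∑ t (move c y) cs
        (λ c′ q → Qʷ.path s (move c′ y) (F (enqueue (noiseᵘ (suc t) y) q)))))

    cleanSplits : ℕ → ℕ → ℕ
    cleanSplits t s = ∑ vs λ v → ∑ cs λ c → Qᵘ.clean t v * Qʷ.clean s (move c v)

    cleanSplits-joint : ∀ t s → cleanSplits t s ≡ joint t s (λ q r → empty q * empty r)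
    cleanSplits-joint t s = ∑-cong vs λ v → ∑-cong cs λ c → sym (begin
      Qᵘ.path t v (λ q → Qʷ.path s (move c v) (λ r → empty q * empty r))
        ≡⟨ Qᵘ.path-cong t v (λ q → trans (Qʷ.path-* s (move c v) (empty q) empty) (*-comm (empty q) _)) ⟩
      Qᵘ.path t v (λ q → Qʷ.clean s (move c v) * empty q)
        ≡⟨ trans (Qᵘ.path-* t v (Qʷ.clean s (move c v)) empty) (*-comm (Qʷ.clean s (move c v)) _) ⟩
      Qᵘ.clean t v * Qʷ.clean s (move c v) ∎)
      where open ≡-Reasoning

    around-mono : ∀ t s {F G} → (∀ y q r → F y q r ≤ G y q r) → around t s F ≤ around t s G
    around-mono t s e = ∑-mono vs λ y → ∑-mono cs λ c → Qᵘ.path-mono t (move c y) λ q →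
      ∑-mono cs λ c′ → Qʷ.path-mono s (move c′ y) (e y q)

    around-+ : ∀ t s F G → around t s (λ y q r → F y q r + G y q r) ≡ around t s F + around t s G
    around-+ t s F G = trans (∑-cong vs λ y → trans (∑-cong cs λ c → trans
        (Qᵘ.path-cong t (move c y) λ q → trans (∑-cong cs λ c′ → Qʷ.path-+ s (move c′ y) (F y q) (G y q)) (∑-+ cs _ _))
        (Qᵘ.path-+ t (move c y) _ _)) (∑-+ cs _ _)) (∑-+ vs _ _)

    -- Moving the cut past y removes y from the backward queue and adds it to the forward one, with
    -- opposite noise: exactly the situation of `split-potential`.
    split-step : ∀ t s → t + s ≡ k →
      cleanSplits t (suc s) + joint (suc t) s below ≤ joint t (suc s) below
    split-step t s refl = begin
      cleanSplits t (suc s) + joint (suc t) s below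
        ≡⟨ cong₂ _+_ (trans (cleanSplits-joint t (suc s)) (joint-before t s (λ q r → empty q * empty r))) (joint-after t s below) ⟩
      around t s _ + around t s _
        ≡⟨ around-+ t s _ _ ⟨
      around t s (λ y q r → empty q * empty (enqueue (noiseʷ (suc s) y) r) + below (enqueue (noiseᵘ (suc t) y) q) r)
        ≤⟨ around-mono t s (λ y q r → pointwise y q r) ⟩
      around t s (λ y q r → below q (enqueue (noiseʷ (suc s) y) r))
        ≡⟨ joint-before t s below ⟨
      joint t (suc s) below ∎
      where
      open ≤-Reasoning
      -- Reconciles the two clocks: y is at time t + 1 with s + 1 steps left, so both noise
      -- functions evaluate the same sign.
      time-left : 2 + (t + s) ∸ suc s ≡ suc t
      time-left = m+n∸n≡m (suc t) s
      time-right : 2 + (t + s) ∸ suc t ≡ suc s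
      time-right = trans (cong (_∸ t) (cong suc (+-comm t s))) (m+n∸n≡m (suc s) t)
      pointwise : ∀ y q r → empty q * empty (enqueue (noiseʷ (suc s) y) r) + below (enqueue (noiseᵘ (suc t) y) q) r
                  ≤ below q (enqueue (noiseʷ (suc s) y) r)
      pointwise y q r rewrite time-left | time-right = split-potential (sign (suc t) (suc s) y) q r

    -- Telescoping `below`, which never exceeds 1: each (k + 2)-walk is charged for at most one
    -- clean split.
    cleanSplits-total : antidiagonal (λ t s → cleanSplits (suc t) (suc s)) 0 k ≤ u · walk w (2 + k)
    cleanSplits-total = begin
      antidiagonal (λ t s → cleanSplits (suc t) (suc s)) 0 k
        ≤⟨ go 0 k refl ⟩
      joint 1 k below
        ≤⟨ ∑-mono vs (λ v → ∑-mono cs λ c → Qᵘ.path-mono 1 v λ q → Qʷ.path-mono k (move c v) λ r → below≤1 q r) ⟩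
      joint 1 k (λ _ _ → 1)
        ≡⟨ ∑-cong vs (λ v → ∑-cong cs λ c → trans (Qᵘ.path-cong 1 v λ q → Qʷ.path-1 k (move c v))
             (trans (Qᵘ.path-const 1 v _) (*-comm (walk w k (move c v)) _))) ⟩
      (∑ vs λ v → ∑ cs λ c → walk u 1 v * walk w k (move c v))
        ≡⟨ ∑-cong vs (λ v → ∑-*ˡ cs (walk u 1 v) _) ⟩
      walk u 1 · walk w (suc k)
        ≡⟨ walk-· u w 1 (suc k) ⟩
      u · walk w (2 + k) ∎
      where
      open ≤-Reasoning
      go : ∀ t s → t + s ≡ k →
           antidiagonal (λ t s → cleanSplits (suc t) (suc s)) t s ≤ joint (suc t) s below
      go t zero    e = z≤n
      go t (suc s) e = ≤-trans
        (+-monoʳ-≤ (cleanSplits (suc t) (suc s)) (go (suc t) s (trans (sym (+-suc t s)) e)))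
        (split-step (suc t) s (trans (sym (+-suc t s)) e))

  -- The default 0 says that no walk is two steps behind before time 2; the overlap of the two laws
  -- vanishes there.
  delay : (ℕ → V → ℕ) → ℕ → V → ℕ
  delay f zero          v = 0
  delay f (suc zero)    v = 0
  delay f (suc (suc t)) v = f t v

  module NearLogConvexity
    (u w : V → ℕ) (u≤1 : ∀ v → u v ≤ 1) (w≤1 : ∀ v → w v ≤ 1) (∑u≤1 : ∑ vs u ≤ 1) (∑w≤1 : ∑ vs w ≤ 1)
    (k E h : ℕ) (1≤k : 1 ≤ k) (1≤n : 1 ≤ n) (96≤E : 96 ≤ E) (2≤h : 2 ≤ h)
    (up : E * (u · walk w (2 + k)) ≤ n * n * (u · walk w k))
    (down : ∀ j → k ≡ 2 + j → E * (n * n * (u · walk w j)) ≤ u · walk w k) where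

    N : ℕ
    N = u · walk w k

    -- Compares, up to the factor N, the laws at time t and at time t - 2 of a uniformly random
    -- walk of length k; s = k + 2 - t.
    behind? : ∀ t s v → Dec (walk u t v * delay (walk w) s v < delay (walk u) t v * walk w s v)
    behind? t s v = walk u t v * delay (walk w) s v <? delay (walk u) t v * walk w s v

    common : ℕ → ℕ → ℕ
    common t s = ∑ vs λ v → (walk u t v * delay (walk w) s v) ⊓ (delay (walk u) t v * walk w s v)

    vanishing : ∀ {x} → x ≡ 0 → E * (n * n * x) ≤ N
    vanishing refl = ≤-trans (≤-reflexive (trans (cong (E *_) (*-zeroʳ (n * n))) (*-zeroʳ E))) z≤n

    delayed-mass : ∀ t s → t + s ≡ 2 + k → E * (n * n * (delay (walk u) t · delay (walk w) s)) ≤ N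
    delayed-mass zero          s          e = vanishing (∑-zero vs)
    delayed-mass (suc zero)    s          e = vanishing (∑-zero vs)
    delayed-mass (suc (suc t)) zero       e = vanishing (trans (∑-cong vs λ v → *-zeroʳ (walk u t v)) (∑-zero vs))
    delayed-mass (suc (suc t)) (suc zero) e = vanishing (trans (∑-cong vs λ v → *-zeroʳ (walk u t v)) (∑-zero vs))
    delayed-mass (suc (suc t)) (suc (suc s)) e =
      ≤-trans (≤-reflexive (cong (λ x → E * (n * n * x)) (walk-· u w t s)))
        (down (t + s) (trans (sym (suc-injective (suc-injective e))) (trans (+-suc t (suc s)) (cong suc (+-suc t s)))))

    -- After `⊓-interchange` the factors regroup into undelayed and doubly delayed walks, that is N
    -- (k + 2) and N (k - 2). Each hypothesis contributes one N.
    common-bound : ∀ t s → t + s ≡ 2 + k → E * common t s ≤ 2 * N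
    common-bound t s e = *-cancelˡ-≤ (n * n) {{>-nonZero (*-mono-≤ 1≤n 1≤n)}} (begin
      n * n * (E * common t s)
        ≡⟨ lemma (n * n) E (common t s) ⟩
      E * (n * n * common t s)
        ≡⟨ cong (E *_) (∑-*ˡ vs (n * n) _) ⟨
      E * (∑ vs λ v → n * n * ((walk u t v * delay (walk w) s v) ⊓ (delay (walk u) t v * walk w s v)))
        ≤⟨ *-monoʳ-≤ E (∑-mono vs λ v → ⊓-interchange n (walk u t v) (delay (walk w) s v) (delay (walk u) t v) (walk w s v)) ⟩
      E * (∑ vs λ v → walk u t v * walk w s v + n * n * (n * n * (delay (walk u) t v * delay (walk w) s v)))
        ≡⟨ cong (E *_) (trans (∑-+ vs _ _) (cong₂ _+_ (trans (walk-· u w t s) (cong (λ j → u · walk w j) e))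
             (trans (∑-*ˡ vs (n * n) _) (cong (n * n *_) (∑-*ˡ vs (n * n) _))))) ⟩
      E * (u · walk w (2 + k) + n * n * (n * n * D))
        ≡⟨ lemma′ E (u · walk w (2 + k)) (n * n) D ⟩
      E * (u · walk w (2 + k)) + n * n * (E * (n * n * D))
        ≤⟨ +-mono-≤ up (*-monoʳ-≤ (n * n) (delayed-mass t s e)) ⟩
      n * n * N + n * n * N
        ≡⟨ lemma″ (n * n) N ⟩
      n * n * (2 * N) ∎)
      where
      open ≤-Reasoning
      D = delay (walk u) t · delay (walk w) s
      lemma : ∀ a b c → a * (b * c) ≡ b * (a * c)
      lemma = solve-∀
      lemma′ : ∀ a b c d → a * (b + c * (c * d)) ≡ a * b + c * (a * (c * d))
      lemma′ = solve-∀
      lemma″ : ∀ a b → a * b + a * b ≡ a * (2 * b)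
      lemma″ = solve-∀

    open Splits u w (λ t s v → does (behind? t s v)) k

    -- The sign at a vertex follows the larger of the two products, so where it is wrong the mass of
    -- on-time walks is the smaller one and lies below the minimum.
    noiseᵘ-bound : ∀ t s → suc (t + s) ≡ k → E * Qᵘ.noiseMass w (suc t) s ≤ 2 * N
    noiseᵘ-bound t s refl = ≤-trans (*-monoʳ-≤ E (∑-mono vs pointwise))
      (common-bound (suc t) (2 + s) (trans (+-suc (suc t) (suc s)) (cong suc (+-suc (suc t) s))))
      where
      pointwise : ∀ v → ⟦ noiseᵘ (suc t) v ⟧ * (walk u (suc t) v * walk w s v)
                  ≤ (walk u (suc t) v * delay (walk w) (2 + s) v) ⊓ (delay (walk u) (suc t) v * walk w (2 + s) v)
      pointwise v rewrite trans (cong (_∸ t) (cong (_+_ 2) (+-comm t s))) (m+n∸n≡m (2 + s) t)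
        = ⟦<⟧*≤⊓ (behind? (suc t) (2 + s) v)

    noiseʷ-bound : ∀ s t → suc (s + t) ≡ k → E * Qʷ.noiseMass u (suc s) t ≤ 2 * N
    noiseʷ-bound s t refl = ≤-trans (*-monoʳ-≤ E (∑-mono vs pointwise))
      (common-bound (2 + t) (suc s) (cong (_+_ 2) (trans (+-suc t s) (cong suc (+-comm t s)))))
      where
      pointwise : ∀ v → ⟦ noiseʷ (suc s) v ⟧ * (walk w (suc s) v * walk u t v)
                  ≤ (walk u (2 + t) v * delay (walk w) (suc s) v) ⊓ (delay (walk u) (2 + t) v * walk w (suc s) v)
      pointwise v rewrite trans (cong (_∸ s) (cong (_+_ 2) (+-comm s t))) (m+n∸n≡m (2 + t) s)
                        | *-comm (walk w (suc s) v) (walk u t v)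
        = ⟦≮⟧*≤⊓ (behind? (2 + t) (suc s) v)

    module Sᵘ = SmallSteps u u≤1 h 2≤h
    module Sʷ = SmallSteps w w≤1 h 2≤h

    uncleanᵘ uncleanʷ : ℕ → ℕ → ℕ
    uncleanᵘ t s = Qᵘ.unclean (suc t) · walk w s
    uncleanʷ s t = Qʷ.unclean (suc s) · walk u t

    -- The 96 is 3 · 2 · 16: three unclean moments per noise, noise mass 2 N / E at each time, and a
    -- target of one sixteenth of k N.
    unclean-bound : ∀ (f g : ℕ → ℕ → ℕ) → antidiagonal f 0 k ≤ 3 * antidiagonal g 0 k →
                    (∀ t s → suc (t + s) ≡ k → E * g t s ≤ 2 * N) → 16 * antidiagonal f 0 k ≤ k * N
    unclean-bound f g f≤g bound = *-cancelˡ-≤ 6 (begin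
      6 * (16 * antidiagonal f 0 k)          ≡⟨ *-assoc 6 16 (antidiagonal f 0 k) ⟨
      96 * antidiagonal f 0 k                ≤⟨ *-mono-≤ 96≤E f≤g ⟩
      E * (3 * antidiagonal g 0 k)           ≡⟨ lemma E (antidiagonal g 0 k) ⟩
      3 * (E * antidiagonal g 0 k)           ≡⟨ cong (3 *_) (antidiagonal-* E g 0 k) ⟨
      3 * antidiagonal (λ a b → E * g a b) 0 k  ≤⟨ *-monoʳ-≤ 3 (antidiagonal-mono k 0 k refl bound) ⟩
      3 * antidiagonal (λ _ _ → 2 * N) 0 k   ≡⟨ cong (3 *_) (antidiagonal-const (2 * N) 0 k) ⟩
      3 * (k * (2 * N))                      ≡⟨ lemma′ k N ⟩
      6 * (k * N)                            ∎)
      where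
      open ≤-Reasoning
      lemma : ∀ a b → a * (3 * b) ≡ 3 * (a * b)
      lemma = solve-∀
      lemma′ : ∀ a b → 3 * (a * (2 * b)) ≡ 6 * (a * b)
      lemma′ = solve-∀

    -- N is split by the edge crossed from time t to t + 1. For a usable edge, a clean walk to its
    -- head in t + 1 steps and a clean walk from its tail in s + 1 steps, joined by the edge
    -- traversed backwards, form a clean split of a (k + 2)-walk.
    edges : ∀ t s → suc (t + s) ≡ k →
      n * n * N ≤ 4 * (h * h) * cleanSplits (suc t) (suc s)
        + n * n * (Sᵘ.smallMass w t s + Sʷ.smallMass u s t + 2 * uncleanᵘ t s + 2 * uncleanʷ s t)
    edges t s e = begin
      n * n * N
        ≡⟨ cong (n * n *_) (trans (cong (λ j → u · walk w j) (sym e)) (sym (walk-· u w (suc t) s))) ⟩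
      n * n * (walk u (suc t) · walk w s)
        ≡⟨ cong (n * n *_) (∑-cong vs (λ v → sym (∑-*ʳ cs (walk w s v) _))) ⟩
      n * n * ∑∑ (λ c v → a c v * b v)
        ≡⟨ ∑∑-* (n * n) _ ⟨
      ∑∑ (λ c v → n * n * (a c v * b v))
        ≤⟨ ∑-mono vs (λ v → ∑-mono cs λ c → edge-bound n h (a c v) (walk u (suc t) v) (Qᵘ.clean (suc t) v)
             (b v) (walk w (suc s) (move c v)) (Qʷ.clean (suc s) (move c v))) ⟩
      ∑∑ (λ c v → 4 * (h * h) * (Qᵘ.clean (suc t) v * Qʷ.clean (suc s) (move c v))
                  + n * n * (f₁ c v + f₂ c v + f₃ c v + f₄ c v))
        ≡⟨ trans (∑∑-+ _ _) (cong₂ _+_ (∑∑-* (4 * (h * h)) _)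
             (trans (∑∑-* (n * n) _) (cong (n * n *_)
             (trans (∑∑-+ _ f₄) (cong (_+ ∑∑ f₄) (trans (∑∑-+ _ f₃) (cong (_+ ∑∑ f₃) (∑∑-+ f₁ f₂)))))))) ⟩
      4 * (h * h) * cleanSplits (suc t) (suc s) + n * n * (∑∑ f₁ + ∑∑ f₂ + ∑∑ f₃ + ∑∑ f₄)
        ≤⟨ +-monoʳ-≤ (4 * (h * h) * cleanSplits (suc t) (suc s)) (*-monoʳ-≤ (n * n)
             (+-mono-≤ (+-mono-≤ (+-monoʳ-≤ (∑∑ f₁) (≤-reflexive f₂-sum)) f₃-sum) f₄-sum)) ⟩
      _ ∎
      where
      open ≤-Reasoning
      ∑∑ : (C → V → ℕ) → ℕ
      ∑∑ f = ∑ vs λ v → ∑ cs λ c → f c v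
      ∑∑-* : ∀ x f → ∑∑ (λ c v → x * f c v) ≡ x * ∑∑ f
      ∑∑-* x f = trans (∑-cong vs λ v → ∑-*ˡ cs x _) (∑-*ˡ vs x _)
      ∑∑-+ : ∀ f g → ∑∑ (λ c v → f c v + g c v) ≡ ∑∑ f + ∑∑ g
      ∑∑-+ f g = trans (∑-cong vs λ v → ∑-+ cs _ _) (∑-+ vs _ _)
      a : C → V → ℕ
      a c v = walk u t (move c v)
      b : V → ℕ
      b v = walk w s v
      f₁ f₂ f₃ f₄ : C → V → ℕ
      f₁ c v = 𝟙 (Sᵘ.small? t (move c v) v) * (a c v * b v)
      f₂ c v = 𝟙 (Sʷ.small? s v (move c v)) * (b v * a c v)
      f₃ c v = 𝟙 (2 * Qᵘ.clean (suc t) v <? walk u (suc t) v) * (a c v * b v)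
      f₄ c v = 𝟙 (2 * Qʷ.clean (suc s) (move c v) <? walk w (suc s) (move c v)) * (a c v * b v)
      f₂-sum : ∑∑ f₂ ≡ Sʷ.smallMass u s t
      f₂-sum = ∑∑-reverse λ v y → 𝟙 (Sʷ.small? s v y) * (walk w s v * walk u t y)
      f₃-sum : ∑∑ f₃ ≤ 2 * uncleanᵘ t s
      f₃-sum = begin
        ∑∑ f₃
          ≡⟨ ∑-cong vs (λ v → trans (∑-*ˡ cs (x v) _) (trans (cong (x v *_) (∑-*ʳ cs (b v) _)) (sym (*-assoc (x v) _ (b v))))) ⟩
        (∑ vs λ v → x v * walk u (suc t) v * b v)
          ≤⟨ ∑-mono vs (λ v → *-monoˡ-≤ (b v) (minority (Qᵘ.clean (suc t) v) (Qᵘ.unclean (suc t) v) (Qᵘ.clean+unclean (suc t) v))) ⟩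
        (∑ vs λ v → 2 * Qᵘ.unclean (suc t) v * b v)
          ≡⟨ trans (∑-cong vs λ v → *-assoc 2 (Qᵘ.unclean (suc t) v) (b v)) (∑-*ˡ vs 2 _) ⟩
        2 * uncleanᵘ t s ∎
        where
        x : V → ℕ
        x v = 𝟙 (2 * Qᵘ.clean (suc t) v <? walk u (suc t) v)
      f₄-sum : ∑∑ f₄ ≤ 2 * uncleanʷ s t
      f₄-sum = begin
        ∑∑ f₄
          ≡⟨ ∑∑-reverse (λ v y → x v * (walk u t v * walk w s y)) ⟨
        (∑ vs λ v → ∑ cs λ c → x v * (walk u t v * walk w s (move c v)))
          ≡⟨ ∑-cong vs (λ v → trans (∑-*ˡ cs (x v) _) (trans (cong (x v *_) (∑-*ˡ cs (walk u t v) _)) (lemma (x v) (walk u t v) (walk w (suc s) v)))) ⟩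
        (∑ vs λ v → x v * walk w (suc s) v * walk u t v)
          ≤⟨ ∑-mono vs (λ v → *-monoˡ-≤ (walk u t v) (minority (Qʷ.clean (suc s) v) (Qʷ.unclean (suc s) v) (Qʷ.clean+unclean (suc s) v))) ⟩
        (∑ vs λ v → 2 * Qʷ.unclean (suc s) v * walk u t v)
          ≡⟨ trans (∑-cong vs λ v → *-assoc 2 (Qʷ.unclean (suc s) v) (walk u t v)) (∑-*ˡ vs 2 _) ⟩
        2 * uncleanʷ s t ∎
        where
        x : V → ℕ
        x v = 𝟙 (2 * Qʷ.clean (suc s) v <? walk w (suc s) v)
        lemma : ∀ a b c → a * (b * c) ≡ a * c * b
        lemma = solve-∀

    all-edges : n * n * (k * N) ≤ 4 * (h * h) * (u · walk w (2 + k))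
      + n * n * (antidiagonal (Sᵘ.smallMass w) 0 k + antidiagonal (Sʷ.smallMass u) 0 k
                 + 2 * antidiagonal uncleanᵘ 0 k + 2 * antidiagonal uncleanʷ 0 k)
    all-edges = begin
      n * n * (k * N)
        ≡⟨ lemma (n * n) k N ⟩
      k * (n * n * N)
        ≡⟨ antidiagonal-const (n * n * N) 0 k ⟨
      antidiagonal (λ _ _ → n * n * N) 0 k
        ≤⟨ antidiagonal-mono k 0 k refl edges ⟩
      antidiagonal (λ t s → 4 * (h * h) * cleanSplits (suc t) (suc s)
        + n * n * (Sᵘ.smallMass w t s + Sʷ.smallMass u s t + 2 * uncleanᵘ t s + 2 * uncleanʷ s t)) 0 k
        ≡⟨ trans (antidiagonal-+ _ _ 0 k) (cong₂ _+_ (antidiagonal-* (4 * (h * h)) _ 0 k)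
             (trans (antidiagonal-* (n * n) _ 0 k) (cong (n * n *_) sums))) ⟩
      4 * (h * h) * antidiagonal (λ t s → cleanSplits (suc t) (suc s)) 0 k + n * n * total
        ≤⟨ +-monoˡ-≤ (n * n * total) (*-monoʳ-≤ (4 * (h * h)) cleanSplits-total) ⟩
      4 * (h * h) * (u · walk w (2 + k)) + n * n * total ∎
      where
      open ≤-Reasoning
      total = antidiagonal (Sᵘ.smallMass w) 0 k + antidiagonal (Sʷ.smallMass u) 0 k
                 + 2 * antidiagonal uncleanᵘ 0 k + 2 * antidiagonal uncleanʷ 0 k
      lemma : ∀ a b c → a * (b * c) ≡ b * (a * c)
      lemma = solve-∀
      sums : antidiagonal (λ t s → Sᵘ.smallMass w t s + Sʷ.smallMass u s t + 2 * uncleanᵘ t s + 2 * uncleanʷ s t) 0 k ≡ total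
      sums = trans (antidiagonal-+ _ _ 0 k) (cong₂ _+_ (trans (antidiagonal-+ _ _ 0 k) (cong₂ _+_
        (trans (antidiagonal-+ _ _ 0 k) (cong (_+_ (antidiagonal (Sᵘ.smallMass w) 0 k)) (sym (antidiagonal-flip (Sʷ.smallMass u) k))))
        (antidiagonal-* 2 uncleanᵘ 0 k))) (trans (antidiagonal-* 2 _ 0 k) (cong (2 *_) (sym (antidiagonal-flip uncleanʷ k)))))

    -- Each of the two terms of `smallMass-bound` is at most k N / 8 after division by h^(q + 1):
    -- one since 8 q ≤ k, the other since N is not tiny.
    small-bound : ∀ q x → 8 * q ≤ k → 8 * (2 * n) ^ k ≤ N * h ^ suc q →
                  h ^ suc q * x ≤ h ^ suc q * (q * N) + (2 * n) ^ k → 4 * x ≤ k * N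
    small-bound q x 8q≤k big bound = *-cancelˡ-≤ (2 * h ^ suc q) {{m*n≢0 2 (h ^ suc q) {{_}} {{m^n≢0 h (suc q) {{>-nonZero (≤-trans (s≤s z≤n) 2≤h)}}}}}} (begin
      2 * hq * (4 * x)              ≡⟨ lemma hq x ⟩
      8 * (hq * x)                  ≤⟨ *-monoʳ-≤ 8 bound ⟩
      8 * (hq * (q * N) + (2 * n) ^ k) ≡⟨ lemma′ hq q N ((2 * n) ^ k) ⟩
      8 * q * (hq * N) + 8 * (2 * n) ^ k ≤⟨ +-mono-≤ (*-monoˡ-≤ (hq * N) 8q≤k) big ⟩
      k * (hq * N) + N * hq          ≤⟨ +-monoʳ-≤ (k * (hq * N)) (≤-trans (≤-reflexive (trans (*-comm N hq) (sym (*-identityˡ (hq * N))))) (*-monoˡ-≤ (hq * N) 1≤k)) ⟩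
      k * (hq * N) + k * (hq * N)    ≡⟨ lemma″ k hq N ⟩
      2 * hq * (k * N)              ∎)
      where
      open ≤-Reasoning
      hq = h ^ suc q
      lemma : ∀ a b → 2 * a * (4 * b) ≡ 8 * (a * b)
      lemma = solve-∀
      lemma′ : ∀ a b c d → 8 * (a * (b * c) + d) ≡ 8 * b * (a * c) + 8 * d
      lemma′ = solve-∀
      lemma″ : ∀ a b c → a * (b * c) + a * (b * c) ≡ 2 * b * (a * c)
      lemma″ = solve-∀

    -- If N were larger, small steps would spoil at most k N / 4 of the edges in either direction
    -- and unclean ends at most k N / 8 on either side. A quarter of k N survives, so k n² N ≤ 16 h²
    -- N (k + 2), which contradicts `up` as soon as 16 h² < k E.
    near-log-convexity : ∀ q → 8 * q ≤ k → 16 * (h * h) < k * E → N * h ^ suc q < 8 * (2 * n) ^ k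
    near-log-convexity q 8q≤k 16h²<kE = ≰⇒> λ big → <-irrefl refl (begin-strict
      16 * (h * h) * M             <⟨ *-monoˡ-< M {{>-nonZero (M-pos big)}} 16h²<kE ⟩
      k * E * M                    ≡⟨ lemma₁ k E (n * n) N ⟩
      E * (n * n * (k * N))        ≤⟨ *-monoʳ-≤ E (half big) ⟩
      E * (16 * (h * h) * P)       ≡⟨ lemma₂ E (h * h) P ⟩
      16 * (h * h) * (E * P)       ≤⟨ *-monoʳ-≤ (16 * (h * h)) up ⟩
      16 * (h * h) * M             ∎)
      where
      open ≤-Reasoning
      M = n * n * N
      P = u · walk w (2 + k)
      lemma₁ : ∀ a b c d → a * b * (c * d) ≡ b * (c * (a * d))
      lemma₁ = solve-∀
      lemma₂ : ∀ a b c → a * (16 * b * c) ≡ 16 * b * (a * c)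
      lemma₂ = solve-∀
      M-pos : 8 * (2 * n) ^ k ≤ N * h ^ suc q → 1 ≤ M
      M-pos big = *-mono-≤ (*-mono-≤ 1≤n 1≤n) (N-pos N (≤-trans (*-mono-≤ (s≤s (z≤n {7})) (>-nonZero⁻¹ ((2 * n) ^ k) {{m^n≢0 (2 * n) k {{>-nonZero (*-mono-≤ (s≤s (z≤n {1})) 1≤n)}}}})) big))
        where
        N-pos : ∀ x → 1 ≤ x * h ^ suc q → 1 ≤ x
        N-pos (suc x) _ = s≤s z≤n
      half : 8 * (2 * n) ^ k ≤ N * h ^ suc q → n * n * (k * N) ≤ 16 * (h * h) * P
      half big = *-cancelˡ-≤ 2 (+-cancelʳ-≤ (6 * (n * n * (k * N))) _ _ (begin
        2 * (n * n * (k * N)) + 6 * (n * n * (k * N))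
          ≡⟨ lemma₃ (n * n * (k * N)) ⟩
        8 * (n * n * (k * N))
          ≤⟨ *-monoʳ-≤ 8 all-edges ⟩
        8 * (4 * (h * h) * P + n * n * (a + b + 2 * c + 2 * d))
          ≡⟨ lemma₄ (h * h) P (n * n) a b c d ⟩
        2 * (16 * (h * h) * P) + n * n * (2 * (4 * a) + 2 * (4 * b) + 16 * c + 16 * d)
          ≤⟨ +-monoʳ-≤ (2 * (16 * (h * h) * P)) (*-monoʳ-≤ (n * n) (+-mono-≤ (+-mono-≤ (+-mono-≤
               (*-monoʳ-≤ 2 (small-bound q a 8q≤k big (≤-trans (Sᵘ.smallMass-bound w ∑w≤1 k q) (≤-reflexive (cong (λ x → h ^ suc q * (q * x) + (2 * n) ^ k) Nᵘ)))))
               (*-monoʳ-≤ 2 (small-bound q b 8q≤k big (≤-trans (Sʷ.smallMass-bound u ∑u≤1 k q) (≤-reflexive (cong (λ x → h ^ suc q * (q * x) + (2 * n) ^ k) (·-comm (walk w k) u)))))))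
               (unclean-bound uncleanᵘ _ (Qᵘ.unclean-mass w k) noiseᵘ-bound))
               (unclean-bound uncleanʷ _ (Qʷ.unclean-mass u k) noiseʷ-bound))) ⟩
        2 * (16 * (h * h) * P) + n * n * (2 * (k * N) + 2 * (k * N) + k * N + k * N)
          ≡⟨ cong (_+_ (2 * (16 * (h * h) * P))) (lemma₅ (n * n) (k * N)) ⟩
        2 * (16 * (h * h) * P) + 6 * (n * n * (k * N)) ∎))
        where
        a = antidiagonal (Sᵘ.smallMass w) 0 k
        b = antidiagonal (Sʷ.smallMass u) 0 k
        c = antidiagonal uncleanᵘ 0 k
        d = antidiagonal uncleanʷ 0 k
        Nᵘ : walk u k · w ≡ N
        Nᵘ = trans (walk-· u w k 0) (cong (λ j → u · walk w j) (+-identityʳ k))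
        lemma₃ : ∀ x → 2 * x + 6 * x ≡ 8 * x
        lemma₃ = solve-∀
        lemma₄ : ∀ x p y a b c d → 8 * (4 * x * p + y * (a + b + 2 * c + 2 * d))
                 ≡ 2 * (16 * x * p) + y * (2 * (4 * a) + 2 * (4 * b) + 16 * c + 16 * d)
        lemma₄ = solve-∀
        lemma₅ : ∀ x y → x * (2 * y + 2 * y + y + y) ≡ 6 * (x * y)
        lemma₅ = solve-∀

-- Walks on the cube

_⊕_ : ∀ {r} → Vec Bool r → Vec Bool r → Vec Bool r
_⊕_ = zipWith _xor_

⊕-invol : ∀ {r} (c v : Vec Bool r) → c ⊕ (c ⊕ v) ≡ v
⊕-invol []      []      = refl
⊕-invol (a ∷ c) (b ∷ v) = cong₂ _∷_ (xor-invol a b) (⊕-invol c v)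
  where
  xor-invol : ∀ a b → a xor (a xor b) ≡ b
  xor-invol false b     = refl
  xor-invol true  false = refl
  xor-invol true  true  = refl

vectors : ∀ r → List (Vec Bool r)
vectors zero    = [] ∷ []
vectors (suc r) = map (false ∷_) (vectors r) ++ map (true ∷_) (vectors r)

∑-vectors : ∀ r (f : Vec Bool (suc r) → ℕ) → ∑ (vectors (suc r)) f ≡ ∑ (vectors r) (f ∘ (false ∷_)) + ∑ (vectors r) (f ∘ (true ∷_))
∑-vectors r f = trans (∑-++ (map (false ∷_) (vectors r)) _ f)
  (cong₂ _+_ (∑-map (false ∷_) (vectors r) f) (∑-map (true ∷_) (vectors r) f))

∑-⊕ : ∀ {r} (c : Vec Bool r) (f : Vec Bool r → ℕ) → ∑ (vectors r) (λ v → f (c ⊕ v)) ≡ ∑ (vectors r) f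
∑-⊕         []          f = refl
∑-⊕ {suc r} (false ∷ c) f = trans (∑-vectors r _)
  (trans (cong₂ _+_ (∑-⊕ c (f ∘ (false ∷_))) (∑-⊕ c (f ∘ (true ∷_)))) (sym (∑-vectors r f)))
∑-⊕ {suc r} (true ∷ c)  f = trans (∑-vectors r _)
  (trans (cong₂ _+_ (∑-⊕ c (f ∘ (true ∷_))) (∑-⊕ c (f ∘ (false ∷_))))
         (trans (+-comm _ (∑ (vectors r) (f ∘ (false ∷_)))) (sym (∑-vectors r f))))

point : ∀ {r} → Vec Bool r → Vec Bool r → ℕ
point []      []      = 1
point (a ∷ p) (b ∷ v) = ⟦ not (a xor b) ⟧ * point p v

point≤1 : ∀ {r} (p v : Vec Bool r) → point p v ≤ 1
point≤1 []      []      = ≤-refl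
point≤1 (a ∷ p) (b ∷ v) = *-mono-≤ (⟦⟧≤1 (not (a xor b))) (point≤1 p v)

∑-point : ∀ {r} (p : Vec Bool r) (f : Vec Bool r → ℕ) → ∑ (vectors r) (λ v → point p v * f v) ≡ f p
∑-point [] f = trans (+-identityʳ _) (*-identityˡ (f []))
∑-point {suc r} (false ∷ p) f = trans (∑-vectors r _) (trans (cong₂ _+_
  (trans (∑-cong (vectors r) λ v → cong (_* f (false ∷ v)) (*-identityˡ (point p v))) (∑-point p (f ∘ (false ∷_))))
  (∑-zero (vectors r))) (+-identityʳ _))
∑-point {suc r} (true ∷ p) f = trans (∑-vectors r _) (cong₂ _+_ (∑-zero (vectors r))
  (trans (∑-cong (vectors r) λ v → cong (_* f (true ∷ v)) (*-identityˡ (point p v))) (∑-point p (f ∘ (true ∷_)))))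

∑-point-1 : ∀ {r} (p : Vec Bool r) → ∑ (vectors r) (point p) ≡ 1
∑-point-1 {r} p = trans (∑-cong (vectors r) λ v → sym (*-identityʳ (point p v))) (∑-point p (λ _ → 1))

-- Leaves as affine subspaces

record Affine (n : ℕ) : Set where
  field
    value : F2^ n → Bool
    slope : Fin n → Bool
    flips : ∀ i x → value (x [ i ]%= not) ≡ slope i xor value x
open Affine

complement : ∀ {n} → Affine n → Affine n
complement φ = record
  { value = not ∘ value φ
  ; slope = slope φ
  ; flips = λ i x → trans (cong not (flips φ i x)) (not-xor (slope φ i) (value φ x)) }
  where
  not-xor : ∀ a b → not (a xor b) ≡ a xor not b
  not-xor false b = refl
  not-xor true  b = refl

Cell : ℕ → Set
Cell n = List (Affine n)

inside : ∀ {n} → Cell n → F2^ n → ℕ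
inside []      x = 1
inside (φ ∷ ℓ) x = ⟦ not (value φ x) ⟧ * inside ℓ x

inside-++ : ∀ {n} (ℓ ℓ′ : Cell n) x → inside (ℓ ++ ℓ′) x ≡ inside ℓ x * inside ℓ′ x
inside-++ []      ℓ′ x = sym (*-identityˡ _)
inside-++ (φ ∷ ℓ) ℓ′ x = trans (cong (⟦ not (value φ x) ⟧ *_) (inside-++ ℓ ℓ′ x))
  (sym (*-assoc ⟦ not (value φ x) ⟧ (inside ℓ x) (inside ℓ′ x)))

syndrome : ∀ {n} (ℓ : Cell n) → F2^ n → Vec Bool (length ℓ)
syndrome []      x = []
syndrome (φ ∷ ℓ) x = value φ x ∷ syndrome ℓ x

column : ∀ {n} (ℓ : Cell n) → Fin n → Vec Bool (length ℓ)
column []      i = []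
column (φ ∷ ℓ) i = slope φ i ∷ column ℓ i

-- With the affine forms of a cell as parity checks, flipping a coordinate translates the syndrome
-- by a column. This makes the columns the generators of the Cayley graph.
syndrome-flip : ∀ {n} (ℓ : Cell n) i x → syndrome ℓ (x [ i ]%= not) ≡ column ℓ i ⊕ syndrome ℓ x
syndrome-flip []      i x = refl
syndrome-flip (φ ∷ ℓ) i x = cong₂ _∷_ (flips φ i x) (syndrome-flip ℓ i x)

inside-point : ∀ {n} (ℓ : Cell n) x → inside ℓ x ≡ point (replicate _ false) (syndrome ℓ x)
inside-point []      x = refl
inside-point (φ ∷ ℓ) x = cong (⟦ not (value φ x) ⟧ *_) (inside-point ℓ x)

-- Tuples with repetition take the place of subsets: they are what walks count, and `collisions`
-- controls the difference.
sweep : ∀ {n} → ℕ → F2^ n → (F2^ n → ℕ) → ℕ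
sweep     zero    x F = F x
sweep {n} (suc j) x F = ∑ (allFin n) λ i → sweep j (x [ i ]%= not) F

module _ {n : ℕ} where

  length-allFin : length (allFin n) ≡ n
  length-allFin = length-tabulate id

  sweep-mono : ∀ j x {F G : F2^ n → ℕ} → (∀ y → F y ≤ G y) → sweep j x F ≤ sweep j x G
  sweep-mono zero    x e = e x
  sweep-mono (suc j) x e = ∑-mono (allFin n) λ i → sweep-mono j _ e

  sweep-+ : ∀ j x (F G : F2^ n → ℕ) → sweep j x (λ y → F y + G y) ≡ sweep j x F + sweep j x G
  sweep-+ zero    x F G = refl
  sweep-+ (suc j) x F G = trans (∑-cong (allFin n) λ i → sweep-+ j _ F G) (∑-+ (allFin n) _ _)

  sweep-* : ∀ j x a (F : F2^ n → ℕ) → sweep j x (λ y → a * F y) ≡ a * sweep j x F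
  sweep-* zero    x a F = refl
  sweep-* (suc j) x a F = trans (∑-cong (allFin n) λ i → sweep-* j _ a F) (∑-*ˡ (allFin n) a _)

  sweep-≤ : ∀ j (x : F2^ n) {F z} → (∀ y → weight y ≤ weight x + j → F y ≤ z) → sweep j x F ≤ n ^ j * z
  sweep-≤ zero    x {F} {z} le = ≤-trans (le x (m≤m+n _ 0)) (≤-reflexive (sym (*-identityˡ z)))
  sweep-≤ (suc j) x {F} {z} le = begin
    (∑ (allFin n) λ i → sweep j (x [ i ]%= not) F)
      ≤⟨ ∑-mono (allFin n) (λ i → sweep-≤ j (x [ i ]%= not) λ y y≤ → le y (≤-trans y≤
           (≤-trans (+-monoˡ-≤ j (weight-flip-≤ i x)) (≤-reflexive (sym (+-suc (weight x) j)))))) ⟩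
    (∑ (allFin n) λ _ → n ^ j * z)
      ≡⟨ trans (∑-const (allFin n) _) (cong (_* (n ^ j * z)) length-allFin) ⟩
    n * (n ^ j * z)
      ≡⟨ *-assoc n (n ^ j) z ⟨
    n ^ suc j * z ∎
    where
    open ≤-Reasoning
    weight-flip-≤ : ∀ {n} (i : Fin n) x → weight (x [ i ]%= not) ≤ suc (weight x)
    weight-flip-≤ zero    (true  ∷ x) = m≤n⇒m≤1+n (n≤1+n _)
    weight-flip-≤ zero    (false ∷ x) = ≤-refl
    weight-flip-≤ (suc i) (true  ∷ x) = s≤s (weight-flip-≤ i x)
    weight-flip-≤ (suc i) (false ∷ x) = weight-flip-≤ i x

  sweep-const : ∀ j (x : F2^ n) z → sweep j x (λ _ → z) ≡ n ^ j * z
  sweep-const zero    x z = sym (*-identityˡ z)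
  sweep-const (suc j) x z = trans (∑-cong (allFin n) λ i → sweep-const j _ z)
    (trans (∑-const (allFin n) _) (trans (cong (_* (n ^ j * z)) length-allFin) (sym (*-assoc n (n ^ j) z))))

  misses : ℕ → F2^ n → ℕ
  misses m y = 𝟙 (¬? (weight y ≟ m))

∑-lookup : ∀ {n} (x : F2^ n) → ∑ (allFin n) (λ i → ⟦ lookup x i ⟧) ≡ weight x
∑-lookup []          = refl
∑-lookup {suc n} (b ∷ x) = trans (cong (_+_ (⟦ b ⟧)) (trans (cong (λ l → ∑ l (λ i → ⟦ lookup (b ∷ x) i ⟧)) (sym (map-tabulate id suc)))
  (trans (∑-map suc (allFin n) _) (∑-lookup x)))) (head b)
  where
  head : ∀ b → ⟦ b ⟧ + weight x ≡ weight (b ∷ x)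
  head true  = refl
  head false = refl

weight-flip : ∀ {n} (i : Fin n) x → lookup x i ≡ false → weight (x [ i ]%= not) ≡ suc (weight x)
weight-flip zero    (false ∷ x) e = refl
weight-flip (suc i) (true  ∷ x) e = cong suc (weight-flip i x e)
weight-flip (suc i) (false ∷ x) e = weight-flip i x e

-- A union bound over the first flip: it hits one of the `weight x` ones, and the whole branch is
-- given up, or it raises the weight and induction applies.
collisions : ∀ {n} j (x : F2^ n) → n * sweep j x (misses (weight x + j)) ≤ j * (weight x + j) * n ^ j
collisions {n} zero    x rewrite +-identityʳ (weight x) with weight x ≟ weight x
... | yes _ = ≤-reflexive (*-zeroʳ n)
... | no ne = contradiction refl ne
collisions {n} (suc j) x = begin
  n * (∑ (allFin n) λ i → sweep j (x [ i ]%= not) (misses (weight x + suc j)))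
    ≡⟨ ∑-*ˡ (allFin n) n _ ⟨
  (∑ (allFin n) λ i → n * sweep j (x [ i ]%= not) (misses (weight x + suc j)))
    ≤⟨ ∑-mono (allFin n) (λ i → one i (lookup x i) refl) ⟩
  (∑ (allFin n) λ i → ⟦ lookup x i ⟧ * n ^ suc j + c)
    ≡⟨ trans (∑-+ (allFin n) _ _) (cong₂ _+_ (trans (∑-*ʳ (allFin n) (n ^ suc j) _) (cong (_* n ^ suc j) (∑-lookup x)))
         (trans (∑-const (allFin n) c) (cong (_* c) (length-allFin {n})))) ⟩
  weight x * n ^ suc j + n * (j * (suc (weight x) + j) * n ^ j)
    ≤⟨ m≤m+n _ ((1 + j) * n ^ suc j) ⟩
  weight x * n ^ suc j + n * (j * (suc (weight x) + j) * n ^ j) + (1 + j) * n ^ suc j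
    ≡⟨ lemma (weight x) n j (n ^ j) ⟩
  suc j * (weight x + suc j) * n ^ suc j ∎
  where
  open ≤-Reasoning
  c = j * (suc (weight x) + j) * n ^ j
  lemma : ∀ w n j p → w * (n * p) + n * (j * (suc w + j) * p) + (1 + j) * (n * p) ≡ suc j * (w + suc j) * (n * p)
  lemma = solve-∀
  one : ∀ i b → lookup x i ≡ b → n * sweep j (x [ i ]%= not) (misses (weight x + suc j)) ≤ ⟦ b ⟧ * n ^ suc j + c
  one i true  e = m≤n⇒m≤n+o c (≤-trans (*-monoʳ-≤ n (≤-trans (sweep-≤ j (x [ i ]%= not) λ y _ → 𝟙≤1 (¬? (weight y ≟ weight x + suc j)))
    (≤-reflexive (*-identityʳ (n ^ j))))) (≤-reflexive (sym (*-identityˡ _))))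
  one i false e = ≤-trans (≤-reflexive (cong (λ m → n * sweep j (x [ i ]%= not) (misses m))
      (trans (+-suc (weight x) j) (cong (_+ j) (sym (weight-flip i x e))))))
    (≤-trans (collisions j (x [ i ]%= not)) (≤-reflexive (cong (λ m → j * (m + j) * n ^ j) (weight-flip i x e))))

-- Non-negative combinations of cell indicators

Combination : ℕ → Set
Combination n = List (ℕ × Cell n)

combine : ∀ {n} → Combination n → F2^ n → ℕ
combine L x = ∑ L λ (a , ℓ) → a * inside ℓ x

mass : ∀ {n} → Combination n → ℕ
mass L = ∑ L proj₁

module _ {n : ℕ} where

  infixr 7 _⊗_
  -- Concatenating two lists of affine forms intersects their cells. Products of combinations are
  -- thus again combinations of affine subspaces, which is why repeated runs are covered by the same
  -- bound.
  _⊗_ : Combination n → Combination n → Combination n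
  []            ⊗ L′ = []
  ((a , ℓ) ∷ L) ⊗ L′ = map (λ (a′ , ℓ′) → a * a′ , ℓ ++ ℓ′) L′ ++ L ⊗ L′

  combine-⊗ : ∀ L L′ x → combine (L ⊗ L′) x ≡ combine L x * combine L′ x
  combine-⊗ []            L′ x = refl
  combine-⊗ ((a , ℓ) ∷ L) L′ x = begin
    combine (map (λ (a′ , ℓ′) → a * a′ , ℓ ++ ℓ′) L′ ++ L ⊗ L′) x
      ≡⟨ ∑-++ (map _ L′) (L ⊗ L′) _ ⟩
    combine (map (λ (a′ , ℓ′) → a * a′ , ℓ ++ ℓ′) L′) x + combine (L ⊗ L′) x
      ≡⟨ cong₂ _+_ (trans (∑-map _ L′ _) (∑-cong L′ λ (a′ , ℓ′) → trans (cong (a * a′ *_) (inside-++ ℓ ℓ′ x)) (lemma a a′ (inside ℓ x) (inside ℓ′ x)))) (combine-⊗ L L′ x) ⟩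
    (∑ L′ λ (a′ , ℓ′) → a * inside ℓ x * (a′ * inside ℓ′ x)) + combine L x * combine L′ x
      ≡⟨ cong (_+ combine L x * combine L′ x) (∑-*ˡ L′ (a * inside ℓ x) _) ⟩
    a * inside ℓ x * combine L′ x + combine L x * combine L′ x
      ≡⟨ *-distribʳ-+ (combine L′ x) (a * inside ℓ x) (combine L x) ⟨
    (a * inside ℓ x + combine L x) * combine L′ x ∎
    where
    open ≡-Reasoning
    lemma : ∀ a b c d → a * b * (c * d) ≡ a * c * (b * d)
    lemma = solve-∀

  mass-⊗ : ∀ L L′ → mass (L ⊗ L′) ≡ mass L * mass L′
  mass-⊗ []            L′ = refl
  mass-⊗ ((a , ℓ) ∷ L) L′ = trans (∑-++ (map _ L′) (L ⊗ L′) proj₁) (trans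
    (cong₂ _+_ (trans (∑-map _ L′ proj₁) (∑-*ˡ L′ a proj₁)) (mass-⊗ L L′))
    (sym (*-distribʳ-+ (mass L′) a (mass L))))

  power : Combination n → ℕ → Combination n
  power L zero    = (1 , []) ∷ []
  power L (suc p) = L ⊗ power L p

  combine-power : ∀ L p x → combine (power L p) x ≡ combine L x ^ p
  combine-power L zero    x = refl
  combine-power L (suc p) x = trans (combine-⊗ L (power L p) x) (cong (combine L x *_) (combine-power L p x))

  mass-power : ∀ L p → mass (power L p) ≡ mass L ^ p
  mass-power L zero    = refl
  mass-power L (suc p) = trans (mass-⊗ L (power L p)) (cong (mass L *_) (mass-power L p))

  sweep-combine : ∀ j x L → sweep j x (combine L) ≡ ∑ L λ (a , ℓ) → a * sweep j x (inside ℓ)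
  sweep-combine j x []            = trans (sweep-const j x 0) (*-zeroʳ (n ^ j))
  sweep-combine j x ((a , ℓ) ∷ L) = trans (sweep-+ j x _ (combine L)) (cong₂ _+_ (sweep-* j x a (inside ℓ)) (sweep-combine j x L))

twoBefore : (ℕ → ℕ) → ℕ → ℕ
twoBefore f zero          = 0
twoBefore f (suc zero)    = 0
twoBefore f (suc (suc j)) = f j

∑-twoBefore : ∀ {A : Set} (xs : List A) (a : A → ℕ) (f : A → ℕ → ℕ) k →
  ∑ xs (λ x → a x * twoBefore (f x) k) ≡ twoBefore (λ j → ∑ xs λ x → a x * f x j) k
∑-twoBefore xs a f zero          = trans (∑-cong xs λ x → *-zeroʳ (a x)) (∑-zero xs)
∑-twoBefore xs a f (suc zero)    = trans (∑-cong xs λ x → *-zeroʳ (a x)) (∑-zero xs)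
∑-twoBefore xs a f (suc (suc k)) = refl

-- The corruption bound for combinations of cells

module Corruption {n : ℕ} (x : F2^ n) (k E h q : ℕ) (1≤n : 1 ≤ n) (1≤k : 1 ≤ k) (96≤E : 96 ≤ E) (2≤h : 2 ≤ h)
                  (8q≤k : 8 * q ≤ k) (16h²<kE : 16 * (h * h) < k * E) where

  module _ (ℓ : Cell n) where

    walk : (Vec Bool (length ℓ) → ℕ) → ℕ → Vec Bool (length ℓ) → ℕ
    walk = Graph.walk (Vec Bool (length ℓ)) (Fin n) (vectors (length ℓ)) (allFin n) n (length-allFin {n})
             (λ i v → column ℓ i ⊕ v) (λ i → ⊕-invol (column ℓ i)) (λ i → ∑-⊕ (column ℓ i))

    origin : Vec Bool (length ℓ)
    origin = replicate _ false

    sweep-walk : ∀ j y → sweep j y (inside ℓ) ≡ walk (point origin) j (syndrome ℓ y)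
    sweep-walk zero    y = inside-point ℓ y
    sweep-walk (suc j) y = ∑-cong (allFin n) λ i →
      trans (sweep-walk j (y [ i ]%= not)) (cong (walk (point origin) j) (syndrome-flip ℓ i y))

    count : ℕ → ℕ
    count j = sweep j x (inside ℓ)

    count-walk : ∀ j → ∑ (vectors (length ℓ)) (λ v → point (syndrome ℓ x) v * walk (point origin) j v) ≡ count j
    count-walk j = trans (∑-point (syndrome ℓ x) (walk (point origin) j)) (sym (sweep-walk j x))

    -- The growth hypotheses hold only on average over cells. A cell that violates one of them is
    -- dominated by its own count at k + 2 or k - 2; the others have tiny counts.
    cell-bound : n * n * (h ^ suc q * count k)
      ≤ h ^ suc q * (E * count (2 + k)) + h ^ suc q * (n * n * (E * (n * n * twoBefore count k)))
        + n * n * (8 * (2 * n) ^ k)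
    cell-bound with E * count (2 + k) ≤? n * n * count k
    ... | no ¬up = m≤n⇒m≤n+o _ (m≤n⇒m≤n+o _ (begin
      n * n * (h ^ suc q * count k)    ≡⟨ lemma (n * n) (h ^ suc q) (count k) ⟩
      h ^ suc q * (n * n * count k)    ≤⟨ *-monoʳ-≤ (h ^ suc q) (<⇒≤ (≰⇒> ¬up)) ⟩
      h ^ suc q * (E * count (2 + k))  ∎))
      where
      open ≤-Reasoning
      lemma : ∀ a b c → a * (b * c) ≡ b * (a * c)
      lemma = solve-∀
    ... | yes up with E * (n * n * twoBefore count k) ≤? count k
    ...   | no ¬down = m≤n⇒m≤n+o _ (m≤n⇒m≤o+n (h ^ suc q * (E * count (2 + k))) (begin
      n * n * (h ^ suc q * count k)  ≡⟨ lemma (n * n) (h ^ suc q) (count k) ⟩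
      h ^ suc q * (n * n * count k)  ≤⟨ *-monoʳ-≤ (h ^ suc q) (*-monoʳ-≤ (n * n) (<⇒≤ (≰⇒> ¬down))) ⟩
      _                              ∎))
      where
      open ≤-Reasoning
      lemma : ∀ a b c → a * (b * c) ≡ b * (a * c)
      lemma = solve-∀
    ...   | yes down = m≤n⇒m≤o+n _ (*-monoʳ-≤ (n * n) (begin
      h ^ suc q * count k  ≡⟨ trans (*-comm (h ^ suc q) _) (cong (_* h ^ suc q) (sym (count-walk k))) ⟩
      ∑ (vectors (length ℓ)) (λ v → point (syndrome ℓ x) v * walk (point origin) k v) * h ^ suc q
                           ≤⟨ <⇒≤ (Graph.NearLogConvexity.near-log-convexity
                                (Vec Bool (length ℓ)) (Fin n) (vectors (length ℓ)) (allFin n) n (length-allFin {n})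
                                (λ i v → column ℓ i ⊕ v) (λ i → ⊕-invol (column ℓ i)) (λ i → ∑-⊕ (column ℓ i))
                                (point (syndrome ℓ x)) (point origin)
                                (point≤1 (syndrome ℓ x)) (point≤1 origin) (≤-reflexive (∑-point-1 (syndrome ℓ x))) (≤-reflexive (∑-point-1 origin))
                                k E h 1≤k 1≤n 96≤E 2≤h
                                (subst₂ (λ a b → E * a ≤ n * n * b) (sym (count-walk (2 + k))) (sym (count-walk k)) up)
                                (λ j e → subst₂ (λ a b → E * (n * n * a) ≤ b) (trans (cong (twoBefore count) e) (sym (count-walk j)))
                                           (sym (count-walk k)) down)
                                q 8q≤k 16h²<kE) ⟩
      8 * (2 * n) ^ k      ∎))
      where open ≤-Reasoning

  -- The factor 4 E, rather than E, makes each of the two neighbour terms of `cell-bound` absorb at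
  -- most a quarter of the left side; the remaining half doubles the 8 to 16.
  corruption : ∀ L → let acc = λ j → sweep j x (combine L) in
    4 * E * acc (2 + k) ≤ n * n * acc k → 4 * E * (n * n * twoBefore acc k) ≤ acc k →
    h ^ suc q * acc k ≤ 16 * (2 * n) ^ k * mass L
  corruption L up down = *-cancelˡ-≤ (2 * (n * n)) {{>-nonZero (*-mono-≤ (s≤s (z≤n {1})) (*-mono-≤ 1≤n 1≤n))}}
    (+-cancelʳ-≤ (2 * (hq * (n * n * acc k))) _ _ (begin
    2 * (n * n) * (hq * acc k) + 2 * (hq * (n * n * acc k))
      ≡⟨ lemma₁ (n * n) hq (acc k) ⟩
    4 * (n * n * (hq * acc k))
      ≤⟨ *-monoʳ-≤ 4 total ⟩
    4 * (hq * (E * acc (2 + k)) + hq * (n * n * (E * (n * n * twoBefore acc k))) + n * n * (8 * (2 * n) ^ k) * mass L)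
      ≡⟨ lemma₂ hq E (acc (2 + k)) (n * n) (n * n * twoBefore acc k) ((2 * n) ^ k) (mass L) ⟩
    2 * (n * n) * (16 * (2 * n) ^ k * mass L) + (hq * (4 * E * acc (2 + k)) + hq * (n * n * (4 * E * (n * n * twoBefore acc k))))
      ≤⟨ +-monoʳ-≤ (2 * (n * n) * (16 * (2 * n) ^ k * mass L)) (+-mono-≤ (*-monoʳ-≤ hq up) (*-monoʳ-≤ hq (*-monoʳ-≤ (n * n) down))) ⟩
    2 * (n * n) * (16 * (2 * n) ^ k * mass L) + (hq * (n * n * acc k) + hq * (n * n * acc k))
      ≡⟨ cong (_+_ (2 * (n * n) * (16 * (2 * n) ^ k * mass L))) (lemma₃ (hq * (n * n * acc k))) ⟩
    2 * (n * n) * (16 * (2 * n) ^ k * mass L) + 2 * (hq * (n * n * acc k)) ∎))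
    where
    open ≤-Reasoning
    hq = h ^ suc q
    acc : ℕ → ℕ
    acc j = sweep j x (combine L)
    lemma₁ : ∀ a b c → 2 * a * (b * c) + 2 * (b * (a * c)) ≡ 4 * (a * (b * c))
    lemma₁ = solve-∀
    lemma₂ : ∀ hq E a m b p M → 4 * (hq * (E * a) + hq * (m * (E * b)) + m * (8 * p) * M)
             ≡ 2 * m * (16 * p * M) + (hq * (4 * E * a) + hq * (m * (4 * E * b)))
    lemma₂ = solve-∀
    lemma₃ : ∀ a → a + a ≡ 2 * a
    lemma₃ = solve-∀
    lemma₄ : ∀ a x y z → a * (x * (y * z)) ≡ x * (y * (a * z))
    lemma₄ = solve-∀
    lemma₅ : ∀ a hq E u m v z → a * (hq * (E * u) + hq * (m * (E * (m * v))) + z)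
             ≡ hq * (E * (a * u)) + hq * (m * (E * (m * (a * v)))) + a * z
    lemma₅ = solve-∀
    pull : ∀ {A : Set} (xs : List A) hq E m z (a u v : A → ℕ) →
      ∑ xs (λ i → hq * (E * (a i * u i)) + hq * (m * (E * (m * (a i * v i)))) + a i * z)
      ≡ hq * (E * ∑ xs (λ i → a i * u i)) + hq * (m * (E * (m * ∑ xs (λ i → a i * v i)))) + z * ∑ xs a
    pull []       hq E m z a u v = lemma₆ hq E m z
      where
      lemma₆ : ∀ hq E m z → 0 ≡ hq * (E * 0) + hq * (m * (E * (m * 0))) + z * 0
      lemma₆ = solve-∀
    pull (i ∷ xs) hq E m z a u v rewrite pull xs hq E m z a u v =
      lemma₇ hq E m z (a i * u i) (a i * v i) (a i) (∑ xs (λ i → a i * u i)) (∑ xs (λ i → a i * v i)) (∑ xs a)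
      where
      lemma₇ : ∀ hq E m z u v a u′ v′ a′ →
        hq * (E * u) + hq * (m * (E * (m * v))) + a * z + (hq * (E * u′) + hq * (m * (E * (m * v′))) + z * a′)
        ≡ hq * (E * (u + u′)) + hq * (m * (E * (m * (v + v′)))) + z * (a + a′)
      lemma₇ = solve-∀
    total : n * n * (hq * acc k)
      ≤ hq * (E * acc (2 + k)) + hq * (n * n * (E * (n * n * twoBefore acc k))) + n * n * (8 * (2 * n) ^ k) * mass L
    total = begin
      n * n * (hq * acc k)
        ≡⟨ cong (λ y → n * n * (hq * y)) (sweep-combine k x L) ⟩
      n * n * (hq * ∑ L (λ (a , ℓ) → a * count ℓ k))
        ≡⟨ trans (sym (*-assoc (n * n) hq _)) (sym (∑-*ˡ L (n * n * hq) _)) ⟩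
      ∑ L (λ (a , ℓ) → n * n * hq * (a * count ℓ k))
        ≡⟨ ∑-cong L (λ (a , ℓ) → trans (*-assoc (n * n) hq _) (sym (lemma₄ a (n * n) hq (count ℓ k)))) ⟩
      ∑ L (λ (a , ℓ) → a * (n * n * (hq * count ℓ k)))
        ≤⟨ ∑-mono L (λ (a , ℓ) → *-monoʳ-≤ a (cell-bound ℓ)) ⟩
      ∑ L (λ (a , ℓ) → a * (hq * (E * count ℓ (2 + k)) + hq * (n * n * (E * (n * n * twoBefore (count ℓ) k))) + n * n * (8 * (2 * n) ^ k)))
        ≡⟨ ∑-cong L (λ (a , ℓ) → lemma₅ a hq E (count ℓ (2 + k)) (n * n) (twoBefore (count ℓ) k) (n * n * (8 * (2 * n) ^ k))) ⟩
      ∑ L (λ (a , ℓ) → hq * (E * (a * count ℓ (2 + k))) + hq * (n * n * (E * (n * n * (a * twoBefore (count ℓ) k)))) + a * (n * n * (8 * (2 * n) ^ k)))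
        ≡⟨ pull L hq E (n * n) (n * n * (8 * (2 * n) ^ k)) proj₁ (λ (a , ℓ) → count ℓ (2 + k)) (λ (a , ℓ) → twoBefore (count ℓ) k) ⟩
      hq * (E * ∑ L (λ (a , ℓ) → a * count ℓ (2 + k))) + hq * (n * n * (E * (n * n * ∑ L (λ (a , ℓ) → a * twoBefore (count ℓ) k)))) + n * n * (8 * (2 * n) ^ k) * mass L
        ≡⟨ cong₂ (λ y z → hq * (E * y) + hq * (n * n * (E * (n * n * z))) + n * n * (8 * (2 * n) ^ k) * mass L)
             (sym (sweep-combine (2 + k) x L))
             (trans (∑-twoBefore L proj₁ (λ (a , ℓ) → count ℓ) k) (twoBefore-cong (λ j → sym (sweep-combine j x L)) k)) ⟩
      hq * (E * acc (2 + k)) + hq * (n * n * (E * (n * n * twoBefore acc k))) + n * n * (8 * (2 * n) ^ k) * mass L ∎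
      where
      twoBefore-cong : ∀ {f g} → (∀ j → f j ≡ g j) → ∀ j → twoBefore f j ≡ twoBefore g j
      twoBefore-cong e zero          = refl
      twoBefore-cong e (suc zero)    = refl
      twoBefore-cong e (suc (suc j)) = e j

-- Trees with some coordinates fixed to one

weight-⧺ : ∀ {n m} (x : F2^ n) (y : F2^ m) → weight (x ⧺ y) ≡ weight x + weight y
weight-⧺ []          y = refl
weight-⧺ (true  ∷ x) y = cong suc (weight-⧺ x y)
weight-⧺ (false ∷ x) y = weight-⧺ x y

ones : ∀ m → F2^ m
ones m = replicate m true

weight-ones : ∀ m → weight (ones m) ≡ m
weight-ones zero    = refl
weight-ones (suc m) = cong suc (weight-ones m)

weight-zeros : ∀ n → weight (replicate n false) ≡ 0
weight-zeros zero    = refl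
weight-zeros (suc n) = weight-zeros n

-- The fixed ones make the inner product affine instead of linear in the free coordinates.
query : ∀ {n} m → F2^ (n + m) → Affine n
query m y = record
  { value = λ x → ⟨ x ⧺ ones m , y ⟩
  ; slope = λ i → lookup y (i ↑ˡ m)
  ; flips = λ i x → inner-flip i x (ones m) y }
  where
  inner-flip : ∀ {n m} (i : Fin n) (x : F2^ n) (o : F2^ m) y →
    ⟨ (x [ i ]%= not) ⧺ o , y ⟩ ≡ lookup y (i ↑ˡ m) xor ⟨ x ⧺ o , y ⟩
  inner-flip zero    (b ∷ x) o (c ∷ y) = lemma b c ⟨ x ⧺ o , y ⟩
    where
    lemma : ∀ b c d → (not b ∧ c) xor d ≡ c xor ((b ∧ c) xor d)
    lemma false false d     = refl
    lemma true  false d     = refl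
    lemma false true  d     = refl
    lemma true  true  false = refl
    lemma true  true  true  = refl
  inner-flip (suc i) (b ∷ x) o (c ∷ y) = trans (cong ((b ∧ c) xor_) (inner-flip i x o y))
    (lemma (b ∧ c) (lookup y (i ↑ˡ _)) ⟨ x ⧺ o , y ⟩)
    where
    lemma : ∀ a b c → a xor (b xor c) ≡ b xor (a xor c)
    lemma false b     c     = refl
    lemma true  false c     = refl
    lemma true  true  c     = refl

constrain : ∀ {n} → Affine n → Combination n → Combination n
constrain φ = map λ (a , ℓ) → a , φ ∷ ℓ

combine-constrain : ∀ {n} (φ : Affine n) L x → combine (constrain φ L) x ≡ ⟦ not (value φ x) ⟧ * combine L x
combine-constrain φ L x = trans (∑-map _ L _) (trans
  (∑-cong L λ (a , ℓ) → lemma a ⟦ not (value φ x) ⟧ (inside ℓ x)) (∑-*ˡ L ⟦ not (value φ x) ⟧ _))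
  where
  lemma : ∀ a b c → a * (b * c) ≡ b * (a * c)
  lemma = solve-∀

acceptingLeaves : ∀ {n} m → ℕ → PDT (n + m) → Combination n
acceptingLeaves m a (leaf false)  = []
acceptingLeaves m a (leaf true)   = (a , []) ∷ []
acceptingLeaves m a (node y l r) =
  constrain (query m y) (acceptingLeaves m a l) ++ constrain (complement (query m y)) (acceptingLeaves m a r)

-- At every node exactly one of the query and its complement vanishes at x, so only the cell of the
-- leaf reached can contribute.
combine-acceptingLeaves : ∀ {n} m a (t : PDT (n + m)) x →
  combine (acceptingLeaves m a t) x ≡ a * ⟦ eval t (x ⧺ ones m) ⟧
combine-acceptingLeaves m a (leaf false)  x = sym (*-zeroʳ a)
combine-acceptingLeaves m a (leaf true)   x = +-identityʳ (a * 1)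
combine-acceptingLeaves m a (node y l r) x = trans
  (trans (∑-++ (constrain φ (acceptingLeaves m a l)) _ _)
    (cong₂ _+_ (trans (combine-constrain φ (acceptingLeaves m a l) x) (cong (⟦ not (value φ x) ⟧ *_) (combine-acceptingLeaves m a l x)))
               (trans (combine-constrain (complement φ) (acceptingLeaves m a r) x) (cong (⟦ not (not (value φ x)) ⟧ *_) (combine-acceptingLeaves m a r x)))))
  (branch (value φ x))
  where
  φ = query m y
  A = eval l (x ⧺ ones m)
  B = eval r (x ⧺ ones m)
  branch : ∀ b → ⟦ not b ⟧ * (a * ⟦ A ⟧) + ⟦ not (not b) ⟧ * (a * ⟦ B ⟧) ≡ a * ⟦ if b then B else A ⟧
  branch false = trans (+-identityʳ _) (*-identityˡ _)
  branch true  = *-identityˡ _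

mass-acceptingLeaves : ∀ {n} m a (t : PDT (n + m)) → mass (acceptingLeaves {n} m a t) ≤ a * size t
mass-acceptingLeaves m a (leaf false)  = z≤n
mass-acceptingLeaves m a (leaf true)   = ≤-reflexive (trans (+-identityʳ a) (sym (*-identityʳ a)))
mass-acceptingLeaves m a (node y l r) = begin
  mass (constrain (query m y) (acceptingLeaves m a l) ++ constrain (complement (query m y)) (acceptingLeaves m a r))
    ≡⟨ trans (∑-++ (constrain _ (acceptingLeaves m a l)) _ proj₁) (cong₂ _+_ (∑-map _ (acceptingLeaves m a l) proj₁) (∑-map _ (acceptingLeaves m a r) proj₁)) ⟩
  mass (acceptingLeaves m a l) + mass (acceptingLeaves m a r)
    ≤⟨ +-mono-≤ (mass-acceptingLeaves m a l) (mass-acceptingLeaves m a r) ⟩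
  a * size l + a * size r
    ≡⟨ *-distribˡ-+ a (size l) (size r) ⟨
  a * (size l + size r)
    ≤⟨ *-monoʳ-≤ a (n≤1+n (size l + size r)) ⟩
  a * size (node y l r) ∎
  where open ≤-Reasoning

Forest : ℕ → Set
Forest n = List (ℕ × PDT n)

totalℕ : ∀ {n} → Forest n → ℕ
totalℕ ts = ∑ ts proj₁

accepts : ∀ {n} → Forest n → F2^ n → ℕ
accepts ts x = ∑ ts λ (a , t) → a * ⟦ eval t x ⟧

accepts≤totalℕ : ∀ {n} (ts : Forest n) x → accepts ts x ≤ totalℕ ts
accepts≤totalℕ ts x = ∑-mono ts λ (a , t) →
  ≤-trans (*-monoʳ-≤ a (⟦⟧≤1 (eval t x))) (≤-reflexive (*-identityʳ a))

forestLeaves : ∀ {n} m → Forest (n + m) → Combination n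
forestLeaves m []             = []
forestLeaves m ((a , t) ∷ ts) = acceptingLeaves m a t ++ forestLeaves m ts

combine-forestLeaves : ∀ {n} m (ts : Forest (n + m)) x → combine (forestLeaves m ts) x ≡ accepts ts (x ⧺ ones m)
combine-forestLeaves m []             x = refl
combine-forestLeaves m ((a , t) ∷ ts) x = trans (∑-++ (acceptingLeaves m a t) _ _)
  (cong₂ _+_ (combine-acceptingLeaves m a t x) (combine-forestLeaves m ts x))

mass-forestLeaves : ∀ {n} m (ts : Forest (n + m)) → mass (forestLeaves {n} m ts) ≤ ∑ ts λ (a , t) → a * size t
mass-forestLeaves     m []             = z≤n
mass-forestLeaves {n} m ((a , t) ∷ ts) = ≤-trans (≤-reflexive (∑-++ (acceptingLeaves {n} m a t) _ proj₁))
  (+-mono-≤ (mass-acceptingLeaves {n} m a t) (mass-forestLeaves {n} m ts))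

-- The last m coordinates are fixed to 1, and the trees are run p times, accepting when all runs do.
module SizeBound {n m : ℕ} (ts : Forest (n + m)) (S p κ y Z z g E h q : ℕ)
  (sizes : ∑ ts (λ (a , t) → a * size t) ≤ S * totalℕ ts) (1≤total : 1 ≤ totalℕ ts)
  (yes-bound : ∀ x → weight x ≡ κ + m → y * totalℕ ts ^ p ≤ Z * accepts ts x ^ p)
  (no-bound : ∀ x → weight x ≢ κ + m → Z * accepts ts x ^ p ≤ z * totalℕ ts ^ p)
  (1≤κ : 1 ≤ κ) (1≤Z : 1 ≤ Z) (2κ²≤n : 2 * (κ * κ) ≤ n) (9Zκ²≤gn : Z * (9 * (κ * κ)) ≤ g * n)
  (8E≤y : 8 * E * (z + g) ≤ y) (96≤E : 96 ≤ E) (2≤h : 2 ≤ h) (8q≤κ : 8 * q ≤ κ)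
  (16h²<κE : 16 * (h * h) < κ * E) where

  Ω : ℕ
  Ω = totalℕ ts ^ p

  1≤Ω : 1 ≤ Ω
  1≤Ω = >-nonZero⁻¹ Ω {{m^n≢0 (totalℕ ts) p {{>-nonZero 1≤total}}}}

  1≤n : 1 ≤ n
  1≤n = ≤-trans (*-mono-≤ (s≤s (z≤n {1})) (*-mono-≤ 1≤κ 1≤κ)) 2κ²≤n

  instance
    n≢0 : NonZero n
    n≢0 = >-nonZero 1≤n
    2Z≢0 : NonZero (2 * Z)
    2Z≢0 = >-nonZero (*-mono-≤ (s≤s (z≤n {1})) 1≤Z)

  L : Combination n
  L = power (forestLeaves m ts) p

  F : F2^ n → ℕ
  F = combine L

  F-accepts : ∀ x → F x ≡ accepts ts (x ⧺ ones m) ^ p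
  F-accepts x = trans (combine-power (forestLeaves m ts) p x) (cong (_^ p) (combine-forestLeaves m ts x))

  weight-extend : ∀ (x : F2^ n) → weight (x ⧺ ones m) ≡ weight x + m
  weight-extend x = trans (weight-⧺ x (ones m)) (cong (_+_ (weight x)) (weight-ones m))

  F-yes : ∀ x → weight x ≡ κ → y * Ω ≤ Z * F x
  F-yes x e = ≤-trans (yes-bound (x ⧺ ones m) (trans (weight-extend x) (cong (_+ m) e)))
    (≤-reflexive (cong (Z *_) (sym (F-accepts x))))

  F-no : ∀ x → weight x ≢ κ → Z * F x ≤ z * Ω
  F-no x ne = ≤-trans (≤-reflexive (cong (Z *_) (F-accepts x)))
    (no-bound (x ⧺ ones m) λ e → ne (+-cancelʳ-≡ m (weight x) κ (trans (sym (weight-extend x)) e)))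

  F≤Ω : ∀ x → F x ≤ Ω
  F≤Ω x = ≤-trans (≤-reflexive (F-accepts x)) (^-monoˡ-≤ p (accepts≤totalℕ ts (x ⧺ ones m)))

  zeros : F2^ n
  zeros = replicate n false

  acc miss : ℕ → ℕ
  acc j  = sweep j zeros F
  miss j = sweep j zeros (misses j)

  miss-bound : ∀ j → n * miss j ≤ j * j * n ^ j
  miss-bound j = subst (λ w → n * sweep j zeros (misses (w + j)) ≤ j * (w + j) * n ^ j) (weight-zeros n) (collisions j zeros)

  -- As 2 κ² ≤ n, at least half of all κ-tuples are free of collisions, and each of these is
  -- accepted with weight at least y/Z.
  acc-lower : y * Ω * n ^ κ ≤ 2 * Z * acc κ
  acc-lower = +-cancelʳ-≤ (y * Ω * n ^ κ) _ _ (begin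
    y * Ω * n ^ κ + y * Ω * n ^ κ
      ≡⟨ lemma₁ (y * Ω) (n ^ κ) ⟩
    2 * (n ^ κ * (y * Ω))
      ≡⟨ cong (2 *_) (sweep-const κ zeros (y * Ω)) ⟨
    2 * sweep κ zeros (λ _ → y * Ω)
      ≤⟨ *-monoʳ-≤ 2 (sweep-mono κ zeros pointwise) ⟩
    2 * sweep κ zeros (λ x → Z * F x + y * Ω * misses κ x)
      ≡⟨ cong (2 *_) (trans (sweep-+ κ zeros _ _) (cong₂ _+_ (sweep-* κ zeros Z F) (sweep-* κ zeros (y * Ω) (misses κ)))) ⟩
    2 * (Z * acc κ + y * Ω * miss κ)
      ≡⟨ lemma₂ Z (acc κ) (y * Ω) (miss κ) ⟩
    2 * Z * acc κ + y * Ω * (2 * miss κ)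
      ≤⟨ +-monoʳ-≤ (2 * Z * acc κ) (*-monoʳ-≤ (y * Ω) few) ⟩
    2 * Z * acc κ + y * Ω * n ^ κ ∎)
    where
    open ≤-Reasoning
    lemma₁ : ∀ a b → a * b + a * b ≡ 2 * (b * a)
    lemma₁ = solve-∀
    lemma₂ : ∀ a b c d → 2 * (a * b + c * d) ≡ 2 * a * b + c * (2 * d)
    lemma₂ = solve-∀
    lemma₃ : ∀ a b → a * (2 * b) ≡ 2 * (a * b)
    lemma₃ = solve-∀
    pointwise : ∀ x → y * Ω ≤ Z * F x + y * Ω * misses κ x
    pointwise x with weight x ≟ κ
    ... | yes e  = m≤n⇒m≤n+o _ (F-yes x e)
    ... | no  ne = m≤n⇒m≤o+n (Z * F x) (≤-reflexive (sym (*-identityʳ (y * Ω))))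
    few : 2 * miss κ ≤ n ^ κ
    few = *-cancelˡ-≤ n (begin
      n * (2 * miss κ)         ≡⟨ lemma₃ n (miss κ) ⟩
      2 * (n * miss κ)         ≤⟨ *-monoʳ-≤ 2 (miss-bound κ) ⟩
      2 * (κ * κ * n ^ κ)      ≡⟨ *-assoc 2 (κ * κ) (n ^ κ) ⟨
      2 * (κ * κ) * n ^ κ      ≤⟨ *-monoˡ-≤ (n ^ κ) 2κ²≤n ⟩
      n * n ^ κ                ∎)

  -- Collision-free tuples have the rejected weight κ + 2. A collision may produce weight κ, so
  -- those tuples count as fully accepted; they are at most a g/Z fraction, since (κ + 2)² ≤ 9 κ².
  acc-up : Z * acc (2 + κ) ≤ (z + g) * Ω * n ^ (2 + κ)
  acc-up = begin
    Z * acc (2 + κ)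
      ≡⟨ sweep-* (2 + κ) zeros Z F ⟨
    sweep (2 + κ) zeros (λ x → Z * F x)
      ≤⟨ sweep-mono (2 + κ) zeros pointwise ⟩
    sweep (2 + κ) zeros (λ x → z * Ω + Z * Ω * misses (2 + κ) x)
      ≡⟨ trans (sweep-+ (2 + κ) zeros _ _) (cong₂ _+_ (sweep-const (2 + κ) zeros (z * Ω)) (sweep-* (2 + κ) zeros (Z * Ω) (misses (2 + κ)))) ⟩
    n ^ (2 + κ) * (z * Ω) + Z * Ω * miss (2 + κ)
      ≡⟨ lemma₁ (n ^ (2 + κ)) z Ω Z (miss (2 + κ)) ⟩
    z * Ω * n ^ (2 + κ) + Ω * (Z * miss (2 + κ))
      ≤⟨ +-monoʳ-≤ (z * Ω * n ^ (2 + κ)) (*-monoʳ-≤ Ω few) ⟩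
    z * Ω * n ^ (2 + κ) + Ω * (g * n ^ (2 + κ))
      ≡⟨ lemma₂ z Ω (n ^ (2 + κ)) g ⟩
    (z + g) * Ω * n ^ (2 + κ) ∎
    where
    open ≤-Reasoning
    lemma₁ : ∀ a z Ω Z b → a * (z * Ω) + Z * Ω * b ≡ z * Ω * a + Ω * (Z * b)
    lemma₁ = solve-∀
    lemma₂ : ∀ z Ω a g → z * Ω * a + Ω * (g * a) ≡ (z + g) * Ω * a
    lemma₂ = solve-∀
    lemma₃ : ∀ a b c → a * (b * c) ≡ b * (a * c)
    lemma₃ = solve-∀
    lemma₄ : ∀ Z a b c → Z * (a * b * c) ≡ Z * (a * b) * c
    lemma₄ = solve-∀
    lemma₅ : ∀ g n a → g * n * a ≡ n * (g * a)
    lemma₅ = solve-∀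
    lemma₆ : ∀ κ → (3 * κ) * (3 * κ) ≡ 9 * (κ * κ)
    lemma₆ = solve-∀
    2+κ≤3κ : 2 + κ ≤ 3 * κ
    2+κ≤3κ = ≤-trans (≤-reflexive (+-comm 2 κ)) (+-monoʳ-≤ κ (*-monoʳ-≤ 2 1≤κ))
    pointwise : ∀ x → Z * F x ≤ z * Ω + Z * Ω * misses (2 + κ) x
    pointwise x with weight x ≟ 2 + κ
    ... | yes e = m≤n⇒m≤n+o _ (F-no x λ e′ → m≢1+n+m κ {1} (trans (sym e′) e))
    ... | no  _ = m≤n⇒m≤o+n (z * Ω) (≤-trans (*-monoʳ-≤ Z (F≤Ω x)) (≤-reflexive (sym (*-identityʳ (Z * Ω)))))
    few : Z * miss (2 + κ) ≤ g * n ^ (2 + κ)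
    few = *-cancelˡ-≤ n (begin
      n * (Z * miss (2 + κ))                 ≡⟨ lemma₃ n Z (miss (2 + κ)) ⟩
      Z * (n * miss (2 + κ))                 ≤⟨ *-monoʳ-≤ Z (miss-bound (2 + κ)) ⟩
      Z * ((2 + κ) * (2 + κ) * n ^ (2 + κ))  ≡⟨ lemma₄ Z (2 + κ) (2 + κ) (n ^ (2 + κ)) ⟩
      Z * ((2 + κ) * (2 + κ)) * n ^ (2 + κ)  ≤⟨ *-monoˡ-≤ (n ^ (2 + κ)) (*-monoʳ-≤ Z (≤-trans (*-mono-≤ 2+κ≤3κ 2+κ≤3κ) (≤-reflexive (lemma₆ κ)))) ⟩
      Z * (9 * (κ * κ)) * n ^ (2 + κ)        ≤⟨ *-monoˡ-≤ (n ^ (2 + κ)) 9Zκ²≤gn ⟩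
      g * n * n ^ (2 + κ)                    ≡⟨ lemma₅ g n (n ^ (2 + κ)) ⟩
      n * (g * n ^ (2 + κ))                  ∎)

  -- Collisions are harmless here: fewer than κ flips never reach weight κ, so every tuple is
  -- rejected.
  acc-down : ∀ j → j ≤ κ → Z * (n * n * twoBefore acc j) ≤ z * Ω * n ^ j
  acc-down zero          _   = ≤-trans (≤-reflexive (trans (cong (Z *_) (*-zeroʳ (n * n))) (*-zeroʳ Z))) z≤n
  acc-down (suc zero)    _   = ≤-trans (≤-reflexive (trans (cong (Z *_) (*-zeroʳ (n * n))) (*-zeroʳ Z))) z≤n
  acc-down (suc (suc j)) j≤κ = begin
    Z * (n * n * acc j)
      ≡⟨ lemma₁ Z (n * n) (acc j) ⟩
    n * n * (Z * acc j)
      ≡⟨ cong (n * n *_) (sweep-* j zeros Z F) ⟨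
    n * n * sweep j zeros (λ x → Z * F x)
      ≤⟨ *-monoʳ-≤ (n * n) (sweep-≤ j zeros λ x x≤ → F-no x λ e →
           <-irrefl e (≤-trans (s≤s (subst (λ w → weight x ≤ w + j) (weight-zeros n) x≤)) (≤-trans (n≤1+n (suc j)) j≤κ))) ⟩
    n * n * (n ^ j * (z * Ω))
      ≡⟨ lemma₂ n (n ^ j) (z * Ω) ⟩
    z * Ω * n ^ (2 + j) ∎
    where
    open ≤-Reasoning
    lemma₁ : ∀ a b c → a * (b * c) ≡ b * (a * c)
    lemma₁ = solve-∀
    lemma₂ : ∀ n a b → n * n * (a * b) ≡ b * (n * (n * a))
    lemma₂ = solve-∀

  mass-bound : mass L ≤ S ^ p * Ω
  mass-bound = begin
    mass L                           ≡⟨ mass-power (forestLeaves m ts) p ⟩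
    mass (forestLeaves m ts) ^ p     ≤⟨ ^-monoˡ-≤ p (≤-trans (mass-forestLeaves m ts) sizes) ⟩
    (S * totalℕ ts) ^ p              ≡⟨ ^-distribʳ-* p S (totalℕ ts) ⟩
    S ^ p * Ω                        ∎
    where open ≤-Reasoning

  size-bound : h ^ suc q * y ≤ 32 * Z * 2 ^ κ * S ^ p
  size-bound = *-cancelʳ-≤ _ _ (Ω * n ^ κ) {{>-nonZero (*-mono-≤ 1≤Ω (>-nonZero⁻¹ (n ^ κ) {{m^n≢0 n κ}}))}} (begin
    h ^ suc q * y * (Ω * n ^ κ)
      ≡⟨ lemma₁ (h ^ suc q) y Ω (n ^ κ) ⟩
    h ^ suc q * (y * Ω * n ^ κ)
      ≤⟨ *-monoʳ-≤ (h ^ suc q) acc-lower ⟩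
    h ^ suc q * (2 * Z * acc κ)
      ≡⟨ lemma₂ (h ^ suc q) (2 * Z) (acc κ) ⟩
    2 * Z * (h ^ suc q * acc κ)
      ≤⟨ *-monoʳ-≤ (2 * Z) (Corruption.corruption zeros κ E h q 1≤n 1≤κ 96≤E 2≤h 8q≤κ 16h²<κE L up down) ⟩
    2 * Z * (16 * (2 * n) ^ κ * mass L)
      ≤⟨ *-monoʳ-≤ (2 * Z) (*-monoʳ-≤ (16 * (2 * n) ^ κ) mass-bound) ⟩
    2 * Z * (16 * (2 * n) ^ κ * (S ^ p * Ω))
      ≡⟨ cong (λ w → 2 * Z * (16 * w * (S ^ p * Ω))) (^-distribʳ-* κ 2 n) ⟩
    2 * Z * (16 * (2 ^ κ * n ^ κ) * (S ^ p * Ω))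
      ≡⟨ lemma₃ Z (2 ^ κ) (n ^ κ) (S ^ p) Ω ⟩
    32 * Z * 2 ^ κ * S ^ p * (Ω * n ^ κ) ∎)
    where
    open ≤-Reasoning
    lemma₁ : ∀ a b c d → a * b * (c * d) ≡ a * (b * c * d)
    lemma₁ = solve-∀
    lemma₂ : ∀ a b c → a * (b * c) ≡ b * (a * c)
    lemma₂ = solve-∀
    lemma₃ : ∀ Z a b c d → 2 * Z * (16 * (a * b) * (c * d)) ≡ 32 * Z * a * c * (d * b)
    lemma₃ = solve-∀
    lemma₄ : ∀ Z E a → 2 * Z * (4 * E * a) ≡ 8 * E * (Z * a)
    lemma₄ = solve-∀
    lemma₅ : ∀ E a Ω b → 8 * E * (a * Ω * b) ≡ 8 * E * a * (Ω * b)
    lemma₅ = solve-∀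
    lemma₆ : ∀ y Ω n a → y * (Ω * (n * (n * a))) ≡ n * n * (y * Ω * a)
    lemma₆ = solve-∀
    up : 4 * E * acc (2 + κ) ≤ n * n * acc κ
    up = *-cancelˡ-≤ (2 * Z) (begin
      2 * Z * (4 * E * acc (2 + κ))             ≡⟨ lemma₄ Z E (acc (2 + κ)) ⟩
      8 * E * (Z * acc (2 + κ))                 ≤⟨ *-monoʳ-≤ (8 * E) acc-up ⟩
      8 * E * ((z + g) * Ω * n ^ (2 + κ))       ≡⟨ lemma₅ E (z + g) Ω (n ^ (2 + κ)) ⟩
      8 * E * (z + g) * (Ω * n ^ (2 + κ))       ≤⟨ *-monoˡ-≤ (Ω * n ^ (2 + κ)) 8E≤y ⟩
      y * (Ω * n ^ (2 + κ))                     ≡⟨ lemma₆ y Ω n (n ^ κ) ⟩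
      n * n * (y * Ω * n ^ κ)                   ≤⟨ *-monoʳ-≤ (n * n) acc-lower ⟩
      n * n * (2 * Z * acc κ)                   ≡⟨ lemma₂ (n * n) (2 * Z) (acc κ) ⟩
      2 * Z * (n * n * acc κ)                   ∎)
    down : 4 * E * (n * n * twoBefore acc κ) ≤ acc κ
    down = *-cancelˡ-≤ (2 * Z) (begin
      2 * Z * (4 * E * (n * n * twoBefore acc κ))  ≡⟨ lemma₄ Z E (n * n * twoBefore acc κ) ⟩
      8 * E * (Z * (n * n * twoBefore acc κ))      ≤⟨ *-monoʳ-≤ (8 * E) (acc-down κ ≤-refl) ⟩
      8 * E * (z * Ω * n ^ κ)                      ≡⟨ lemma₅ E z Ω (n ^ κ) ⟩
      8 * E * z * (Ω * n ^ κ)                      ≤⟨ *-monoˡ-≤ (Ω * n ^ κ) (≤-trans (*-monoʳ-≤ (8 * E) (m≤m+n z g)) 8E≤y) ⟩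
      y * (Ω * n ^ κ)                              ≡⟨ *-assoc y Ω (n ^ κ) ⟨
      y * Ω * n ^ κ                                ≤⟨ acc-lower ⟩
      2 * Z * acc κ                                ∎)

-- Choice of parameters

-- The randomized tree with δ = a / d and its probabilities scaled to natural numbers. `sizes`
-- bounds only the weighted average size.
record Decides {n} (ts : Forest n) (S k a d : ℕ) : Set where
  field
    1≤a      : 1 ≤ a
    3a≤d     : 3 * a ≤ d
    1≤k      : 1 ≤ k
    k²d<an   : k * k * d < a * n
    sizes    : ∑ ts (λ (b , t) → b * size t) ≤ S * totalℕ ts
    1≤total  : 1 ≤ totalℕ ts
    complete : ∀ x → weight x ≡ k → d * totalℕ ts ≤ d * accepts ts x + a * totalℕ ts
    sound    : ∀ x → weight x ≢ k → d * accepts ts x ≤ a * totalℕ ts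

  1≤d : 1 ≤ d
  1≤d = ≤-trans (*-mono-≤ (s≤s (z≤n {2})) 1≤a) 3a≤d

  instance
    a≢0 : NonZero a
    a≢0 = >-nonZero 1≤a
    d≢0 : NonZero d
    d≢0 = >-nonZero 1≤d
    k≢0 : NonZero k
    k≢0 = >-nonZero 1≤k

  complete′ : ∀ x → weight x ≡ k → 2 * totalℕ ts ≤ 3 * accepts ts x
  complete′ x e = *-cancelˡ-≤ d (+-cancelʳ-≤ (d * totalℕ ts) _ _ (begin
    d * (2 * totalℕ ts) + d * totalℕ ts              ≡⟨ lemma₁ d (totalℕ ts) ⟩
    3 * (d * totalℕ ts)                              ≤⟨ *-monoʳ-≤ 3 (complete x e) ⟩
    3 * (d * accepts ts x + a * totalℕ ts)           ≡⟨ lemma₂ d (accepts ts x) a (totalℕ ts) ⟩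
    d * (3 * accepts ts x) + 3 * a * totalℕ ts       ≤⟨ +-monoʳ-≤ (d * (3 * accepts ts x)) (*-monoˡ-≤ (totalℕ ts) 3a≤d) ⟩
    d * (3 * accepts ts x) + d * totalℕ ts           ∎))
    where
    open ≤-Reasoning
    lemma₁ : ∀ d b → d * (2 * b) + d * b ≡ 3 * (d * b)
    lemma₁ = solve-∀
    lemma₂ : ∀ d b a c → 3 * (d * b + a * c) ≡ d * (3 * b) + 3 * a * c
    lemma₂ = solve-∀

  sound′ : ∀ x → weight x ≢ k → 3 * accepts ts x ≤ totalℕ ts
  sound′ x ne = *-cancelˡ-≤ d (begin
    d * (3 * accepts ts x)   ≡⟨ lemma d (accepts ts x) ⟩
    3 * (d * accepts ts x)   ≤⟨ *-monoʳ-≤ 3 (sound x ne) ⟩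
    3 * (a * totalℕ ts)      ≡⟨ *-assoc 3 a (totalℕ ts) ⟨
    3 * a * totalℕ ts        ≤⟨ *-monoˡ-≤ (totalℕ ts) 3a≤d ⟩
    d * totalℕ ts            ∎)
    where
    open ≤-Reasoning
    lemma : ∀ a b → a * (3 * b) ≡ 3 * (a * b)
    lemma = solve-∀

  3k²<n : 3 * (k * k) < n
  3k²<n = *-cancelˡ-< a _ _ (begin-strict
    a * (3 * (k * k))  ≡⟨ lemma a (k * k) ⟩
    k * k * (3 * a)    ≤⟨ *-monoʳ-≤ (k * k) 3a≤d ⟩
    k * k * d          <⟨ k²d<an ⟩
    a * n              ∎)
    where
    open ≤-Reasoning
    lemma : ∀ a b → a * (3 * b) ≡ b * (3 * a)
    lemma = solve-∀

  k≤n : k ≤ n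
  k≤n = ≤-trans (m≤m*n k k) (≤-trans (m≤m+n (k * k) _) (<⇒≤ 3k²<n))

weight-witness : ∀ {n k} → k ≤ n → ∃ λ (x : F2^ n) → weight x ≡ k
weight-witness {n}     {zero}  _         = replicate n false , weight-zeros n
weight-witness {suc n} {suc k} (s≤s k≤n) with weight-witness k≤n
... | x , e = true ∷ x , cong suc e

-- A tree of size 1 is constant, so for S ≤ 1 the acceptance weight would not depend on the input.
nontrivial : ∀ {n} {ts : Forest n} {S k a d} → Decides ts S k a d → 2 ≤ S
nontrivial {n} {ts} {S} D with 2 ≤? S
... | yes 2≤S = 2≤S
... | no  2≰S = contradiction (begin-strict
  totalℕ ts               <⟨ m<m+n (totalℕ ts) (≤-trans 1≤total (≤-reflexive (sym (+-identityʳ _)))) ⟩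
  2 * totalℕ ts           ≤⟨ complete′ x₁ (proj₂ (weight-witness k≤n)) ⟩
  3 * accepts ts x₁       ≤⟨ *-monoʳ-≤ 3 same ⟩
  3 * accepts ts x₀       ≤⟨ sound′ x₀ (λ e → <-irrefl (trans (sym (weight-zeros n)) e) 1≤k) ⟩
  totalℕ ts               ∎) (<-irrefl refl)
  where
  open Decides D
  open ≤-Reasoning
  x₀ x₁ : F2^ n
  x₀ = replicate n false
  x₁ = proj₁ (weight-witness k≤n)
  one : ∀ b (t : PDT n) → b * ⟦ eval t x₁ ⟧ + b ≤ b * ⟦ eval t x₀ ⟧ + b * size t
  one b (leaf c)       = +-monoʳ-≤ (b * ⟦ c ⟧) (≤-reflexive (sym (*-identityʳ b)))
  one b t@(node y l r) = m≤n⇒m≤o+n (b * ⟦ eval t x₀ ⟧) (begin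
    b * ⟦ eval t x₁ ⟧ + b  ≤⟨ +-monoˡ-≤ b (*-monoʳ-≤ b (⟦⟧≤1 (eval t x₁))) ⟩
    b * 1 + b              ≡⟨ lemma b ⟩
    b * 2                  ≤⟨ *-monoʳ-≤ b (s≤s (≤-trans (1≤size l) (m≤m+n (size l) (size r)))) ⟩
    b * size t             ∎)
    where
    lemma : ∀ b → b * 1 + b ≡ b * 2
    lemma = solve-∀
    1≤size : ∀ {n} (t : PDT n) → 1 ≤ size t
    1≤size (leaf _)     = s≤s z≤n
    1≤size (node _ _ _) = s≤s z≤n
  same : accepts ts x₁ ≤ accepts ts x₀
  same = +-cancelʳ-≤ (totalℕ ts) _ _ (begin
    accepts ts x₁ + totalℕ ts
      ≡⟨ ∑-+ ts _ proj₁ ⟨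
    (∑ ts λ (b , t) → b * ⟦ eval t x₁ ⟧ + b)
      ≤⟨ ∑-mono ts (λ (b , t) → one b t) ⟩
    (∑ ts λ (b , t) → b * ⟦ eval t x₀ ⟧ + b * size t)
      ≡⟨ ∑-+ ts _ _ ⟩
    accepts ts x₀ + (∑ ts λ (b , t) → b * size t)
      ≤⟨ +-monoʳ-≤ (accepts ts x₀) (≤-trans sizes (*-monoˡ-≤ (totalℕ ts) (≤-pred (≰⇒> 2≰S)))) ⟩
    accepts ts x₀ + 1 * totalℕ ts
      ≡⟨ cong (_+_ (accepts ts x₀)) (*-identityˡ (totalℕ ts)) ⟩
    accepts ts x₀ + totalℕ ts ∎)

sqrt-sixteenth : ∀ X → ∃ λ h → 16 * (h * h) < suc X × suc X ≤ 16 * (suc h * suc h)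
sqrt-sixteenth zero    = 0 , s≤s z≤n , s≤s z≤n
sqrt-sixteenth (suc X) with sqrt-sixteenth X
... | h , lo , hi with 2 + X ≤? 16 * (suc h * suc h)
...   | yes le = h , m≤n⇒m≤1+n lo , le
...   | no  gt = suc h , ≰⇒> gt , (begin
  2 + X                            ≤⟨ s≤s hi ⟩
  suc (16 * (suc h * suc h))       ≤⟨ m≤m+n _ (47 + 32 * h) ⟩
  suc (16 * (suc h * suc h)) + (47 + 32 * h)  ≡⟨ lemma h ⟩
  16 * ((2 + h) * (2 + h))         ∎)
  where
  open ≤-Reasoning
  lemma : ∀ h → suc (16 * (suc h * suc h)) + (47 + 32 * h) ≡ 16 * ((2 + h) * (2 + h))
  lemma = solve-∀

-- The largest h with 16 h² < X; from 96 ≤ X it is at least 2, and h + 1 ≤ 2 h turns the upper bound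
-- 16 (h + 1)² into 64 h².
scale : ∀ X → 96 ≤ X → ∃ λ h → 2 ≤ h × 16 * (h * h) < X × X ≤ 64 * (h * h)
scale (suc X) 96≤X with sqrt-sixteenth X
... | zero        , lo , hi = contradiction (≤-trans 96≤X hi) (λ le → from-no (96 ≤? 16) le)
... | suc zero    , lo , hi = contradiction (≤-trans 96≤X hi) (λ le → from-no (96 ≤? 64) le)
... | h@(suc (suc h′)) , lo , hi = h , s≤s (s≤s z≤n) , lo , ≤-trans hi (begin
  16 * (suc h * suc h)             ≤⟨ *-monoʳ-≤ 16 (*-mono-≤ suc≤2* suc≤2*) ⟩
  16 * ((2 * h) * (2 * h))         ≡⟨ lemma h ⟩
  64 * (h * h)                     ∎)
  where
  open ≤-Reasoning
  suc≤2* : suc h ≤ 2 * h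
  suc≤2* = ≤-trans (+-monoˡ-≤ h (s≤s (z≤n {suc h′}))) (≤-reflexive (cong (_+_ h) (sym (+-identityʳ h))))
  lemma : ∀ h → 16 * ((2 * h) * (2 * h)) ≡ 64 * (h * h)
  lemma = solve-∀

-- The eighth power undoes q being about κ/8; the constant c and the 2^κ are merged into (2 c)^κ.
amplify : ∀ κ q c h y Z S p → 1 ≤ κ → κ ≤ 8 * suc q → 1 ≤ h → 1 ≤ y → 32 * Z ≤ c * y → 1 ≤ c →
  h ^ suc q * y ≤ 32 * Z * 2 ^ κ * S ^ p → h ^ κ ≤ ((2 * c) ^ 8) ^ κ * S ^ (8 * p)
amplify κ q c h y Z S p 1≤κ κ≤ 1≤h 1≤y Z≤ 1≤c bound = begin
  h ^ κ
    ≤⟨ ^-monoʳ-≤ h {{>-nonZero 1≤h}} κ≤ ⟩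
  h ^ (8 * suc q)
    ≡⟨ trans (cong (h ^_) (*-comm 8 (suc q))) (sym (^-*-assoc h (suc q) 8)) ⟩
  (h ^ suc q) ^ 8
    ≤⟨ ^-monoˡ-≤ 8 (*-cancelʳ-≤ (h ^ suc q) (c * 2 ^ κ * S ^ p) y {{>-nonZero 1≤y}} (≤-trans bound (begin
         32 * Z * 2 ^ κ * S ^ p      ≤⟨ *-monoˡ-≤ (S ^ p) (*-monoˡ-≤ (2 ^ κ) Z≤) ⟩
         c * y * 2 ^ κ * S ^ p       ≡⟨ lemma c y (2 ^ κ) (S ^ p) ⟩
         c * 2 ^ κ * S ^ p * y       ∎))) ⟩
  (c * 2 ^ κ * S ^ p) ^ 8
    ≤⟨ ^-monoˡ-≤ 8 (*-monoˡ-≤ (S ^ p) (*-monoˡ-≤ (2 ^ κ) (≤-trans (≤-reflexive (sym (*-identityʳ c))) (^-monoʳ-≤ c {{>-nonZero 1≤c}} 1≤κ)))) ⟩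
  (c ^ κ * 2 ^ κ * S ^ p) ^ 8
    ≡⟨ ^-distribʳ-* 8 (c ^ κ * 2 ^ κ) (S ^ p) ⟩
  (c ^ κ * 2 ^ κ) ^ 8 * (S ^ p) ^ 8
    ≡⟨ cong₂ _*_ (trans (cong (_^ 8) (trans (sym (^-distribʳ-* κ c 2)) (cong (_^ κ) (*-comm c 2)))) (^-swap (2 * c) κ 8))
         (trans (^-*-assoc S p 8) (cong (S ^_) (*-comm p 8))) ⟩
  ((2 * c) ^ 8) ^ κ * S ^ (8 * p) ∎
  where
  open ≤-Reasoning
  lemma : ∀ c y a s → c * y * a * s ≡ c * a * s * y
  lemma = solve-∀

-- Squaring the upper bound on x and cancelling one x against the lower bound gives x K⁴ ≤ a h⁴.
-- Half of the exponent is thus spent on the constants, and K^κ drops out of the fourth power of the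
-- last hypothesis.
finish : ∀ κ x a h C K S p → 1 ≤ a → 1 ≤ C → 1 ≤ K → x ≤ C * a * (h * h) → C * C * K ^ 4 * a ≤ x →
  h ^ κ ≤ K ^ κ * S ^ p → x ^ κ ≤ S ^ (4 * p) * a ^ κ
finish κ x a h C K S p 1≤a 1≤C 1≤K x≤ ≤x bound =
  *-cancelʳ-≤ _ _ ((K ^ 4) ^ κ) {{m^n≢0 (K ^ 4) κ {{m^n≢0 K 4 {{>-nonZero 1≤K}}}}}} (begin
    x ^ κ * (K ^ 4) ^ κ                  ≡⟨ ^-distribʳ-* κ x (K ^ 4) ⟨
    (x * K ^ 4) ^ κ                      ≤⟨ ^-monoˡ-≤ κ one ⟩
    (a * h ^ 4) ^ κ                      ≡⟨ trans (^-distribʳ-* κ a (h ^ 4)) (cong (a ^ κ *_) (^-swap h 4 κ)) ⟩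
    a ^ κ * (h ^ κ) ^ 4                  ≤⟨ *-monoʳ-≤ (a ^ κ) (^-monoˡ-≤ 4 bound) ⟩
    a ^ κ * (K ^ κ * S ^ p) ^ 4          ≡⟨ cong (a ^ κ *_) (trans (^-distribʳ-* 4 (K ^ κ) (S ^ p))
                                              (cong₂ _*_ (^-swap K κ 4) (trans (^-*-assoc S p 4) (cong (S ^_) (*-comm p 4))))) ⟩
    a ^ κ * ((K ^ 4) ^ κ * S ^ (4 * p))  ≡⟨ lemma₁ (a ^ κ) ((K ^ 4) ^ κ) (S ^ (4 * p)) ⟩
    S ^ (4 * p) * a ^ κ * (K ^ 4) ^ κ    ∎)
  where
  open ≤-Reasoning
  lemma₁ : ∀ a b c → a * (b * c) ≡ c * a * b
  lemma₁ = solve-∀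
  lemma₂ : ∀ C a x k → C * C * a * (x * k) ≡ x * (C * C * k * a)
  lemma₂ = solve-∀
  lemma₃ : ∀ C a h → C * a * (h * h) * (C * a * (h * h)) ≡ C * C * a * (a * (h * (h * (h * (h * 1)))))
  lemma₃ = solve-∀
  one : x * K ^ 4 ≤ a * h ^ 4
  one = *-cancelˡ-≤ (C * C * a) {{>-nonZero (*-mono-≤ (*-mono-≤ 1≤C 1≤C) 1≤a)}} (begin
    C * C * a * (x * K ^ 4)                ≡⟨ lemma₂ C a x (K ^ 4) ⟩
    x * (C * C * K ^ 4 * a)                ≤⟨ *-monoʳ-≤ x ≤x ⟩
    x * x                                  ≤⟨ *-mono-≤ x≤ x≤ ⟩
    C * a * (h * h) * (C * a * (h * h))    ≡⟨ lemma₃ C a h ⟩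
    C * C * a * (a * h ^ 4)                ∎)

quotient : ∀ d b → 1 ≤ b → ∃ λ e → e * b ≤ d × d < suc e * b
quotient d b@(suc _) _ = d div b , m/n*n≤m d b ,
  (begin-strict
    d                    ≡⟨ m≡m%n+[m/n]*n d b ⟩
    d % b + d div b * b    <⟨ +-monoˡ-< (d div b * b) (m%n<n d b) ⟩
    b + d div b * b        ∎)
  where open ≤-Reasoning

eighth : ∀ κ → ∃ λ q → 8 * q ≤ κ × κ ≤ 8 * suc q
eighth κ with quotient κ 8 (s≤s z≤n)
... | q , lo , hi = q , ≤-trans (≤-reflexive (*-comm 8 q)) lo , ≤-trans (<⇒≤ hi) (≤-reflexive (*-comm (suc q) 8))

-- δ = a / d below 1 / 11520, where one run of the trees suffices.
small-error : ∀ {n} {ts : Forest n} {S k a d} c C → 48 ≤ c → 240 * 64 ≤ C → Decides ts S k a d → 96 * (120 * a) ≤ d →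
  C * C * ((2 * c) ^ 8) ^ 4 * a ≤ k * d → (k * d) ^ k ≤ S ^ (4 * (8 * 1)) * a ^ k
small-error {n} {ts} {S} {k} {a} {d} c C 48≤c 240*64≤C D tiny large
  -- With acceptance levels 2 d and 3 a over 3 d and collision share 27 a, the condition 8 E (3 a +
  -- 27 a) ≤ 2 d reads 120 a E ≤ d. So E is the integer part of d / (120 a).
  with quotient d (120 * a) (*-mono-≤ (s≤s (z≤n {119})) (Decides.1≤a D)) | eighth k
... | E , lo , hi | q , 8q≤k , k≤ = go (scale (k * E) (*-mono-≤ 1≤k 96≤E))
  where
  open Decides D
  open ≤-Reasoning
  96≤E : 96 ≤ E
  96≤E = ≤-pred (*-cancelʳ-< (120 * a) 96 (suc E) (begin-strict
    96 * (120 * a)   ≤⟨ tiny ⟩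
    d                <⟨ hi ⟩
    suc E * (120 * a) ∎))
  lemma₁ : ∀ E a → 8 * E * (3 * a + 27 * a) ≡ 2 * (E * (120 * a))
  lemma₁ = solve-∀
  lemma₂ : ∀ d k → 3 * d * (9 * k) ≡ 27 * (k * d)
  lemma₂ = solve-∀
  lemma₃ : ∀ d t → 2 * d * (t * 1) ≡ d * (2 * t)
  lemma₃ = solve-∀
  lemma₄ : ∀ d t → d * (3 * t) ≡ 3 * d * (t * 1)
  lemma₄ = solve-∀
  lemma₅ : ∀ d t → 3 * d * (t * 1) ≡ 3 * (d * t)
  lemma₅ = solve-∀
  lemma₆ : ∀ a t → 3 * (a * t) ≡ 3 * a * (t * 1)
  lemma₆ = solve-∀
  lemma₇ : ∀ d → 32 * (3 * d) ≡ 48 * (2 * d)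
  lemma₇ = solve-∀
  lemma₈ : ∀ k E a → k * (2 * E * (120 * a)) ≡ 240 * a * (k * E)
  lemma₈ = solve-∀
  lemma₉ : ∀ x y a h → x * a * (y * h) ≡ x * y * a * h
  lemma₉ = solve-∀
  at-k : ∀ {w} → w ≡ k + 0 → w ≡ k
  at-k e = trans e (+-identityʳ k)
  go : (∃ λ h → 2 ≤ h × 16 * (h * h) < k * E × k * E ≤ 64 * (h * h)) → (k * d) ^ k ≤ S ^ (4 * (8 * 1)) * a ^ k
  go (h , 2≤h , lo′ , hi′) = finish k (k * d) a h C ((2 * c) ^ 8) S (8 * 1) 1≤a (≤-trans (s≤s z≤n) 240*64≤C)
    (>-nonZero⁻¹ ((2 * c) ^ 8) {{m^n≢0 (2 * c) 8 {{>-nonZero (*-mono-≤ (s≤s (z≤n {1})) 1≤c)}}}})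
    (begin
      k * d                    ≤⟨ *-monoʳ-≤ k (<⇒≤ hi) ⟩
      k * (suc E * (120 * a))  ≤⟨ *-monoʳ-≤ k (*-monoˡ-≤ (120 * a) (≤-trans (+-monoˡ-≤ E (≤-trans (s≤s z≤n) 96≤E)) (≤-reflexive (cong (_+_ E) (sym (+-identityʳ E)))))) ⟩
      k * (2 * E * (120 * a))  ≡⟨ lemma₈ k E a ⟩
      240 * a * (k * E)        ≤⟨ *-monoʳ-≤ (240 * a) hi′ ⟩
      240 * a * (64 * (h * h)) ≡⟨ lemma₉ 240 64 a (h * h) ⟩
      240 * 64 * a * (h * h)      ≤⟨ *-monoˡ-≤ (h * h) (*-monoˡ-≤ a 240*64≤C) ⟩
      C * a * (h * h)          ∎)
    large
    (amplify k q c h (2 * d) (3 * d) S 1 1≤k k≤ (≤-trans (s≤s z≤n) 2≤h) (*-mono-≤ (s≤s (z≤n {1})) 1≤d)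
      (≤-trans (≤-reflexive (lemma₇ d)) (*-monoˡ-≤ (2 * d) 48≤c)) 1≤c bound)
    where
    1≤c : 1 ≤ c
    1≤c = ≤-trans (s≤s z≤n) 48≤c
    widen : ∀ {n′} → n ≡ n′ → Σ (Forest n′) λ ts′ → Decides ts′ S k a d
    widen refl = ts , D
    bound : h ^ suc q * (2 * d) ≤ 32 * (3 * d) * 2 ^ k * S ^ 1
    bound with widen (sym (+-identityʳ n))
    ... | ts′ , D′ = SizeBound.size-bound {n} {0} ts′ S 1 k (2 * d) (3 * d) (3 * a) (27 * a) E h q
      (Decides.sizes D′) (Decides.1≤total D′)
      (λ x e → ≤-trans (≤-reflexive (lemma₃ d (totalℕ ts′))) (≤-trans (*-monoʳ-≤ d (Decides.complete′ D′ x (at-k e))) (≤-reflexive (lemma₄ d (accepts ts′ x)))))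
      (λ x ne → ≤-trans (≤-reflexive (lemma₅ d (accepts ts′ x))) (≤-trans (*-monoʳ-≤ 3 (Decides.sound D′ x λ e → ne (trans e (sym (+-identityʳ k))))) (≤-reflexive (lemma₆ a (totalℕ ts′)))))
      1≤k (*-mono-≤ (s≤s (z≤n {2})) 1≤d)
      (≤-trans (*-monoˡ-≤ (k * k) (s≤s (s≤s (z≤n {1})))) (<⇒≤ 3k²<n))
      (≤-trans (≤-reflexive (lemma₂ d (k * k))) (≤-trans (*-monoʳ-≤ 27 (<⇒≤ k²d<an)) (≤-reflexive (sym (*-assoc 27 a n)))))
      (≤-trans (≤-reflexive (lemma₁ E a)) (*-monoʳ-≤ 2 lo))
      96≤E 2≤h 8q≤k lo′

-- δ = a / d above 1 / τ: fixing all but κ of the ones makes collisions rare, and p runs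
-- separate the two acceptance probabilities.
large-error-fixed : ∀ {n m κ} {ts : Forest (n + m)} {S a d} c p M C τ →
  1 ≤ c → 1 ≤ M → 1 ≤ τ → τ * (2 * M) ≤ C → 2048 ≤ 2 ^ p → 3 ^ p * 9 ≤ 2 * (M * M) → 32 * 3 ^ p ≤ c * 2 ^ p →
  Decides ts S (κ + m) a d → d ≤ τ * a → 1 ≤ κ → κ * M ≤ κ + m → κ + m ≤ κ * (2 * M) →
  C * C * ((2 * c) ^ 8) ^ 4 * a ≤ (κ + m) * d →
  ((κ + m) * d) ^ (κ + m) ≤ S ^ (4 * (8 * p) * (2 * M)) * a ^ (κ + m)
large-error-fixed {n} {m} {κ} {ts} {S} {a} {d} c p M C τ 1≤c 1≤M 1≤τ C≥ 2048≤ 3^p≤ c≥ D coarse 1≤κ lo hi large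
  -- Here E is the constant 128, so h² is only of order κ; this suffices because δ is bounded below.
  with eighth κ | scale (κ * 128) (*-mono-≤ 1≤κ (from-yes (96 ≤? 128)))
... | q , 8q≤κ , κ≤ | h , 2≤h , lo′ , hi′ = begin
  (k * d) ^ k
    ≤⟨ ^-monoˡ-≤ k kd≤ ⟩
  (C * κ * a) ^ k
    ≡⟨ ^-distribʳ-* k (C * κ) a ⟩
  (C * κ) ^ k * a ^ k
    ≤⟨ *-monoˡ-≤ (a ^ k) (^-monoʳ-≤ (C * κ) {{>-nonZero (*-mono-≤ 1≤C 1≤κ)}} hi) ⟩
  (C * κ) ^ (κ * (2 * M)) * a ^ k
    ≡⟨ cong (_* a ^ k) (sym (^-*-assoc (C * κ) κ (2 * M))) ⟩
  ((C * κ) ^ κ) ^ (2 * M) * a ^ k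
    ≤⟨ *-monoˡ-≤ (a ^ k) (^-monoˡ-≤ (2 * M) final) ⟩
  (S ^ (4 * (8 * p)) * 1 ^ κ) ^ (2 * M) * a ^ k
    ≡⟨ cong (λ x → x ^ (2 * M) * a ^ k) (trans (cong (S ^ (4 * (8 * p)) *_) (^-zeroˡ κ)) (*-identityʳ _)) ⟩
  (S ^ (4 * (8 * p))) ^ (2 * M) * a ^ k
    ≡⟨ cong (_* a ^ k) (^-*-assoc S (4 * (8 * p)) (2 * M)) ⟩
  S ^ (4 * (8 * p) * (2 * M)) * a ^ k ∎
  where
  open Decides D hiding (1≤k)
  open ≤-Reasoning
  k K : ℕ
  k = κ + m
  K = (2 * c) ^ 8
  1≤C : 1 ≤ C
  1≤C = ≤-trans (*-mono-≤ 1≤τ (*-mono-≤ (s≤s (z≤n {1})) 1≤M)) C≥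
  1≤K : 1 ≤ K
  1≤K = >-nonZero⁻¹ K {{m^n≢0 (2 * c) 8 {{>-nonZero (*-mono-≤ (s≤s (z≤n {1})) 1≤c)}}}}
  lemma₁ : ∀ κ M τ a → κ * (2 * M) * (τ * a) ≡ τ * (2 * M) * κ * a
  lemma₁ = solve-∀
  lemma₂ : ∀ k → k + 2 * k ≡ 3 * k
  lemma₂ = solve-∀
  lemma₃ : ∀ x κ → x * (9 * (κ * κ)) ≡ x * 9 * (κ * κ)
  lemma₃ = solve-∀
  lemma₄ : ∀ M κ → 2 * (M * M) * (κ * κ) ≡ 2 * (κ * M * (κ * M))
  lemma₄ = solve-∀
  kd≤ : k * d ≤ C * κ * a
  kd≤ = ≤-trans (*-mono-≤ hi coarse) (≤-trans (≤-reflexive (lemma₁ κ M τ a)) (*-monoˡ-≤ a (*-monoˡ-≤ κ C≥)))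
  2k²≤n : 2 * (k * k) ≤ n
  -- The m fixed coordinates are at most k², so 3 k² < n + m leaves 2 k² for the free ones.
  2k²≤n = +-cancelˡ-≤ (k * k) _ _ (begin
    k * k + 2 * (k * k)  ≡⟨ lemma₂ (k * k) ⟩
    3 * (k * k)          ≤⟨ <⇒≤ 3k²<n ⟩
    n + m                ≡⟨ +-comm n m ⟩
    m + n                ≤⟨ +-monoˡ-≤ n (≤-trans (m≤n+m m κ) (m≤m*n k k)) ⟩
    k * k + n            ∎)
  2κ²≤n : 2 * (κ * κ) ≤ n
  2κ²≤n = ≤-trans (*-monoʳ-≤ 2 (*-mono-≤ (m≤m+n κ m) (m≤m+n κ m))) 2k²≤n
  bound : h ^ suc q * 2 ^ p ≤ 32 * 3 ^ p * 2 ^ κ * S ^ p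
  -- Acceptance at least 2/3 against at most 1/3 becomes 2^p against 1 over the common denominator
  -- 3^p.
  bound = SizeBound.size-bound {n} {m} ts S p κ (2 ^ p) (3 ^ p) 1 1 128 h q sizes 1≤total
    (λ x e → ≤-trans (≤-reflexive (sym (^-distribʳ-* p 2 (totalℕ ts)))) (≤-trans (^-monoˡ-≤ p (complete′ x e)) (≤-reflexive (^-distribʳ-* p 3 (accepts ts x)))))
    (λ x ne → ≤-trans (≤-reflexive (sym (^-distribʳ-* p 3 (accepts ts x)))) (≤-trans (^-monoˡ-≤ p (sound′ x ne)) (≤-reflexive (sym (*-identityˡ _)))))
    1≤κ (>-nonZero⁻¹ (3 ^ p) {{m^n≢0 3 p}}) 2κ²≤n
    (begin
      3 ^ p * (9 * (κ * κ))    ≡⟨ lemma₃ (3 ^ p) κ ⟩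
      3 ^ p * 9 * (κ * κ)      ≤⟨ *-monoˡ-≤ (κ * κ) 3^p≤ ⟩
      2 * (M * M) * (κ * κ)    ≡⟨ lemma₄ M κ ⟩
      2 * (κ * M * (κ * M))    ≤⟨ *-monoʳ-≤ 2 (*-mono-≤ lo lo) ⟩
      2 * (k * k)              ≤⟨ 2k²≤n ⟩
      n                        ≡⟨ *-identityˡ n ⟨
      1 * n                    ∎)
    2048≤ (from-yes (96 ≤? 128)) 2≤h 8q≤κ lo′
  κ≤h² : κ ≤ h * h
  κ≤h² = *-cancelʳ-≤ κ (h * h) 64 (begin
    κ * 64           ≤⟨ *-monoʳ-≤ κ (from-yes (64 ≤? 128)) ⟩
    κ * 128          ≤⟨ hi′ ⟩
    64 * (h * h)     ≡⟨ *-comm 64 (h * h) ⟩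
    h * h * 64       ∎)
  final : (C * κ) ^ κ ≤ S ^ (4 * (8 * p)) * 1 ^ κ
  final = finish κ (C * κ) 1 h C K S (8 * p) (s≤s z≤n) 1≤C 1≤K
    (≤-trans (*-monoʳ-≤ C κ≤h²) (≤-reflexive (cong (_* (h * h)) (sym (*-identityʳ C)))))
    (≤-trans (≤-reflexive (*-identityʳ (C * C * K ^ 4))) (*-cancelʳ-≤ _ _ a (≤-trans large kd≤)))
    (amplify κ q c h (2 ^ p) (3 ^ p) S p 1≤κ κ≤ (≤-trans (s≤s z≤n) 2≤h) (≤-trans (s≤s z≤n) 2048≤) c≥ 1≤c bound)

-- The integer part κ of k / M counts the free ones. It is positive because the last hypothesis with
-- d ≤ τ a forces M ≤ k, and then k ≤ 2 M κ, so the exponent shrinks only by a constant factor.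
large-error : ∀ {n} {ts : Forest n} {S k a d} c p M C τ →
  1 ≤ c → 1 ≤ M → 1 ≤ τ → τ * (2 * M) ≤ C → 2048 ≤ 2 ^ p → 3 ^ p * 9 ≤ 2 * (M * M) → 32 * 3 ^ p ≤ c * 2 ^ p →
  Decides ts S k a d → d ≤ τ * a →
  C * C * ((2 * c) ^ 8) ^ 4 * a ≤ k * d →
  (k * d) ^ k ≤ S ^ (4 * (8 * p) * (2 * M)) * a ^ k
large-error {n} {ts} {S} {k} {a} {d} c p M C τ 1≤c 1≤M 1≤τ C≥ 2048≤ 3^p≤ c≥ D coarse large =
  reduce (quotient k M 1≤M)
  where
  open ≤-Reasoning
  lemma : ∀ M τ a → M * (τ * a) ≡ τ * M * a
  lemma = solve-∀
  instance
    C≢0 : NonZero C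
    C≢0 = >-nonZero (≤-trans (*-mono-≤ 1≤τ (*-mono-≤ (s≤s (z≤n {1})) 1≤M)) C≥)
  M≤k : M ≤ k
  M≤k = *-cancelʳ-≤ M k (τ * a) {{>-nonZero (*-mono-≤ 1≤τ (Decides.1≤a D))}} (begin
    M * (τ * a)
      ≡⟨ lemma M τ a ⟩
    τ * M * a
      ≤⟨ *-monoˡ-≤ a (≤-trans (*-monoʳ-≤ τ (m≤m+n M _)) C≥) ⟩
    C * a
      ≤⟨ *-monoˡ-≤ a (≤-trans (m≤m*n C C)
           (m≤m*n (C * C) (((2 * c) ^ 8) ^ 4) {{m^n≢0 ((2 * c) ^ 8) 4 {{m^n≢0 (2 * c) 8 {{>-nonZero (*-mono-≤ (s≤s (z≤n {1})) 1≤c)}}}}}})) ⟩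
    C * C * ((2 * c) ^ 8) ^ 4 * a
      ≤⟨ large ⟩
    k * d
      ≤⟨ *-monoʳ-≤ k coarse ⟩
    k * (τ * a) ∎)
  reindex : ∀ {n k} (ts : Forest n) → Decides ts S k a d →
    C * C * ((2 * c) ^ 8) ^ 4 * a ≤ k * d →
    ∀ κ m n′ → κ + m ≡ k → n′ + m ≡ n → 1 ≤ κ → κ * M ≤ k → k ≤ κ * (2 * M) →
    (k * d) ^ k ≤ S ^ (4 * (8 * p) * (2 * M)) * a ^ k
  reindex ts D large κ m n′ refl refl 1≤κ lo hi =
    large-error-fixed {n′} {m} {κ} {ts} c p M C τ 1≤c 1≤M 1≤τ C≥ 2048≤ 3^p≤ c≥ D coarse 1≤κ lo hi large
  reduce : (∃ λ κ → κ * M ≤ k × k < suc κ * M) → (k * d) ^ k ≤ S ^ (4 * (8 * p) * (2 * M)) * a ^ k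
  reduce (zero  , _  , hi) = contradiction (≤-trans hi (≤-trans (≤-reflexive (*-identityˡ M)) M≤k)) (<-irrefl refl)
  reduce (κ@(suc κ′) , lo , hi) =
    reindex ts D large κ (k ∸ κ) (n ∸ (k ∸ κ)) (m+[n∸m]≡n κ≤k)
      (m∸n+n≡m (≤-trans (m∸n≤m k κ) (Decides.k≤n D))) (s≤s z≤n) lo (begin
        k                ≤⟨ <⇒≤ hi ⟩
        M + κ * M        ≤⟨ +-monoˡ-≤ (κ * M) (m≤m+n M (κ′ * M)) ⟩
        κ * M + κ * M    ≡⟨ lemma′ κ M ⟩
        κ * (2 * M)      ∎)
    where
    κ≤k : κ ≤ k
    κ≤k = ≤-trans (m≤m*n κ M {{>-nonZero 1≤M}}) lo
    lemma′ : ∀ a b → a * b + a * b ≡ a * (2 * b)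
    lemma′ = solve-∀

-- When k/δ is bounded, so is k, and a fixed power of S ≥ 2 beats K^k.
bounded : ∀ {n} {ts : Forest n} {S k a d} K → Decides ts S k a d → k * d ≤ K * a → (k * d) ^ k ≤ S ^ (K * K) * a ^ k
bounded {S = S} {k} {a} {d} K D le = begin
  (k * d) ^ k          ≤⟨ ^-monoˡ-≤ k le ⟩
  (K * a) ^ k          ≡⟨ ^-distribʳ-* k K a ⟩
  K ^ k * a ^ k        ≤⟨ *-monoˡ-≤ (a ^ k) (^-monoˡ-≤ k (≤-trans (≤-trans (n≤1+n K) (1+n≤h^n 2 ≤-refl K)) (^-monoˡ-≤ K 2≤S))) ⟩
  (S ^ K) ^ k * a ^ k  ≡⟨ cong (_* a ^ k) (^-*-assoc S K k) ⟩
  S ^ (K * k) * a ^ k  ≤⟨ *-monoˡ-≤ (a ^ k) (^-monoʳ-≤ S {{>-nonZero (≤-trans (s≤s z≤n) 2≤S)}} (*-monoʳ-≤ K k≤K)) ⟩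
  S ^ (K * K) * a ^ k  ∎
  where
  open Decides D
  open ≤-Reasoning
  2≤S = nontrivial D
  k≤K : k ≤ K
  k≤K = *-cancelʳ-≤ k K d (≤-trans le (*-monoʳ-≤ K (≤-trans (m≤n*m a 3) 3a≤d)))

module Assembly (c p M C τ K : ℕ) (48≤c : 48 ≤ c) (1≤M : 1 ≤ M) (240*64≤C : 240 * 64 ≤ C) (1≤τ : 1 ≤ τ) (τ≥ : 96 * 120 ≤ τ) (C≥ : τ * (2 * M) ≤ C)
  (2048≤ : 2048 ≤ 2 ^ p) (3^p≤ : 3 ^ p * 9 ≤ 2 * (M * M)) (c≥ : 32 * 3 ^ p ≤ c * 2 ^ p)
  (K≥ : C * C * ((2 * c) ^ 8) ^ 4 ≤ K) where

  exponent : ℕ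
  exponent = K * K + (4 * (8 * p) * (2 * M) + 4 * (8 * 1))

  1≤exponent : 1 ≤ exponent
  1≤exponent = ≤-trans (s≤s z≤n) (≤-trans (m≤n+m (4 * (8 * 1)) (4 * (8 * p) * (2 * M))) (m≤n+m _ (K * K)))

  module _ {n} {ts : Forest n} {S k a d} (D : Decides ts S k a d) where

    raise : ∀ {e x} → e ≤ exponent → x ≤ S ^ e * a ^ k → x ≤ S ^ exponent * a ^ k
    raise e≤ x≤ = ≤-trans x≤ (*-monoˡ-≤ (a ^ k) (^-monoʳ-≤ S {{>-nonZero (≤-trans (s≤s z≤n) (nontrivial D))}} e≤))

    forest-bound : (k * d) ^ k ≤ S ^ exponent * a ^ k
    forest-bound with k * d ≤? K * a | 96 * (120 * a) ≤? d
    ... | yes le | _ = raise (m≤m+n (K * K) _) (bounded K D le)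
    ... | no gt | yes tiny = raise (≤-trans (m≤n+m (4 * (8 * 1)) (4 * (8 * p) * (2 * M))) (m≤n+m _ (K * K)))
      (small-error c C 48≤c 240*64≤C D tiny (≤-trans (*-monoˡ-≤ a K≥) (<⇒≤ (≰⇒> gt))))
    ... | no gt | no coarse = raise (≤-trans (m≤m+n (4 * (8 * p) * (2 * M)) (4 * (8 * 1))) (m≤n+m _ (K * K)))
      (large-error c p M C τ (≤-trans (s≤s z≤n) 48≤c) 1≤M 1≤τ C≥ 2048≤ 3^p≤ c≥ D (≤-trans (<⇒≤ (≰⇒> coarse)) (≤-trans (≤-reflexive (sym (*-assoc 96 120 a))) (*-monoˡ-≤ a τ≥)))
        (≤-trans (*-monoˡ-≤ a K≥) (<⇒≤ (≰⇒> gt))))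

-- Clearing denominators

toℚ-mkℚ : ∀ n → toℚ n ≡ mkℚ (+ n) 0 (Coprimality.sym (Coprimality.1-coprimeTo n))
toℚ-mkℚ n = ℚ.↥p/↧p≡p (mkℚ (+ n) 0 (Coprimality.sym (Coprimality.1-coprimeTo n)))

toℚ-+ : ∀ m n → toℚ (m + n) ≡ toℚ m +ℚ toℚ n
toℚ-+ m n rewrite toℚ-mkℚ m | toℚ-mkℚ n =
  sym (cong (_/ 1) (cong₂ ℤ._+_ (ℤ.*-identityʳ (+ m)) (ℤ.*-identityʳ (+ n))))

toℚ-* : ∀ m n → toℚ (m * n) ≡ toℚ m *ℚ toℚ n
toℚ-* m n rewrite toℚ-mkℚ m | toℚ-mkℚ n = cong (_/ 1) (ℤ.pos-* m n)

toℚ-mono-≤ : ∀ {m n} → m ≤ n → toℚ m ≤ℚ toℚ n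
toℚ-mono-≤ {m} {n} m≤n rewrite toℚ-mkℚ m | toℚ-mkℚ n =
  *≤* (subst₂ ℤ._≤_ (sym (ℤ.*-identityʳ (+ m))) (sym (ℤ.*-identityʳ (+ n))) (ℤ.+≤+ m≤n))

toℚ-cancel-≤ : ∀ {m n} → toℚ m ≤ℚ toℚ n → m ≤ n
toℚ-cancel-≤ {m} {n} le rewrite toℚ-mkℚ m | toℚ-mkℚ n =
  ℤ.drop‿+≤+ (subst₂ ℤ._≤_ (ℤ.*-identityʳ (+ m)) (ℤ.*-identityʳ (+ n)) (ℚ.drop-*≤* le))

toℚ-cancel-< : ∀ {m n} → toℚ m <ℚ toℚ n → m < n
toℚ-cancel-< {m} {n} lt = ≰⇒> λ n≤m → ℚ.<-irrefl refl (ℚ.<-≤-trans lt (toℚ-mono-≤ n≤m))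

toℚ-nonNegative : ∀ n → ℚ.NonNegative (toℚ n)
toℚ-nonNegative n rewrite toℚ-mkℚ n = _

toℚ-positive : ∀ {n} → 1 ≤ n → ℚ.Positive (toℚ n)
toℚ-positive {suc n} _ rewrite toℚ-mkℚ (suc n) = _

numerator denominator : ℚ → ℕ
numerator p = ℤ.∣ ↥ p ∣
denominator p = ↧ₙ p

1≤denominator : ∀ p → 1 ≤ denominator p
1≤denominator (mkℚ _ _ _) = s≤s z≤n

numerator-positive : ∀ p → 0ℚ <ℚ p → 1 ≤ numerator p
numerator-positive (mkℚ (+ suc _) _ _)  _  = s≤s z≤n
numerator-positive (mkℚ (+ zero) _ _)   lt = contradiction (ℚ.drop-*<* lt) λ { (ℤ.+<+ ()) }
numerator-positive (mkℚ -[1+ _ ] _ _)   lt = contradiction (ℚ.drop-*<* lt) λ ()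

-- `numerator` is an absolute value; the hypothesis excludes negative p.
clear-denominator : ∀ p → 0ℚ <ℚ p → toℚ (denominator p) *ℚ p ≡ toℚ (numerator p)
clear-denominator (mkℚ -[1+ _ ] _ _)     lt = contradiction (ℚ.drop-*<* lt) λ ()
clear-denominator p@(mkℚ (+ a) d-1 _) lt rewrite toℚ-mkℚ (suc d-1) | toℚ-mkℚ a =
  ℚ.toℚᵘ-injective (ℚᵘ.≃-trans (ℚ.toℚᵘ-homo-* (mkℚ (+ suc d-1) 0 (Coprimality.sym (Coprimality.1-coprimeTo (suc d-1)))) p) (ℚᵘ.*≡* (begin
    + suc d-1 ℤ.* + a ℤ.* + 1    ≡⟨ ℤ.*-identityʳ (+ suc d-1 ℤ.* + a) ⟩
    + suc d-1 ℤ.* + a            ≡⟨ ℤ.*-comm (+ suc d-1) (+ a) ⟩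
    + a ℤ.* + suc d-1            ≡⟨ cong (λ x → + a ℤ.* + x) (sym (*-identityˡ (suc d-1))) ⟩
    + a ℤ.* + (1 * suc d-1)      ∎)))
  where open ≡-Reasoning

sumIf : ∀ {n} → (PDT n → Bool) → RPDT n → ℚ
sumIf g []            = 0ℚ
sumIf g ((p , t) ∷ R) = (if g t then p else 0ℚ) +ℚ sumIf g R

totalWeight-sumIf : ∀ {n} (R : RPDT n) → totalWeight R ≡ sumIf (λ _ → true) R
totalWeight-sumIf []            = refl
totalWeight-sumIf ((p , _) ∷ R) = cong (p +ℚ_) (totalWeight-sumIf R)

probCorrect-sumIf : ∀ {n} P (R : RPDT n) x → probCorrect P R x ≡ sumIf (λ t → not (eval t x xor P x)) R
probCorrect-sumIf P []            x = refl
probCorrect-sumIf P ((p , t) ∷ R) x = cong ((if not (eval t x xor P x) then p else 0ℚ) +ℚ_) (probCorrect-sumIf P R x)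

commonDenominator : ∀ {n} → RPDT n → ℕ
commonDenominator []            = 1
commonDenominator ((p , _) ∷ R) = denominator p * commonDenominator R

1≤commonDenominator : ∀ {n} (R : RPDT n) → 1 ≤ commonDenominator R
1≤commonDenominator []            = ≤-refl
1≤commonDenominator ((p , _) ∷ R) = *-mono-≤ (1≤denominator p) (1≤commonDenominator R)

rescale : ∀ {n} → ℕ → Forest n → Forest n
rescale e = map λ (b , t) → e * b , t

∑-rescale : ∀ {n} e (ts : Forest n) (f : PDT n → ℕ) →
  ∑ (rescale e ts) (λ (b , t) → b * f t) ≡ e * ∑ ts (λ (b , t) → b * f t)
∑-rescale e ts f = trans (∑-map _ ts _)
  (trans (∑-cong ts λ (b , t) → *-assoc e b (f t)) (∑-*ˡ ts e _))

clear : ∀ {n} → RPDT n → Forest n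
clear []            = []
clear ((p , t) ∷ R) = (numerator p * commonDenominator R , t) ∷ rescale (denominator p) (clear R)

clear-sumIf : ∀ {n} (g : PDT n → Bool) R → AllPositive R →
  toℚ (∑ (clear R) λ (b , t) → b * ⟦ g t ⟧) ≡ toℚ (commonDenominator R) *ℚ sumIf g R
clear-sumIf g []            _              = sym (ℚ.*-zeroʳ (toℚ 1))
clear-sumIf g ((p , t) ∷ R) (p>0 , pos) = begin
  toℚ (numerator p * D * ⟦ g t ⟧ + ∑ (rescale d (clear R)) (λ (b , t) → b * ⟦ g t ⟧))
    ≡⟨ cong (λ x → toℚ (numerator p * D * ⟦ g t ⟧ + x)) (∑-rescale d (clear R) (⟦_⟧ ∘ g)) ⟩
  toℚ (numerator p * D * ⟦ g t ⟧ + d * s)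
    ≡⟨ trans (toℚ-+ (numerator p * D * ⟦ g t ⟧) (d * s)) (cong₂ _+ℚ_ (one (g t))
         (trans (toℚ-* d s) (cong (toℚ d *ℚ_) (clear-sumIf g R pos)))) ⟩
  toℚ d *ℚ toℚ D *ℚ (if g t then p else 0ℚ) +ℚ toℚ d *ℚ (toℚ D *ℚ sumIf g R)
    ≡⟨ cong (toℚ d *ℚ toℚ D *ℚ (if g t then p else 0ℚ) +ℚ_) (sym (ℚ.*-assoc (toℚ d) (toℚ D) (sumIf g R))) ⟩
  toℚ d *ℚ toℚ D *ℚ (if g t then p else 0ℚ) +ℚ toℚ d *ℚ toℚ D *ℚ sumIf g R
    ≡⟨ ℚ.*-distribˡ-+ (toℚ d *ℚ toℚ D) _ _ ⟨
  toℚ d *ℚ toℚ D *ℚ sumIf g ((p , t) ∷ R)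
    ≡⟨ cong (_*ℚ sumIf g ((p , t) ∷ R)) (sym (toℚ-* d D)) ⟩
  toℚ (d * D) *ℚ sumIf g ((p , t) ∷ R) ∎
  where
  open ≡-Reasoning
  D = commonDenominator R
  d = denominator p
  s = ∑ (clear R) λ (b , t) → b * ⟦ g t ⟧
  one : ∀ b → toℚ (numerator p * D * ⟦ b ⟧) ≡ toℚ d *ℚ toℚ D *ℚ (if b then p else 0ℚ)
  one false = trans (cong toℚ (*-zeroʳ (numerator p * D))) (sym (ℚ.*-zeroʳ (toℚ d *ℚ toℚ D)))
  one true  = begin
    toℚ (numerator p * D * 1)        ≡⟨ cong toℚ (*-identityʳ (numerator p * D)) ⟩
    toℚ (numerator p * D)            ≡⟨ toℚ-* (numerator p) D ⟩
    toℚ (numerator p) *ℚ toℚ D       ≡⟨ cong (_*ℚ toℚ D) (sym (clear-denominator p p>0)) ⟩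
    toℚ d *ℚ p *ℚ toℚ D              ≡⟨ ℚ.*-assoc (toℚ d) p (toℚ D) ⟩
    toℚ d *ℚ (p *ℚ toℚ D)            ≡⟨ cong (toℚ d *ℚ_) (ℚ.*-comm p (toℚ D)) ⟩
    toℚ d *ℚ (toℚ D *ℚ p)            ≡⟨ ℚ.*-assoc (toℚ d) (toℚ D) p ⟨
    toℚ d *ℚ toℚ D *ℚ p              ∎

clear-sizes : ∀ {n} (R : RPDT n) S → rsize R ≤ S → ∑ (clear R) (λ (b , t) → b * size t) ≤ S * totalℕ (clear R)
clear-sizes []            S le = z≤n
clear-sizes ((p , t) ∷ R) S le = begin
  b * size t + ∑ (rescale d (clear R)) (λ (b , t) → b * size t)
    ≡⟨ cong (_+_ (b * size t)) (∑-rescale d (clear R) size) ⟩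
  b * size t + d * ∑ (clear R) (λ (b , t) → b * size t)
    ≤⟨ +-mono-≤ (*-monoʳ-≤ b (m⊔n≤o⇒m≤o (size t) (rsize R) le)) (*-monoʳ-≤ d (clear-sizes R S (m⊔n≤o⇒n≤o (size t) (rsize R) le))) ⟩
  b * S + d * (S * totalℕ (clear R))
    ≡⟨ lemma b S d (totalℕ (clear R)) ⟩
  S * (b + d * totalℕ (clear R))
    ≡⟨ cong (λ x → S * (b + x)) (sym (trans (∑-map _ (clear R) proj₁) (∑-*ˡ (clear R) d proj₁))) ⟩
  S * (b + totalℕ (rescale d (clear R))) ∎
  where
  open ≤-Reasoning
  b = numerator p * commonDenominator R
  d = denominator p
  lemma : ∀ b S d t → b * S + d * (S * t) ≡ S * (b + d * t)
  lemma = solve-∀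

correct : ∀ {n} → (F2^ n → Bool) → Forest n → F2^ n → ℕ
correct P ts x = ∑ ts λ (b , t) → b * ⟦ not (eval t x xor P x) ⟧

correct-true : ∀ {n} P (ts : Forest n) x → P x ≡ true → correct P ts x ≡ accepts ts x
correct-true P ts x e rewrite e = ∑-cong ts λ (b , t) → cong (λ c → b * ⟦ c ⟧) (lemma (eval t x))
  where
  lemma : ∀ c → not (c xor true) ≡ c
  lemma false = refl
  lemma true  = refl

correct-false : ∀ {n} P (ts : Forest n) x → P x ≡ false → correct P ts x + accepts ts x ≡ totalℕ ts
correct-false P ts x e rewrite e = trans (sym (∑-+ ts _ _)) (∑-cong ts λ (b , t) → lemma b (eval t x))
  where
  lemma : ∀ b c → b * ⟦ not (c xor false) ⟧ + b * ⟦ c ⟧ ≡ b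
  lemma b false = trans (cong₂ _+_ (*-identityʳ b) (*-zeroʳ b)) (+-identityʳ b)
  lemma b true  = trans (cong₂ _+_ (*-zeroʳ b) (*-identityʳ b)) refl

H-true : ∀ {n k} (x : F2^ n) → weight x ≡ k → H n k x ≡ true
H-true {n} {k} x e = Equivalence.to T-≡ (≡⇒≡ᵇ (weight x) k e)

H-false : ∀ {n k} (x : F2^ n) → weight x ≢ k → H n k x ≡ false
H-false {n} {k} x ne with weight x ≡ᵇ k in eq
... | false = refl
... | true  = contradiction (≡ᵇ⇒≡ (weight x) k (Equivalence.from T-≡ eq)) ne

module _ {n k δ} (δ>0 : 0ℚ <ℚ δ) (δ≤⅓ : δ ≤ℚ (+ 1 / 3)) (1≤k : 1 ≤ k)
         (k²<δn : toℚ (k * k) <ℚ (δ *ℚ toℚ n)) (R : RPDT n) (isR : IsRandPDT (H n k) δ R) where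

  private
    a d D : ℕ
    a = numerator δ
    d = denominator δ
    D = commonDenominator R
    ts : Forest n
    ts = clear R

    total≡D : totalℕ ts ≡ D
    total≡D = ≤-antisym (toℚ-cancel-≤ (ℚ.≤-reflexive same)) (toℚ-cancel-≤ (ℚ.≤-reflexive (sym same)))
      where
      open ≡-Reasoning
      same : toℚ (totalℕ ts) ≡ toℚ D
      same = begin
        toℚ (totalℕ ts)                         ≡⟨ cong toℚ (∑-cong ts λ (b , _) → sym (*-identityʳ b)) ⟩
        toℚ (∑ ts λ (b , _) → b * ⟦ true ⟧)     ≡⟨ clear-sumIf (λ _ → true) R (proj₁ (proj₁ isR)) ⟩
        toℚ D *ℚ sumIf (λ _ → true) R           ≡⟨ cong (toℚ D *ℚ_) (trans (sym (totalWeight-sumIf R)) (proj₂ (proj₁ isR))) ⟩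
        toℚ D *ℚ 1ℚ                             ≡⟨ ℚ.*-identityʳ (toℚ D) ⟩
        toℚ D                                   ∎

    mostly-correct : ∀ x → d * totalℕ ts ≤ d * correct (H n k) ts x + a * totalℕ ts
    mostly-correct x = toℚ-cancel-≤ (begin
      toℚ (d * totalℕ ts)
        ≡⟨ trans (toℚ-* d (totalℕ ts)) (cong (λ x → toℚ d *ℚ toℚ x) total≡D) ⟩
      toℚ d *ℚ toℚ D
        ≡⟨ ℚ.*-identityʳ (toℚ d *ℚ toℚ D) ⟨
      toℚ d *ℚ toℚ D *ℚ 1ℚ
        ≤⟨ ℚ.*-monoˡ-≤-nonNeg (toℚ d *ℚ toℚ D) {{subst ℚ.NonNegative (toℚ-* d D) (toℚ-nonNegative (d * D))}} 1≤c+δ ⟩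
      toℚ d *ℚ toℚ D *ℚ (c +ℚ δ)
        ≡⟨ solve 4 (λ d D c δ → d :* D :* (c :+ δ) := d :* (D :* c) :+ d :* δ :* D) refl (toℚ d) (toℚ D) c δ ⟩
      toℚ d *ℚ (toℚ D *ℚ c) +ℚ toℚ d *ℚ δ *ℚ toℚ D
        ≡⟨ cong₂ (λ x y → toℚ d *ℚ x +ℚ y *ℚ toℚ D)
             (trans (cong (toℚ D *ℚ_) (probCorrect-sumIf (H n k) R x)) (sym (clear-sumIf _ R (proj₁ (proj₁ isR)))))
             (clear-denominator δ δ>0) ⟩
      toℚ d *ℚ toℚ (correct (H n k) ts x) +ℚ toℚ a *ℚ toℚ D
        ≡⟨ cong₂ _+ℚ_ (toℚ-* d (correct (H n k) ts x)) (toℚ-* a D) ⟨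
      toℚ (d * correct (H n k) ts x) +ℚ toℚ (a * D)
        ≡⟨ toℚ-+ (d * correct (H n k) ts x) (a * D) ⟨
      toℚ (d * correct (H n k) ts x + a * D)
        ≡⟨ cong (λ y → toℚ (d * correct (H n k) ts x + a * y)) total≡D ⟨
      toℚ (d * correct (H n k) ts x + a * totalℕ ts) ∎)
      where
      open ℚ.≤-Reasoning
      open +-*-Solver using (solve; con; _:+_; _:*_; _:-_; _:=_)
      c = probCorrect (H n k) R x
      1≤c+δ : 1ℚ ≤ℚ c +ℚ δ
      1≤c+δ = begin
        1ℚ                 ≡⟨ solve 1 (λ δ → con 1ℚ := con 1ℚ :- δ :+ δ) refl δ ⟩
        1ℚ -ℚ δ +ℚ δ       ≤⟨ ℚ.+-monoˡ-≤ δ (proj₂ isR x) ⟩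
        c +ℚ δ             ∎

  decides : Decides ts (rsize R) k a d
  decides = record
    { 1≤a      = numerator-positive δ δ>0
    ; 3a≤d     = third δ δ>0 δ≤⅓
    ; 1≤k      = 1≤k
    ; k²d<an   = toℚ-cancel-< (begin-strict
        toℚ (k * k * d)            ≡⟨ toℚ-* (k * k) d ⟩
        toℚ (k * k) *ℚ toℚ d       <⟨ ℚ.*-monoˡ-<-pos (toℚ d) {{toℚ-positive (1≤denominator δ)}} k²<δn ⟩
        δ *ℚ toℚ n *ℚ toℚ d        ≡⟨ solve 3 (λ δ n d → δ :* n :* d := d :* δ :* n) refl δ (toℚ n) (toℚ d) ⟩
        toℚ d *ℚ δ *ℚ toℚ n        ≡⟨ cong (_*ℚ toℚ n) (clear-denominator δ δ>0) ⟩
        toℚ a *ℚ toℚ n             ≡⟨ toℚ-* a n ⟨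
        toℚ (a * n)                ∎)
    ; sizes    = clear-sizes R (rsize R) ≤-refl
    ; 1≤total  = subst (1 ≤_) (sym total≡D) (1≤commonDenominator R)
    ; complete = λ x e → subst (λ y → d * totalℕ ts ≤ d * y + a * totalℕ ts)
        (correct-true (H n k) ts x (H-true x e)) (mostly-correct x)
    ; sound    = λ x ne → +-cancelˡ-≤ (d * correct (H n k) ts x) _ _ (≤-trans (≤-reflexive
        (trans (sym (*-distribˡ-+ d (correct (H n k) ts x) (accepts ts x))) (cong (d *_) (correct-false (H n k) ts x (H-false x ne)))))
        (mostly-correct x))
    }
    where
    open ℚ.≤-Reasoning
    open +-*-Solver using (solve; con; _:+_; _:*_; _:-_; _:=_)
    third : ∀ δ → 0ℚ <ℚ δ → δ ≤ℚ (+ 1 / 3) → 3 * numerator δ ≤ denominator δ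
    third (mkℚ (+ a) d-1 _) _  le = ℤ.drop‿+≤+ (subst₂ ℤ._≤_
      (trans (sym (ℤ.pos-* a 3)) (cong +_ (*-comm a 3))) (ℤ.*-identityˡ (+ suc d-1)) (ℚ.drop-*≤* le))
    third (mkℚ -[1+ _ ] _ _) lt _ = contradiction (ℚ.drop-*<* lt) λ ()

^ℚ-clear : ∀ δ → 0ℚ <ℚ δ → ∀ k → (δ ^ℚ k) *ℚ toℚ (denominator δ ^ k) ≡ toℚ (numerator δ ^ k)
^ℚ-clear δ δ>0 zero    = ℚ.*-identityˡ (toℚ 1)
^ℚ-clear δ δ>0 (suc k) = begin
  δ *ℚ (δ ^ℚ k) *ℚ toℚ (d * d ^ k)             ≡⟨ cong (δ *ℚ (δ ^ℚ k) *ℚ_) (toℚ-* d (d ^ k)) ⟩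
  δ *ℚ (δ ^ℚ k) *ℚ (toℚ d *ℚ toℚ (d ^ k))      ≡⟨ solve 4 (λ x y z w → x :* y :* (z :* w) := z :* x :* (y :* w)) refl δ (δ ^ℚ k) (toℚ d) (toℚ (d ^ k)) ⟩
  toℚ d *ℚ δ *ℚ ((δ ^ℚ k) *ℚ toℚ (d ^ k))      ≡⟨ cong₂ _*ℚ_ (clear-denominator δ δ>0) (^ℚ-clear δ δ>0 k) ⟩
  toℚ (numerator δ) *ℚ toℚ (numerator δ ^ k)   ≡⟨ toℚ-* (numerator δ) (numerator δ ^ k) ⟨
  toℚ (numerator δ ^ suc k)                    ∎
  where
  open ≡-Reasoning
  open +-*-Solver using (solve; con; _:+_; _:*_; _:-_; _:=_)
  d = denominator δ

restore-denominator : ∀ δ → 0ℚ <ℚ δ → ∀ k s → (k * denominator δ) ^ k ≤ s * numerator δ ^ k → toℚ (k ^ k) ≤ℚ (toℚ s *ℚ (δ ^ℚ k))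
restore-denominator δ δ>0 k s le = ℚ.*-cancelʳ-≤-pos (toℚ (d ^ k)) {{toℚ-positive (>-nonZero⁻¹ (d ^ k) {{m^n≢0 d k {{>-nonZero (1≤denominator δ)}}}})}} (begin
  toℚ (k ^ k) *ℚ toℚ (d ^ k)               ≡⟨ toℚ-* (k ^ k) (d ^ k) ⟨
  toℚ (k ^ k * d ^ k)                      ≡⟨ cong toℚ (^-distribʳ-* k k d) ⟨
  toℚ ((k * d) ^ k)                        ≤⟨ toℚ-mono-≤ le ⟩
  toℚ (s * numerator δ ^ k)                ≡⟨ toℚ-* s (numerator δ ^ k) ⟩
  toℚ s *ℚ toℚ (numerator δ ^ k)           ≡⟨ cong (toℚ s *ℚ_) (sym (^ℚ-clear δ δ>0 k)) ⟩
  toℚ s *ℚ ((δ ^ℚ k) *ℚ toℚ (d ^ k))       ≡⟨ ℚ.*-assoc (toℚ s) (δ ^ℚ k) (toℚ (d ^ k)) ⟨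
  toℚ s *ℚ (δ ^ℚ k) *ℚ toℚ (d ^ k)         ∎)
  where
  open ℚ.≤-Reasoning
  d = denominator δ

-- The size bound, first with constants kept as parameters

size-lower-bound : (c p M C τ K : ℕ) → 48 ≤ c → 1 ≤ M → 240 * 64 ≤ C → 1 ≤ τ → 96 * 120 ≤ τ → τ * (2 * M) ≤ C →
  2048 ≤ 2 ^ p → 3 ^ p * 9 ≤ 2 * (M * M) → 32 * 3 ^ p ≤ c * 2 ^ p → C * C * ((2 * c) ^ 8) ^ 4 ≤ K →
  Σ ℕ λ m → (1 ≤ m) × ((n k : ℕ) (δ : ℚ) → 0ℚ <ℚ δ → δ ≤ℚ (+ 1 / 3) → 1 ≤ k
    → toℚ (k * k) <ℚ (δ *ℚ toℚ n)
    → (R : RPDT n) → IsRandPDT (H n k) δ R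
    → toℚ (k ^ k) ≤ℚ (toℚ (rsize R ^ m) *ℚ (δ ^ℚ k)))
size-lower-bound c p M C τ K h₁ h₂ h₃ h₄ h₅ h₆ h₇ h₈ h₉ h₁₀ =
  exponent , 1≤exponent , λ n k δ δ>0 δ≤⅓ 1≤k k²<δn R isR →
    restore-denominator δ δ>0 k (rsize R ^ exponent)
      (forest-bound (decides δ>0 δ≤⅓ 1≤k k²<δn R isR))
  where open Assembly c p M C τ K h₁ h₂ h₃ h₄ h₅ h₆ h₇ h₈ h₉ h₁₀

-- 11520 = 96 · 120 separates small from large errors; p = 11 runs are the least with 8 · 128 · 2 ≤ 2^p,
-- and fixing all but about k / 1024 of the ones gives 9 · 3^p ≤ 2 · 1024².
theorem1p9 : Σ ℕ λ m → (1 ≤ m) × ((n k : ℕ) (δ : ℚ) → 0ℚ <ℚ δ → δ ≤ℚ (+ 1 / 3) → 1 ≤ k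
    → toℚ (k * k) <ℚ (δ *ℚ toℚ n)
    → (R : RPDT n) → IsRandPDT (H n k) δ R
    → toℚ (k ^ k) ≤ℚ (toℚ (rsize R ^ m) *ℚ (δ ^ℚ k)))
theorem1p9 = size-lower-bound 3000 11 1024 (11520 * 2048) 11520 (11520 * 2048 * (11520 * 2048) * ((2 * 3000) ^ 8) ^ 4)
  (from-yes (48 ≤? 3000)) (from-yes (1 ≤? 1024)) (from-yes (240 * 64 ≤? 11520 * 2048)) (from-yes (1 ≤? 11520)) ≤-refl ≤-refl
  ≤-refl (from-yes (3 ^ 11 * 9 ≤? 2 * (1024 * 1024))) (from-yes (32 * 3 ^ 11 ≤? 3000 * 2 ^ 11)) ≤-refl
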